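{- Let $D=(V,A)$ be a digraph with arc capacities $c\in\mathbb{R}^A_{\ge 0}$ and balance function $b\colon V\to\mathbb{R}$, $\sum_{v\in V}b(v)=0$, that admits a feasible (fractional) $b$-transshipment. If $d_{\max}\le\frac{c_{\min}}{4}$, where $d_{\max}=\max_{t\in S^- }|b(t)|$ and $c_{\min}=\min_{a\in A}c_a$, then all demands can be routed unsplittably in four rounds.
   Context: A vertex $v$ is a source if $b(v)>0$ and a sink if $b(v)<0$; $S^+$, $S^-$ are the sets of sources and sinks. A $b$-transshipment is a vector $x\in\mathbb{R}^A_{\ge0}$ whose outflow minus inflow at each vertex $v$ equals $b(v)$; it is feasible if $x_a\le c_a$ for all $a\in A$. An unsplittable transshipment is a transshipment together with a path decomposition consisting only of source--sink paths, with at most one path for each source--sink pair. Routing all demands unsplittably in $r$ rounds means: the sink set $S^-$ is partitioned into $r$ (possibly empty) subsets, and for each subset there is a feasible unsplittable transshipment (respecting the capacities $c$) that sends flow from sources to exactly the sinks $t$ of that subset, delivering the full demand $|b(t)|$ to each, such that for every source $s\in S^+$ the total flow sent from $s$ over all rounds equals $b(s)$. -}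

module Defs where

open import Level using (0ℓ) renaming (suc to lsuc)
open import Algebra.Bundles using (CommutativeRing)
open import Algebra.Construct.NaturalChoice.Max using ()
open import Data.Bool.Base using (if_then_else_)
open import Data.Fin.Base using (Fin)
open import Data.Fin.Properties using (_≟_)
open import Data.List.Base using (List; []; _∷_; map; filter; allFin)
open import Data.List.Extrema using ()
open import Data.List.Membership.DecPropositional using ()
open import Data.List.Relation.Unary.Unique.Propositional using (Unique)
open import Data.Maybe using (Maybe; maybe′; Is-just)
open import Data.Nat.Base using (ℕ)
open import Data.Product.Base using (∃; ∃-syntax; _×_; _,_)
open import Function.Base using (_∘_)
open import Function.Bundles using (_⇔_)
open import Relation.Binary.Bundles using (DecTotalOrder)
open import Relation.Binary.Construct.Closure.ReflexiveTransitive using (Star; ε; _◅_)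
open import Relation.Binary.Core using (Rel)
open import Relation.Binary.Definitions using (Decidable)
import Relation.Binary.Construct.NonStrictToStrict as NonStrictToStrict
open import Relation.Binary.PropositionalEquality.Core using (_≡_)
open import Relation.Binary.Structures using (IsDecTotalOrder)
open import Relation.Nullary.Decidable.Core using (does)
open import Relation.Nullary.Negation.Core using (¬_)
open import Relation.Unary using (Pred)

-- The standard library has no real numbers, so ℝ is given axiomatically, as a
-- (Dedekind) complete ordered field; classically this determines it up to
-- isomorphism. The order is decidable, as it is for the classical reals.
record RealNumbers : Set (lsuc 0ℓ) where
  infix  4 _≤_
  infix  8 _⁻¹
  infixl 7 _/_
  field
    commutativeRing : CommutativeRing 0ℓ 0ℓ

  open CommutativeRing commutativeRing public
    using (Carrier; _≈_; _+_; _*_; _-_; -_; 0#; 1#)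

  field
    _≤_             : Rel Carrier 0ℓ
    isDecTotalOrder : IsDecTotalOrder _≈_ _≤_
    +-monoˡ-≤       : ∀ z {x y} → x ≤ y → x + z ≤ y + z
    *-nonNeg        : ∀ {x y} → 0# ≤ x → 0# ≤ y → 0# ≤ x * y
    0≉1             : ¬ 0# ≈ 1#
    -- total for convenience; nothing is assumed about the value at 0#
    _⁻¹             : Carrier → Carrier
    ⁻¹-inverseʳ     : ∀ x → ¬ x ≈ 0# → x * x ⁻¹ ≈ 1#

  IsUpperBound : Pred Carrier 0ℓ → Pred Carrier 0ℓ
  IsUpperBound P u = ∀ x → P x → x ≤ u

  field
    supremum : (P : Pred Carrier 0ℓ) → ∃ P → ∃ (IsUpperBound P) →
               ∃[ s ] IsUpperBound P s × (∀ u → IsUpperBound P u → s ≤ u)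

  decTotalOrder : DecTotalOrder 0ℓ 0ℓ 0ℓ
  decTotalOrder = record { isDecTotalOrder = isDecTotalOrder }

  open DecTotalOrder decTotalOrder public using (totalOrder; _≤?_)
    renaming (_≟_ to _≈?_)
  open NonStrictToStrict _≈_ _≤_ public using (_<_)

  _<?_ : Decidable _<_
  _<?_ = NonStrictToStrict.<-decidable _≈_ _≤_ _≈?_ _≤?_

  open Algebra.Construct.NaturalChoice.Max totalOrder public using (_⊔_)

  open import Algebra.Properties.CommutativeMonoid.Sum
    (CommutativeRing.+-commutativeMonoid commutativeRing) public using (sum)

  ∣_∣ : Carrier → Carrier
  ∣ x ∣ = x ⊔ (- x)

  _/_ : Carrier → Carrier → Carrier
  x / y = x * y ⁻¹

  4# : Carrier
  4# = 1# + 1# + 1# + 1#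

-- Parallel arcs and loops are allowed.
record Digraph (n m : ℕ) : Set where
  field
    tail head : Fin m → Fin n

module Paths {n m : ℕ} (D : Digraph n m) where
  open Digraph D

  Arc : Rel (Fin n) 0ℓ
  Arc u v = ∃[ a ] tail a ≡ u × head a ≡ v

  Walk : Rel (Fin n) 0ℓ
  Walk = Star Arc

  vertices : ∀ {u v} → Walk u v → List (Fin n)
  vertices {u} ε       = u ∷ []
  vertices {u} (_ ◅ w) = u ∷ vertices w

  arcs : ∀ {u v} → Walk u v → List (Fin m)
  arcs ε             = []
  arcs ((a , _) ◅ w) = a ∷ arcs w

  record Path (s t : Fin n) : Set where
    field
      walk   : Walk s t
      simple : Unique (vertices walk)

module Transshipments (ℝ : RealNumbers) where
  open RealNumbers ℝ

  module _ {n : ℕ} (b : Fin n → Carrier) where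

    Source Sink : Pred (Fin n) 0ℓ
    Source v = 0# < b v
    Sink   v = b v < 0#

    -- Equal to 0# when there are no sinks.
    dmax : Carrier
    dmax = Data.List.Extrema.max totalOrder 0#
             (map (∣_∣ ∘ b) (filter (λ t → b t <? 0#) (allFin n)))

  minimum : List Carrier → Carrier
  minimum []       = 0#
  minimum (x ∷ xs) = Data.List.Extrema.min totalOrder x xs

  -- The value 0# for m = 0 is harmless: without arcs, every b admitting a
  -- b-transshipment vanishes, so that dmax b ≈ 0#.
  cmin : {m : ℕ} → (Fin m → Carrier) → Carrier
  cmin {m} c = minimum (map c (allFin m))

  module _ {n m : ℕ} (D : Digraph n m) where
    open Digraph D
    open Paths D
    open Data.List.Membership.DecPropositional (_≟_ {m}) using (_∈?_)

    outflow inflow : (Fin m → Carrier) → Fin n → Carrier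
    outflow x v = sum λ a → if does (tail a ≟ v) then x a else 0#
    inflow  x v = sum λ a → if does (head a ≟ v) then x a else 0#

    record IsTransshipment (b : Fin n → Carrier) (x : Fin m → Carrier) : Set where
      field
        nonNegative : ∀ a → 0# ≤ x a
        balanced    : ∀ v → outflow x v - inflow x v ≈ b v

    Feasible : (c x : Fin m → Carrier) → Set
    Feasible c x = ∀ a → x a ≤ c a

    record PathFlow (s t : Fin n) : Set where
      field
        path     : Path s t
        value    : Carrier
        positive : 0# < value

      flowOn : Fin m → Carrier
      flowOn a = if does (a ∈? arcs (Path.walk path)) then value else 0#

    -- Indexing the path flows by pairs of vertices encodes that there is at
    -- most one path for each source–sink pair.
    record UnsplittableTransshipment (b : Fin n → Carrier) : Set where
      field
        flow            : Fin m → Carrier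
        isTransshipment : IsTransshipment b flow
        route           : ∀ s t → Maybe (PathFlow s t)
        source–sink     : ∀ s t → Is-just (route s t) → Source b s × Sink b t
        decomposition   : ∀ a → flow a ≈
          sum λ s → sum λ t → maybe′ (λ p → PathFlow.flowOn p a) 0# (route s t)

      amount : Fin n → Fin n → Carrier
      amount s t = maybe′ PathFlow.value 0# (route s t)

      sentFrom deliveredTo : Fin n → Carrier
      sentFrom    s = sum λ t → amount s t
      deliveredTo t = sum λ s → amount s t

    record RoutableInRounds (c : Fin m → Carrier) (b : Fin n → Carrier) (r : ℕ) : Set where
      field
        -- The i-th class of the partition consists of the sinks t with
        -- round t ≡ i; the value of round at other vertices is irrelevant.
        round          : Fin n → Fin r
        balance        : Fin r → Fin n → Carrier
        transshipment  : ∀ i → UnsplittableTransshipment (balance i)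

      module Round (i : Fin r) = UnsplittableTransshipment (transshipment i)

      field
        feasible       : ∀ i → Feasible c (Round.flow i)
        sources        : ∀ i s → Source (balance i) s → Source b s
        sinks          : ∀ i t → Sink (balance i) t ⇔ (Sink b t × round t ≡ i)
        fullDemand     : ∀ i t → Sink (balance i) t → Round.deliveredTo i t ≈ ∣ b t ∣
        fullSupply     : ∀ s → Source b s → sum (λ i → Round.sentFrom i s) ≈ b s

-- Two of the four rounds suffice. Replace every vertex by two copies, let each copy of an arc carry half of
-- the given flow, feed both copies of a source from a supply vertex and drain both copies of a sink into a
-- demand vertex. Rounding this flow as in the algorithm of Dinitz, Garg and Goemans moves every terminal
-- backwards along arcs that carry its demand; it exceeds the flow on each arc by at most d_max. Supply at a
-- dead end (no entering and a single leaving arc), which would block that algorithm, is moved forward instead.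
-- So supplies are met exactly: a terminal may be served by several sources, but meets each of them at one
-- vertex only. A sink is assigned to the copy into which its terminal moves. What it received before through
-- the other copy passed its demand vertex; the arcs so used form disjoint trees, one per sink, hence
-- transferring it to the assigned copy costs at most another d_max per arc.
-- In total x/2 + 2 d_max ≤ c/2 + c/2.
module Submission where

open import Defs
open import Algebra.Bundles using (CommutativeRing)
import Algebra.Properties.Ring
open import Data.Bool.Base using (Bool; true; false; if_then_else_; not)
import Data.Bool.Properties as Bool
open import Data.Empty using (⊥; ⊥-elim)
open import Data.Fin.Base as Fin using (Fin; zero; suc; toℕ)
open import Data.Fin.Patterns using (0F; 1F; 2F; 3F)
import Data.Fin.Properties as Fin
open import Data.List.Base using (List; []; _∷_; _∷ʳ_; map; filter; allFin)
import Data.List.Extrema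
import Data.List.Membership.DecPropositional as DecMembership
open import Data.List.Membership.Propositional using (_∈_; _∉_)
open import Data.List.Membership.Propositional.Properties using (∈-map⁺; ∈-filter⁺; ∈-allFin)
open import Data.List.Relation.Unary.All as All using ([]; _∷_)
open import Data.List.Relation.Unary.AllPairs using ([]; _∷_)
open import Data.List.Relation.Unary.Any using (here; there)
open import Data.List.Relation.Unary.Unique.Propositional using (Unique)
open import Data.Maybe using (Maybe; just; nothing; maybe′; Is-just)
open import Data.Nat.Base as ℕ using (ℕ; zero; suc; s≤s; z≤n)
import Data.Nat.Properties as ℕ
open import Data.Product.Base using (∃; ∃-syntax; Σ-syntax; _×_; _,_; proj₁; proj₂)
open import Data.Sum.Base as Sum using (_⊎_; inj₁; inj₂; [_,_]′)
open import Function.Base using (_∘_; id)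
open import Function.Bundles using (mk⇔)
open import Relation.Binary.Bundles using (Poset)
open import Relation.Binary.Definitions using (tri<; tri≈; tri>)
open import Relation.Binary.PropositionalEquality.Core as ≡ using (_≡_; _≢_)
open import Relation.Binary.Structures using (IsDecTotalOrder)
open import Relation.Nullary.Decidable using (Dec; yes; no; does; _×-dec_; _⊎-dec_; _→-dec_; ¬?)
open import Relation.Nullary.Negation.Core using (¬_; contradiction)

-- Ordered fields, finite sums and indicators

-- The excess of one `Δ` per arc has a single origin. As long as the head of an arc is unflagged,
-- its residual flow is never raised, and whatever crosses it is paid for out of that flow. An arc
-- into a flagged vertex may be raised, but it is crossed at most once more: a terminal retreats
-- over it only if its demand equals the flow, and advancing supply takes all of the flow, which is
-- then at most `Δ`. Either way the arc dies, and dead arcs never revive. Several sources create an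
-- obstacle absent from the single-source case. A terminal that meets a supply smaller than its
-- demand goes on with the rest, which may be less than the flow on an arc into its vertex; the
-- chain of inequalities that bounds flagged arcs by `Δ` then breaks. Such irregular terminals must
-- stay rare, which is why a match is made only at vertices lacking entering or leaving arcs. The
-- flow is made acyclic beforehand for two reasons: every alternating cycle then lowers some arc,
-- and retreating terminals descend in a fixed ranking, so that the algorithm stops.

module OrderedField (ℝ : RealNumbers) where
  open RealNumbers ℝ public
  private module R = CommutativeRing commutativeRing
  open R public using (+-cong; +-congˡ; +-congʳ; *-congˡ; *-congʳ; +-assoc; +-comm; *-comm;
    +-identityˡ; +-identityʳ; *-identityˡ; *-identityʳ; zeroˡ; zeroʳ; distribˡ; distribʳ; -‿inverseʳ; -‿inverseˡ; -‿cong)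
    renaming (refl to ≈-refl; sym to ≈-sym; trans to ≈-trans; reflexive to ≈-reflexive)
  private module O = IsDecTotalOrder isDecTotalOrder
  open O public using () renaming (refl to ≤-refl; reflexive to ≤-reflexive; trans to ≤-trans; antisym to ≤-antisym; total to ≤-total)
  open import Algebra.Properties.CommutativeMonoid.Sum R.+-commutativeMonoid public
    using (sum-cong-≋; ∑-distrib-+; ∑-comm; sum-replicate-zero)
  open import Algebra.Solver.Ring.NaturalCoefficients.Default R.commutativeSemiring public using (solve; _:=_; _:+_; _:*_; con)
  poset : Poset _ _ _
  poset = record { isPartialOrder = O.isPartialOrder }
  open import Relation.Binary.Reasoning.PartialOrder poset public
    hiding (start; stop)

  private module RP = Algebra.Properties.Ring R.ring

  +-cancelʳ : ∀ z {x y} → x + z ≈ y + z → x ≈ y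
  +-cancelʳ z {x} {y} = RP.+-cancelʳ z x y

  minus-plus : ∀ x y → (x - y) + y ≈ x
  minus-plus x y = ≈-trans (+-assoc x (- y) y) (≈-trans (+-congˡ (-‿inverseˡ y)) (+-identityʳ x))

  +-minus : ∀ {x y z} → x ≈ y + z → x - z ≈ y
  +-minus {x} {y} {z} p = +-cancelʳ z (≈-trans (minus-plus x z) p)

  +-monoʳ-≤ : ∀ z {x y} → x ≤ y → z + x ≤ z + y
  +-monoʳ-≤ z {x} {y} p = begin
    z + x ≈⟨ +-comm z x ⟩
    x + z ≤⟨ +-monoˡ-≤ z p ⟩
    y + z ≈⟨ +-comm y z ⟩
    z + y ∎

  +-mono-≤ : ∀ {x y u v} → x ≤ y → u ≤ v → x + u ≤ y + v
  +-mono-≤ {y = y} {u} p q = ≤-trans (+-monoˡ-≤ u p) (+-monoʳ-≤ y q)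

  +-cancelʳ-≤ : ∀ z {x y} → x + z ≤ y + z → x ≤ y
  +-cancelʳ-≤ z {x} {y} p = begin
    x ≈⟨ +-minus ≈-refl ⟨
    (x + z) - z ≤⟨ +-monoˡ-≤ (- z) p ⟩
    (y + z) - z ≈⟨ +-minus ≈-refl ⟩
    y ∎

  +-nonNeg : ∀ {x y} → 0# ≤ x → 0# ≤ y → 0# ≤ x + y
  +-nonNeg {x} {y} p q = begin
    0# ≈⟨ +-identityˡ 0# ⟨
    0# + 0# ≤⟨ +-mono-≤ p q ⟩
    x + y ∎

  x≤x+y : ∀ {x y} → 0# ≤ y → x ≤ x + y
  x≤x+y {x} {y} p = begin
    x ≈⟨ +-identityʳ x ⟨
    x + 0# ≤⟨ +-monoʳ-≤ x p ⟩
    x + y ∎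

  y≤x+y : ∀ {x y} → 0# ≤ x → y ≤ x + y
  y≤x+y {x} {y} p = ≤-trans (x≤x+y p) (≤-reflexive (+-comm y x))

  0≤x-y : ∀ {x y} → y ≤ x → 0# ≤ x - y
  0≤x-y {x} {y} p = +-cancelʳ-≤ y (begin
    0# + y ≈⟨ +-identityˡ y ⟩
    y ≤⟨ p ⟩
    x ≈⟨ minus-plus x y ⟨
    (x - y) + y ∎)

  x-y≤x : ∀ {x y} → 0# ≤ y → x - y ≤ x
  x-y≤x {x} {y} p = begin
    x - y ≤⟨ x≤x+y p ⟩
    (x - y) + y ≈⟨ minus-plus x y ⟩
    x ∎

  0<x-y : ∀ {x y} → y < x → 0# < x - y
  0<x-y {x} {y} (p , q) = 0≤x-y p , λ e → q (begin-equality
    y ≈⟨ +-identityˡ y ⟨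
    0# + y ≈⟨ +-congʳ e ⟩
    (x - y) + y ≈⟨ minus-plus x y ⟩
    x ∎)

  ≤⊎> : ∀ x y → x ≤ y ⊎ y < x
  ≤⊎> x y with x ≤? y
  ... | yes p = inj₁ p
  ... | no ¬p with ≤-total x y
  ...   | inj₁ p = contradiction p ¬p
  ...   | inj₂ q = inj₂ (q , λ e → ¬p (≤-reflexive (≈-sym e)))

  <⇒≱ : ∀ {x y} → x < y → ¬ y ≤ x
  <⇒≱ (p , q) r = q (≤-antisym p r)

  <-≤-trans : ∀ {x y z} → x < y → y ≤ z → x < z
  <-≤-trans (p , q) r = ≤-trans p r , λ e → q (≤-antisym p (≤-trans r (≤-reflexive (≈-sym e))))

  ≤-<-trans : ∀ {x y z} → x ≤ y → y < z → x < z
  ≤-<-trans r (p , q) = ≤-trans r p , λ e → q (≤-antisym p (≤-trans (≤-reflexive (≈-sym e)) r))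

  0≮0 : ∀ {x} → x ≈ 0# → ¬ 0# < x
  0≮0 e (_ , ne) = ne (≈-sym e)

  ≮⇒≈0 : ∀ {x} → 0# ≤ x → ¬ 0# < x → x ≈ 0#
  ≮⇒≈0 {x} p q with 0# ≈? x
  ... | yes e = ≈-sym e
  ... | no ne = contradiction (p , ne) q

  *-monoˡ-≤ : ∀ {z} → 0# ≤ z → ∀ {x y} → x ≤ y → z * x ≤ z * y
  *-monoˡ-≤ {z} p {x} {y} q = begin
    z * x ≤⟨ x≤x+y (*-nonNeg p (0≤x-y q)) ⟩
    z * x + z * (y - x) ≈⟨ distribˡ z x (y - x) ⟨
    z * (x + (y - x)) ≈⟨ *-congˡ (≈-trans (+-comm x _) (minus-plus y x)) ⟩
    z * y ∎

  0≤1 : 0# ≤ 1#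
  0≤1 with ≤-total 0# 1#
  ... | inj₁ p = p
  ... | inj₂ q = ≤-trans (*-nonNeg 0≤-1 0≤-1) (≤-reflexive -1*-1)
    where
    0≤-1 : 0# ≤ - 1#
    0≤-1 = ≤-trans (0≤x-y q) (≤-reflexive (+-identityˡ _))
    -1*-1 : - 1# * - 1# ≈ 1#
    -1*-1 = ≈-trans (≈-sym (RP.-‿distribˡ-* 1# (- 1#))) (≈-trans (-‿cong (*-identityˡ _)) (RP.-‿involutive 1#))

  -- opaque, so that summands can be inferred by unification

  opaque
    ∑ : ∀ {k} → (Fin k → Carrier) → Carrier
    ∑ = sum

    ∑-def : ∀ {k} (f : Fin k → Carrier) → ∑ f ≡ sum f
    ∑-def f = ≡.refl

    ∑-cong : ∀ {k} {f g : Fin k → Carrier} → (∀ i → f i ≈ g i) → ∑ f ≈ ∑ g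
    ∑-cong = sum-cong-≋

    ∑-mono : ∀ {k} {f g : Fin k → Carrier} → (∀ i → f i ≤ g i) → ∑ f ≤ ∑ g
    ∑-mono {zero}  p = ≤-refl
    ∑-mono {suc k} p = +-mono-≤ (p zero) (∑-mono (p ∘ suc))

    ∑-zero : ∀ {k} {f : Fin k → Carrier} → (∀ i → f i ≈ 0#) → ∑ f ≈ 0#
    ∑-zero {k} p = ≈-trans (∑-cong p) (sum-replicate-zero k)

    ∑-nonNeg : ∀ {k} {f : Fin k → Carrier} → (∀ i → 0# ≤ f i) → 0# ≤ ∑ f
    ∑-nonNeg {zero}  p = ≤-refl
    ∑-nonNeg {suc k} p = +-nonNeg (p zero) (∑-nonNeg (p ∘ suc))

    term≤∑ : ∀ {k} {f : Fin k → Carrier} → (∀ i → 0# ≤ f i) → ∀ i → f i ≤ ∑ f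
    term≤∑ p zero    = x≤x+y (∑-nonNeg (p ∘ suc))
    term≤∑ p (suc i) = ≤-trans (term≤∑ (p ∘ suc) i) (y≤x+y (p zero))

    two-terms≤∑ : ∀ {k} {f : Fin k → Carrier} → (∀ i → 0# ≤ f i) → ∀ {i j} → i ≢ j → f i + f j ≤ ∑ f
    two-terms≤∑ p {zero}  {zero}  ne = contradiction ≡.refl ne
    two-terms≤∑ p {zero}  {suc j} ne = +-monoʳ-≤ _ (term≤∑ (p ∘ suc) j)
    two-terms≤∑ p {suc i} {zero}  ne = ≤-trans (≤-reflexive (+-comm _ _)) (+-monoʳ-≤ _ (term≤∑ (p ∘ suc) i))
    two-terms≤∑ p {suc i} {suc j} ne =
      ≤-trans (two-terms≤∑ (p ∘ suc) (ne ∘ ≡.cong suc)) (y≤x+y (p zero))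

    ∑-pos⇒∃ : ∀ {k} {f : Fin k → Carrier} → (∀ i → 0# ≤ f i) → 0# < ∑ f → ∃[ i ] 0# < f i
    ∑-pos⇒∃ {f = f} p q with Fin.any? (λ i → 0# <? f i)
    ... | yes r = r
    ... | no ¬r = contradiction q (0≮0 (∑-zero λ i → ≮⇒≈0 (p i) (λ s → ¬r (i , s))))

    ∑-pos : ∀ {k} {f : Fin k → Carrier} → (∀ i → 0# ≤ f i) → ∀ i → 0# < f i → 0# < ∑ f
    ∑-pos p i q = <-≤-trans q (term≤∑ p i)

    ∑-*ˡ : ∀ {k} (c : Carrier) (f : Fin k → Carrier) → ∑ (λ i → c * f i) ≈ c * ∑ f
    ∑-*ˡ {zero}  c f = ≈-sym (zeroʳ c)
    ∑-*ˡ {suc k} c f = ≈-trans (+-congˡ (∑-*ˡ c (f ∘ suc))) (≈-sym (distribˡ c _ _))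

    ∑-+ : ∀ {k} (f g : Fin k → Carrier) → ∑ (λ i → f i + g i) ≈ ∑ f + ∑ g
    ∑-+ = ∑-distrib-+

    ∑-swap : ∀ {k l} (f : Fin k → Fin l → Carrier) → ∑ (λ i → ∑ (f i)) ≈ ∑ (λ j → ∑ (λ i → f i j))
    ∑-swap = ∑-comm

    ∑-empty : (f : Fin 0 → Carrier) → ∑ f ≈ 0#
    ∑-empty f = ≈-refl

    ∑-suc : ∀ {k} (f : Fin (suc k) → Carrier) → ∑ f ≈ f zero + ∑ (f ∘ suc)
    ∑-suc f = ≈-refl

  when : ∀ {P : Set} → Dec P → Carrier → Carrier
  when d y = if does d then y else 0#

  module _ {P : Set} where
    when-yes : (d : Dec P) → P → ∀ {y} → when d y ≡ y
    when-yes (yes _) p = ≡.refl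
    when-yes (no ¬p) p = contradiction p ¬p

    when-no : (d : Dec P) → ¬ P → ∀ {y} → when d y ≡ 0#
    when-no (yes p) ¬p = contradiction p ¬p
    when-no (no _)  ¬p = ≡.refl

    when-cong : (d : Dec P) → ∀ {y z} → (P → y ≈ z) → when d y ≈ when d z
    when-cong (yes p) e = e p
    when-cong (no _)  e = ≈-refl

    when-mono : (d : Dec P) → ∀ {y z} → (P → y ≤ z) → when d y ≤ when d z
    when-mono (yes p) e = e p
    when-mono (no _)  e = ≤-refl

    when-nonNeg : (d : Dec P) → ∀ {y} → 0# ≤ y → 0# ≤ when d y
    when-nonNeg (yes _) p = p
    when-nonNeg (no _)  p = ≤-refl

    when≤ : (d : Dec P) → ∀ {y} → 0# ≤ y → when d y ≤ y
    when≤ (yes _) p = ≤-refl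
    when≤ (no _)  p = p

    when-0 : (d : Dec P) → when d 0# ≈ 0#
    when-0 (yes _) = ≈-refl
    when-0 (no _)  = ≈-refl

    when-≈0 : (d : Dec P) → ∀ {y} → (P → y ≈ 0#) → when d y ≈ 0#
    when-≈0 d e = ≈-trans (when-cong d e) (when-0 d)

    when-+ : (d : Dec P) → ∀ y z → when d (y + z) ≈ when d y + when d z
    when-+ (yes _) y z = ≈-refl
    when-+ (no _)  y z = ≈-sym (+-identityˡ 0#)

    *-when : (d : Dec P) → ∀ y z → y * when d z ≈ when d (y * z)
    *-when (yes _) y z = ≈-refl
    *-when (no _)  y z = zeroʳ y

    when-∑ : ∀ {k} (d : Dec P) (f : Fin k → Carrier) → when d (∑ f) ≈ ∑ (λ i → when d (f i))
    when-∑ (yes _) f = ≈-refl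
    when-∑ (no _) f = ≈-sym (∑-zero λ _ → ≈-refl)

    when-pos : (d : Dec P) → ∀ {y} → 0# < when d y → P × 0# < y
    when-pos (yes p) q = p , q
    when-pos (no _)  q = contradiction ≈-refl (proj₂ q)

  when-⇔ : ∀ {P Q : Set} (d : Dec P) (e : Dec Q) → (P → Q) → (Q → P) → ∀ {y} → when d y ≡ when e y
  when-⇔ (yes p) e f g = ≡.sym (when-yes e (f p))
  when-⇔ (no ¬p) e f g = ≡.sym (when-no e (¬p ∘ g))

  ∑-pick : ∀ {k} (j : Fin k) (f : Fin k → Carrier) → ∑ (λ i → when (i Fin.≟ j) (f i)) ≈ f j
  ∑-pick zero f = ≈-trans (∑-suc _) (≈-trans (+-congˡ (∑-zero λ _ → ≈-refl)) (+-identityʳ _))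
  ∑-pick (suc j) f = ≈-trans (∑-suc _) (≈-trans (+-identityˡ _) (≈-trans (∑-cong λ i →
    ≈-reflexive (when-⇔ (suc i Fin.≟ suc j) (i Fin.≟ j) Fin.suc-injective (≡.cong suc))) (∑-pick j (f ∘ suc))))

-- Balances at vertices and shifts along signed cycles.

module AtVertices (ℝ : RealNumbers) where
  open OrderedField ℝ

  opaque
    -- One operator serves for outflow (`g = tl`), inflow (`g = hd`) and for the supply or demand
    -- currently placed at a vertex (`g = sp`, `g = tp`).
    at : ∀ {N k} → (Fin k → Fin N) → (Fin k → Carrier) → Fin N → Carrier
    at g x v = ∑ λ i → when (g i Fin.≟ v) (x i)

    at-def : ∀ {N k} (g : Fin k → Fin N) x v → at g x v ≡ ∑ λ i → when (g i Fin.≟ v) (x i)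
    at-def g x v = ≡.refl

  module _ {N k : ℕ} {g : Fin k → Fin N} where
    opaque
      unfolding at

      at-cong : ∀ {x y} → (∀ i → x i ≈ y i) → ∀ v → at g x v ≈ at g y v
      at-cong p v = ∑-cong λ i → when-cong (g i Fin.≟ v) λ _ → p i

      at-+ : ∀ x y v → at g (λ i → x i + y i) v ≈ at g x v + at g y v
      at-+ x y v = ≈-trans (∑-cong λ i → when-+ (g i Fin.≟ v) (x i) (y i)) (∑-+ _ _)

      at-∑ : ∀ {l} (x : Fin l → Fin k → Carrier) v → at g (λ i → ∑ λ j → x j i) v ≈ ∑ λ j → at g (x j) v
      at-∑ x v = ≈-trans (∑-cong λ i → when-∑ (g i Fin.≟ v) _) (∑-swap _)

      at-* : ∀ c x v → at g (λ i → c * x i) v ≈ c * at g x v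
      at-* c x v = ≈-trans (∑-cong λ i → ≈-sym (*-when (g i Fin.≟ v) c (x i))) (∑-*ˡ c _)

      at-zero : ∀ {x v} → (∀ i → g i ≡ v → x i ≈ 0#) → at g x v ≈ 0#
      at-zero p = ∑-zero λ i → when-≈0 (g i Fin.≟ _) (p i)

      at-nonNeg : ∀ {x} → (∀ i → 0# ≤ x i) → ∀ v → 0# ≤ at g x v
      at-nonNeg p v = ∑-nonNeg λ i → when-nonNeg (g i Fin.≟ v) (p i)

      at-mono : ∀ {x y} → (∀ i → x i ≤ y i) → ∀ v → at g x v ≤ at g y v
      at-mono p v = ∑-mono λ i → when-mono (g i Fin.≟ v) λ _ → p i

      at-term : ∀ {x} → (∀ i → 0# ≤ x i) → ∀ {i v} → g i ≡ v → x i ≤ at g x v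
      at-term {x} p {i} {v} e = begin
        x i ≈⟨ ≈-reflexive (when-yes (g i Fin.≟ v) e) ⟨
        when (g i Fin.≟ v) (x i) ≤⟨ term≤∑ (λ j → when-nonNeg (g j Fin.≟ v) (p j)) i ⟩
        at g x v ∎

      at-two-terms : ∀ {x} → (∀ i → 0# ≤ x i) → ∀ {i j v} → i ≢ j → g i ≡ v → g j ≡ v → x i + x j ≤ at g x v
      at-two-terms {x} p {i} {j} {v} ne e f = begin
        x i + x j
          ≈⟨ +-cong (≈-reflexive (when-yes (g i Fin.≟ v) e)) (≈-reflexive (when-yes (g j Fin.≟ v) f)) ⟨
        when (g i Fin.≟ v) (x i) + when (g j Fin.≟ v) (x j)
          ≤⟨ two-terms≤∑ (λ l → when-nonNeg (g l Fin.≟ v) (p l)) ne ⟩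
        at g x v ∎

      at-pos⇒∃ : ∀ {x} → (∀ i → 0# ≤ x i) → ∀ {v} → 0# < at g x v → ∃[ i ] g i ≡ v × 0# < x i
      at-pos⇒∃ p {v} q with ∑-pos⇒∃ (λ i → when-nonNeg (g i Fin.≟ v) (p i)) q
      ... | i , r = i , when-pos (g i Fin.≟ v) r

      at-pos : ∀ {x} → (∀ i → 0# ≤ x i) → ∀ {i v} → g i ≡ v → 0# < x i → 0# < at g x v
      at-pos p e q = <-≤-trans q (at-term p e)

      at-pick : ∀ i y v → at g (λ j → when (j Fin.≟ i) y) v ≈ when (g i Fin.≟ v) y
      at-pick i y v = ≈-trans (∑-cong swap) (∑-pick i _)
        where
        swap : ∀ j → when (g j Fin.≟ v) (when (j Fin.≟ i) y) ≈ when (j Fin.≟ i) (when (g j Fin.≟ v) y)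
        swap j with j Fin.≟ i
        ... | yes _ = ≈-refl
        ... | no  _ = when-0 (g j Fin.≟ v)

      at-single : ∀ {x} → (∀ i → 0# ≤ x i) → ∀ {v} i → (∀ j → g j ≡ v → 0# < x j → j ≡ i) → at g x v ≤ x i
      at-single {x} p {v} i u = begin
        at g x v ≤⟨ ∑-mono le ⟩
        ∑ (λ j → when (j Fin.≟ i) (x j)) ≈⟨ ∑-pick i x ⟩
        x i ∎
        where
        le : ∀ j → when (g j Fin.≟ v) (x j) ≤ when (j Fin.≟ i) (x j)
        le j with g j Fin.≟ v | j Fin.≟ i
        ... | yes _ | yes _ = ≤-refl
        ... | no  _ | yes _ = p j
        ... | no  _ | no  _ = ≤-refl
        ... | yes e | no ne = ≤-reflexive (≮⇒≈0 (p j) (ne ∘ u j e))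

  -- The effect on a flow of pushing along a signed cycle.
  data Change : Set where
    raised lowered fixed : Change

  [_]↑ [_]↓ : Change → Carrier
  [ raised ]↑ = 1#
  [ _ ]↑ = 0#
  [ lowered ]↓ = 1#
  [ _ ]↓ = 0#

  shift : Change → Carrier → Carrier → Carrier
  shift raised  ε y = y + ε
  shift lowered ε y = y - ε
  shift fixed   ε y = y

  shift-eq : ∀ c ε y → shift c ε y + ε * [ c ]↓ ≈ y + ε * [ c ]↑
  shift-eq raised  ε y = ≈-trans (≈-trans (+-congˡ (zeroʳ ε)) (+-identityʳ _)) (+-congˡ (≈-sym (*-identityʳ ε)))
  shift-eq lowered ε y = ≈-trans (≈-trans (+-congˡ (*-identityʳ ε)) (minus-plus y ε))
                           (≈-sym (≈-trans (+-congˡ (zeroʳ ε)) (+-identityʳ y)))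
  shift-eq fixed   ε y = ≈-refl

  ↑-nonNeg : ∀ c → 0# ≤ [ c ]↑
  ↑-nonNeg raised  = 0≤1
  ↑-nonNeg lowered = ≤-refl
  ↑-nonNeg fixed   = ≤-refl

  -- The signed incidences of the cycle cancel at every vertex. Both sides are kept free of
  -- subtraction, so that the semiring solver applies.
  Circulation : ∀ {N K} → (Fin K → Fin N) → (Fin K → Fin N) → (Fin K → Change) → Set
  Circulation tl hd δ = ∀ v → at tl ([_]↓ ∘ δ) v + at hd ([_]↑ ∘ δ) v ≈ at hd ([_]↓ ∘ δ) v + at tl ([_]↑ ∘ δ) v

  module _ {N K : ℕ} (tl hd : Fin K → Fin N) (δ : Fin K → Change) (circ : Circulation tl hd δ) where

    shift-conserves : ∀ ε x v →
      at tl (λ e → shift (δ e) ε (x e)) v + at hd x v ≈ at tl x v + at hd (λ e → shift (δ e) ε (x e)) v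
    shift-conserves ε x v = +-cancelʳ (ε * T↓ + ε * H↑) (begin-equality
      (T′ + H) + (ε * T↓ + ε * H↑) ≈⟨ solve 4 (λ a b c d → (a :+ b) :+ (c :+ d) := (a :+ c) :+ (b :+ d)) ≈-refl T′ H (ε * T↓) (ε * H↑) ⟩
      (T′ + ε * T↓) + (H + ε * H↑) ≈⟨ +-cong (eq tl) (≈-sym (eq hd)) ⟩
      (T + ε * T↑) + (H′ + ε * H↓) ≈⟨ solve 5 (λ t u h k m → (t :+ m :* u) :+ (h :+ m :* k) := (t :+ h) :+ m :* (k :+ u)) ≈-refl T T↑ H′ H↓ ε ⟩
      (T + H′) + ε * (H↓ + T↑) ≈⟨ +-congˡ (*-congˡ (≈-sym (circ v))) ⟩
      (T + H′) + ε * (T↓ + H↑) ≈⟨ +-congˡ (distribˡ ε T↓ H↑) ⟩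
      (T + H′) + (ε * T↓ + ε * H↑) ∎)
      where
      x′ : Fin K → Carrier
      x′ e = shift (δ e) ε (x e)
      T T′ H H′ T↓ T↑ H↓ H↑ : Carrier
      T = at tl x v
      T′ = at tl x′ v
      H = at hd x v
      H′ = at hd x′ v
      T↓ = at tl ([_]↓ ∘ δ) v
      T↑ = at tl ([_]↑ ∘ δ) v
      H↓ = at hd ([_]↓ ∘ δ) v
      H↑ = at hd ([_]↑ ∘ δ) v
      eq : ∀ g → at g x′ v + ε * at g ([_]↓ ∘ δ) v ≈ at g x v + ε * at g ([_]↑ ∘ δ) v
      eq g = begin-equality
        at g x′ v + ε * at g ([_]↓ ∘ δ) v ≈⟨ +-congˡ (≈-sym (at-* ε ([_]↓ ∘ δ) v)) ⟩
        at g x′ v + at g (λ e → ε * [ δ e ]↓) v ≈⟨ ≈-sym (at-+ x′ (λ e → ε * [ δ e ]↓) v) ⟩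
        at g (λ e → x′ e + ε * [ δ e ]↓) v ≈⟨ at-cong (λ e → shift-eq (δ e) ε (x e)) v ⟩
        at g (λ e → x e + ε * [ δ e ]↑) v ≈⟨ at-+ x (λ e → ε * [ δ e ]↑) v ⟩
        at g x v + at g (λ e → ε * [ δ e ]↑) v ≈⟨ +-congˡ (at-* ε ([_]↑ ∘ δ) v) ⟩
        at g x v + ε * at g ([_]↑ ∘ δ) v ∎

    -- If all changed arcs were raised, they would form a directed circulation: each raised arc has
    -- a raised arc entering its tail. Following these backwards decreases the rank forever.
    lowered-exists : (rank : Fin N → ℕ) → (∀ e → δ e ≢ fixed → rank (tl e) ℕ.< rank (hd e)) →
      (∃[ e ] δ e ≢ fixed) → ∃[ e ] δ e ≡ lowered
    lowered-exists rank up (e₀ , ne₀) with Fin.any? (λ e → lowered? (δ e))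
      where
      lowered? : ∀ c → Dec (c ≡ lowered)
      lowered? raised  = no λ ()
      lowered? lowered = yes ≡.refl
      lowered? fixed   = no λ ()
    ... | yes r = r
    ... | no ¬r = ⊥-elim (descend (suc (rank (tl e₀))) e₀ (nonfixed e₀ ne₀) ℕ.≤-refl)
      where
      nonfixed : ∀ e → δ e ≢ fixed → δ e ≡ raised
      nonfixed e ne with δ e in eq
      ... | raised  = ≡.refl
      ... | lowered = contradiction (e , eq) ¬r
      ... | fixed   = contradiction ≡.refl ne
      ↓≈0 : ∀ e → [ δ e ]↓ ≈ 0#
      ↓≈0 e with δ e in eq
      ... | raised  = ≈-refl
      ... | lowered = contradiction (e , eq) ¬r
      ... | fixed   = ≈-refl
      balance : ∀ v → at hd ([_]↑ ∘ δ) v ≈ at tl ([_]↑ ∘ δ) v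
      balance v = begin-equality
        at hd ([_]↑ ∘ δ) v ≈⟨ +-identityˡ _ ⟨
        0# + at hd ([_]↑ ∘ δ) v ≈⟨ +-congʳ (at-zero λ e _ → ↓≈0 e) ⟨
        at tl ([_]↓ ∘ δ) v + at hd ([_]↑ ∘ δ) v ≈⟨ circ v ⟩
        at hd ([_]↓ ∘ δ) v + at tl ([_]↑ ∘ δ) v ≈⟨ +-congʳ (at-zero λ e _ → ↓≈0 e) ⟩
        0# + at tl ([_]↑ ∘ δ) v ≈⟨ +-identityˡ _ ⟩
        at tl ([_]↑ ∘ δ) v ∎
      pos⇒raised : ∀ {c} → 0# < [ c ]↑ → c ≢ fixed
      pos⇒raised p ≡.refl = proj₂ p ≈-refl
      descend : ∀ r e → δ e ≡ raised → rank (tl e) ℕ.< r → ⊥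
      descend (suc r) e eq (s≤s lt)
        with at-pos⇒∃ {g = hd} (λ f → ↑-nonNeg (δ f)) {tl e}
               (<-≤-trans (at-pos {g = tl} (λ f → ↑-nonNeg (δ f)) {e} ≡.refl
                  (≡.subst (λ c → 0# < [ c ]↑) (≡.sym eq) (0≤1 , 0≉1)))
                 (≤-reflexive (≈-sym (balance (tl e)))))
      ... | f , hf , pf = descend r f (nonfixed f (pos⇒raised pf))
              (ℕ.<-≤-trans (≡.subst (λ v → rank (tl f) ℕ.< rank v) hf (up f (pos⇒raised pf))) lt)

-- Cycles traversing arcs forwards and backwards

module SignedCycles (ℝ : RealNumbers) {N K : ℕ} (tl hd : Fin K → Fin N)
  {St : Set} (arc : St → Fin K) (backward : St → Bool) (next : St → St) where
  open OrderedField ℝ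
  open AtVertices ℝ

  start stop : St → Fin N
  start σ = if backward σ then hd (arc σ) else tl (arc σ)
  stop  σ = if backward σ then tl (arc σ) else hd (arc σ)

  iter : ℕ → St → St
  iter zero    σ = σ
  iter (suc k) σ = iter k (next σ)

  iter-+ : ∀ k d σ → iter (k ℕ.+ d) σ ≡ iter d (iter k σ)
  iter-+ zero    d σ = ≡.refl
  iter-+ (suc k) d σ = iter-+ k d (next σ)

  iter-suc : ∀ k σ → iter (suc k) σ ≡ next (iter k σ)
  iter-suc zero    σ = ≡.refl
  iter-suc (suc k) σ = iter-suc k (next σ)

  pos : St → ℕ → Fin N
  pos σ k = start (iter k σ)

  -- The closed walk has `suc len` steps, hence is never empty. Only vertices repeat at the closing
  -- point; the state reached there may differ from `σ`.
  record SimpleOrbit : Set where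
    field
      σ      : St
      len    : ℕ
      closed : pos σ 0 ≡ pos σ (suc len)
      simple : ∀ (i j : Fin (suc len)) → pos σ (toℕ i) ≡ pos σ (toℕ j) → i ≡ j

  -- A vertex repeated inside the closed walk cuts out a strictly shorter closed walk, which is
  -- again an initial segment of an orbit of `next`.
  shorten : ∀ fuel σ len → len ℕ.< fuel → pos σ 0 ≡ pos σ (suc len) → SimpleOrbit
  shorten (suc fuel) σ len (s≤s lt) cl
    with Fin.any? (λ (i : Fin (suc len)) → Fin.any? (λ (j : Fin (suc len)) →
           (toℕ i ℕ.<? toℕ j) ×-dec (pos σ (toℕ i) Fin.≟ pos σ (toℕ j))))
  ... | no ¬r = record { σ = σ ; len = len ; closed = cl ; simple = simple }
    where
    simple : ∀ (i j : Fin (suc len)) → pos σ (toℕ i) ≡ pos σ (toℕ j) → i ≡ j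
    simple i j e with ℕ.<-cmp (toℕ i) (toℕ j)
    ... | tri< i<j _ _ = contradiction (i , j , i<j , e) ¬r
    ... | tri≈ _ i≡j _ = Fin.toℕ-injective i≡j
    ... | tri> _ _ j<i = contradiction (j , i , j<i , ≡.sym e) ¬r
  ... | yes (i , j , i<j , e) =
      shorten fuel (iter (toℕ i) σ) (toℕ j ℕ.∸ suc (toℕ i)) (ℕ.<-≤-trans shorter lt) cl′
    where
    shorter : toℕ j ℕ.∸ suc (toℕ i) ℕ.< len
    shorter = ℕ.<-≤-trans (ℕ.∸-monoʳ-< {toℕ j} {suc (toℕ i)} {0} (s≤s z≤n) i<j) (ℕ.≤-pred (Fin.toℕ<n j))
    eq : toℕ i ℕ.+ suc (toℕ j ℕ.∸ suc (toℕ i)) ≡ toℕ j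
    eq = ≡.trans (ℕ.+-suc (toℕ i) _) (ℕ.m+[n∸m]≡n i<j)
    cl′ : pos (iter (toℕ i) σ) 0 ≡ pos (iter (toℕ i) σ) (suc (toℕ j ℕ.∸ suc (toℕ i)))
    cl′ = ≡.trans e (≡.trans (≡.cong (pos σ) (≡.sym eq)) (≡.cong start (iter-+ (toℕ i) _ σ)))

  simpleOrbit : St → SimpleOrbit
  simpleOrbit σ with Fin.pigeonhole (ℕ.n<1+n N) (λ i → pos σ (toℕ i))
  ... | i , j , i<j , e = shorten _ (iter (toℕ i) σ) (toℕ j ℕ.∸ suc (toℕ i)) ℕ.≤-refl
      (≡.trans e (≡.trans (≡.cong (pos σ) (≡.sym eq)) (≡.cong start (iter-+ (toℕ i) _ σ))))
    where
    eq : toℕ i ℕ.+ suc (toℕ j ℕ.∸ suc (toℕ i)) ≡ toℕ j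
    eq = ≡.trans (ℕ.+-suc (toℕ i) _) (ℕ.m+[n∸m]≡n i<j)

  ∑-shift : ∀ n (f : ℕ → Carrier) → ∑ {n} (λ k → f (suc (toℕ k))) + f 0 ≈ ∑ {n} (λ k → f (toℕ k)) + f n
  ∑-shift zero    f = +-congʳ (≈-trans (∑-empty _) (≈-sym (∑-empty _)))
  ∑-shift (suc n) f = begin-equality
    ∑ {suc n} (λ k → f (suc (toℕ k))) + f 0 ≈⟨ +-congʳ (∑-suc _) ⟩
    (f 1 + ∑ {n} (λ k → f (suc (suc (toℕ k))))) + f 0 ≈⟨ solve 3 (λ a b c → (a :+ b) :+ c := c :+ (b :+ a)) ≈-refl (f 1) _ (f 0) ⟩
    f 0 + (∑ {n} (λ k → f (suc (suc (toℕ k)))) + f 1) ≈⟨ +-congˡ (∑-shift n (f ∘ suc)) ⟩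
    f 0 + (∑ {n} (λ k → f (suc (toℕ k))) + f (suc n)) ≈⟨ +-assoc _ _ _ ⟨
    (f 0 + ∑ {n} (λ k → f (suc (toℕ k)))) + f (suc n) ≈⟨ +-congʳ (∑-suc _) ⟨
    ∑ {suc n} (λ k → f (toℕ k)) + f (suc n) ∎

  -- `onward` forbids turning round on the arc just traversed; otherwise two opposite traversals
  -- could cancel and leave no cycle.
  module _ (link : ∀ σ → stop σ ≡ start (next σ))
           (onward : ∀ σ → arc (next σ) ≡ arc σ → backward (next σ) ≡ backward σ) where

    record Cycle : Set where
      field
        change      : Fin K → Change
        circulation : Circulation tl hd change
        raised⇒     : ∀ {e} → change e ≡ raised → ∃[ σ ] arc σ ≡ e × backward σ ≡ true
        lowered⇒    : ∀ {e} → change e ≡ lowered → ∃[ σ ] arc σ ≡ e × backward σ ≡ false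
        nontrivial  : ∃[ e ] change e ≢ fixed

    module _ (orbit : SimpleOrbit) where
      open SimpleOrbit orbit

      at-step : Fin (suc len) → St
      at-step k = iter (toℕ k) σ

      Uses : Bool → Fin K → Fin (suc len) → Set
      Uses d e k = backward (at-step k) ≡ d × arc (at-step k) ≡ e

      uses? : ∀ d e k → Dec (Uses d e k)
      uses? d e k = (backward (at-step k) Bool.≟ d) ×-dec (arc (at-step k) Fin.≟ e)

      used? : ∀ d e → Dec (∃ (Uses d e))
      used? d e = Fin.any? (uses? d e)

      start-true : ∀ {σ} → backward σ ≡ true → start σ ≡ hd (arc σ)
      start-true {σ} e rewrite e = ≡.refl
      start-false : ∀ {σ} → backward σ ≡ false → start σ ≡ tl (arc σ)
      start-false {σ} e rewrite e = ≡.refl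
      stop-true : ∀ {σ} → backward σ ≡ true → stop σ ≡ tl (arc σ)
      stop-true {σ} e rewrite e = ≡.refl
      stop-false : ∀ {σ} → backward σ ≡ false → stop σ ≡ hd (arc σ)
      stop-false {σ} e rewrite e = ≡.refl

      uses-unique : ∀ d e {i j} → Uses d e i → Uses d e j → i ≡ j
      uses-unique true  e {i} {j} (bi , ai) (bj , aj) = simple i j
        (≡.trans (start-true bi) (≡.trans (≡.cong hd (≡.trans ai (≡.sym aj))) (≡.sym (start-true bj))))
      uses-unique false e {i} {j} (bi , ai) (bj , aj) = simple i j
        (≡.trans (start-false bi) (≡.trans (≡.cong tl (≡.trans ai (≡.sym aj))) (≡.sym (start-false bj))))

      follows : ∀ k → stop (iter k σ) ≡ pos σ (suc k)
      follows k = ≡.trans (link (iter k σ)) (≡.cong start (≡.sym (iter-suc k σ)))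

      consecutive : ∀ (i j : Fin (suc len)) → stop (at-step i) ≡ start (at-step j) →
        toℕ j ≡ suc (toℕ i) ⊎ (toℕ i ≡ len × toℕ j ≡ 0)
      consecutive i j e with toℕ i ℕ.≟ len
      ... | yes i≡len = inj₂ (i≡len , ≡.cong toℕ (simple j zero (≡.trans (≡.sym e)
              (≡.trans (follows (toℕ i)) (≡.trans (≡.cong (pos σ ∘ suc) i≡len) (≡.sym closed))))))
      ... | no i≢len = inj₁ (≡.trans (≡.cong toℕ (simple j (Fin.fromℕ< lt) (≡.trans (≡.sym e)
              (≡.trans (follows (toℕ i)) (≡.cong (pos σ) (≡.sym (Fin.toℕ-fromℕ< lt))))))) (Fin.toℕ-fromℕ< lt))
        where
        lt : suc (toℕ i) ℕ.< suc len
        lt = s≤s (ℕ.≤∧≢⇒< (ℕ.≤-pred (Fin.toℕ<n i)) i≢len)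

      -- Two opposite traversals of `e` would follow each other in both cyclic orders. A transition
      -- inside the walk is excluded by `onward`, which says nothing about the closing one; but if
      -- both transitions were the closing one, the two steps would be the same.
      one-direction : ∀ e → ∃ (Uses true e) → ∃ (Uses false e) → ⊥
      one-direction e (i , bi , ai) (j , bj , aj) = go (consecutive i j i→j) (consecutive j i j→i)
        where
        i→j : stop (at-step i) ≡ start (at-step j)
        i→j = ≡.trans (stop-true bi) (≡.trans (≡.cong tl (≡.trans ai (≡.sym aj))) (≡.sym (start-false bj)))
        j→i : stop (at-step j) ≡ start (at-step i)
        j→i = ≡.trans (stop-false bj) (≡.trans (≡.cong hd (≡.trans aj (≡.sym ai))) (≡.sym (start-true bi)))
        turn : ∀ {k l : Fin (suc len)} → toℕ l ≡ suc (toℕ k) → arc (at-step l) ≡ arc (at-step k) →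
          backward (at-step l) ≡ backward (at-step k)
        turn {k} {l} eq a rewrite eq = ≡.trans (≡.cong backward (iter-suc (toℕ k) σ))
          (onward (at-step k) (≡.trans (≡.cong arc (≡.sym (iter-suc (toℕ k) σ))) a))
        clash : ∀ {b c} → b ≡ true → c ≡ false → b ≡ c → ⊥
        clash ≡.refl ≡.refl ()
        go : toℕ j ≡ suc (toℕ i) ⊎ (toℕ i ≡ len × toℕ j ≡ 0) → toℕ i ≡ suc (toℕ j) ⊎ (toℕ j ≡ len × toℕ i ≡ 0) → ⊥
        go (inj₁ p) _ = clash bi bj (≡.sym (turn p (≡.trans aj (≡.sym ai))))
        go _ (inj₁ q) = clash bi bj (turn q (≡.trans ai (≡.sym aj)))
        go (inj₂ (_ , j0)) (inj₂ (_ , i0)) =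
          clash bi bj (≡.cong (backward ∘ at-step) (Fin.toℕ-injective (≡.trans i0 (≡.sym j0))))

      changeOf : ∀ {e} → Dec (∃ (Uses true e)) → Dec (∃ (Uses false e)) → Change
      changeOf (yes _) _       = raised
      changeOf (no _)  (yes _) = lowered
      changeOf (no _)  (no _)  = fixed

      change : Fin K → Change
      change e = changeOf (used? true e) (used? false e)

      -- Either 0 or 1 by `uses-unique`. The form as a sum over steps allows counting over arcs to
      -- be exchanged with counting over steps.
      usage : Bool → Fin K → Carrier
      usage d e = ∑ λ k → when (uses? d e k) 1#

      ∑-unique : ∀ {n} {P : Fin n → Set} (P? : ∀ k → Dec (P k)) → (∀ {i j} → P i → P j → i ≡ j) →
        ∑ (λ k → when (P? k) 1#) ≈ when (Fin.any? P?) 1#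
      ∑-unique P? u with Fin.any? P?
      ... | yes (i , p) = ≈-trans (∑-cong λ k → ≈-reflexive (when-⇔ (P? k) (k Fin.≟ i)
                (λ q → u q p) (λ { ≡.refl → p }))) (∑-pick i _)
      ... | no ¬p = ∑-zero λ k → ≈-reflexive (when-no (P? k) (λ q → ¬p (k , q)))

      ↑-usage : ∀ e → [ change e ]↑ ≈ usage true e
      ↑-usage e = ≈-trans (go (used? true e) (used? false e)) (≈-sym (∑-unique (uses? true e) (uses-unique true e)))
        where
        go : (p : Dec (∃ (Uses true e))) (q : Dec (∃ (Uses false e))) → [ changeOf p q ]↑ ≈ when p 1#
        go (yes _) _       = ≈-refl
        go (no _)  (yes _) = ≈-refl
        go (no _)  (no _)  = ≈-refl

      ↓-usage : ∀ e → [ change e ]↓ ≈ usage false e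
      ↓-usage e = ≈-trans (go (used? true e) (used? false e)) (≈-sym (∑-unique (uses? false e) (uses-unique false e)))
        where
        go : (p : Dec (∃ (Uses true e))) (q : Dec (∃ (Uses false e))) → [ changeOf p q ]↓ ≈ when q 1#
        go (yes p) (yes q) = ⊥-elim (one-direction e p q)
        go (yes _) (no _)  = ≈-refl
        go (no _)  (yes _) = ≈-refl
        go (no _)  (no _)  = ≈-refl

      touches : Bool → (Fin K → Fin N) → Fin N → Fin (suc len) → Carrier
      touches d g v k = when (backward (at-step k) Bool.≟ d) (when (g (arc (at-step k)) Fin.≟ v) 1#)

      at-usage : ∀ d (g : Fin K → Fin N) v → at g (usage d) v ≈ ∑ (touches d g v)
      at-usage d g v = begin-equality
        at g (usage d) v
          ≈⟨ ≈-reflexive (at-def g (usage d) v) ⟩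
        ∑ (λ e → when (g e Fin.≟ v) (∑ λ k → when (uses? d e k) 1#))
          ≈⟨ ∑-cong (λ e → when-∑ (g e Fin.≟ v) _) ⟩
        ∑ (λ e → ∑ λ k → when (g e Fin.≟ v) (when (uses? d e k) 1#))
          ≈⟨ ∑-swap _ ⟩
        ∑ (λ k → ∑ λ e → when (g e Fin.≟ v) (when (uses? d e k) 1#))
          ≈⟨ ∑-cong (λ k → ≈-trans (∑-cong (swap k)) (∑-pick (arc (at-step k)) _)) ⟩
        ∑ (touches d g v) ∎
        where
        swap : ∀ k e → when (g e Fin.≟ v) (when (uses? d e k) 1#) ≈
          when (e Fin.≟ arc (at-step k)) (when (backward (at-step k) Bool.≟ d) (when (g e Fin.≟ v) 1#))
        swap k e with backward (at-step k) Bool.≟ d | arc (at-step k) Fin.≟ e | e Fin.≟ arc (at-step k)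
        ... | yes _ | yes _ | yes _ = ≈-refl
        ... | no _  | yes _ | yes _ = when-0 (g e Fin.≟ v)
        ... | yes _ | no _  | no _  = when-0 (g e Fin.≟ v)
        ... | no _  | no _  | no _  = when-0 (g e Fin.≟ v)
        ... | _     | yes p | no q  = contradiction (≡.sym p) q
        ... | _     | no p  | yes q = contradiction (≡.sym q) p

      start-touches : ∀ v k → touches false tl v k + touches true hd v k ≈ when (pos σ (toℕ k) Fin.≟ v) 1#
      start-touches v k with backward (at-step k)
      ... | true  = +-identityˡ _
      ... | false = +-identityʳ _

      stop-touches : ∀ v k → touches false hd v k + touches true tl v k ≈ when (pos σ (suc (toℕ k)) Fin.≟ v) 1#
      stop-touches v k = ≈-trans (go (at-step k)) (≈-reflexive (≡.cong (λ u → when (u Fin.≟ v) 1#) (follows (toℕ k))))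
        where
        go : ∀ τ → when (backward τ Bool.≟ false) (when (hd (arc τ) Fin.≟ v) 1#) +
                   when (backward τ Bool.≟ true)  (when (tl (arc τ) Fin.≟ v) 1#) ≈ when (stop τ Fin.≟ v) 1#
        go τ with backward τ
        ... | true  = +-identityˡ _
        ... | false = +-identityʳ _

      -- Up to regrouping, the left side counts the steps that start at `v` and the right side those
      -- that stop there. As each step starts where its predecessor stops, the counts differ only in
      -- the two ends of the walk, which `closed` identifies.
      circulation : Circulation tl hd change
      circulation v = +-cancelʳ (g 0) (begin-equality
        (at tl ([_]↓ ∘ change) v + at hd ([_]↑ ∘ change) v) + g 0
          ≈⟨ +-congʳ (collect tl hd) ⟩
        ∑ (λ k → touches false tl v k + touches true hd v k) + g 0
          ≈⟨ +-cong (∑-cong (start-touches v)) (≈-reflexive (≡.cong (λ u → when (u Fin.≟ v) 1#) closed)) ⟩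
        ∑ {suc len} (λ k → g (toℕ k)) + g (suc len)
          ≈⟨ ∑-shift (suc len) g ⟨
        ∑ {suc len} (λ k → g (suc (toℕ k))) + g 0
          ≈⟨ +-congʳ (∑-cong (stop-touches v)) ⟨
        ∑ (λ k → touches false hd v k + touches true tl v k) + g 0
          ≈⟨ +-congʳ (collect hd tl) ⟨
        (at hd ([_]↓ ∘ change) v + at tl ([_]↑ ∘ change) v) + g 0 ∎)
        where
        g : ℕ → Carrier
        g k = when (pos σ k Fin.≟ v) 1#
        collect : ∀ (p q : Fin K → Fin N) →
          at p ([_]↓ ∘ change) v + at q ([_]↑ ∘ change) v ≈ ∑ (λ k → touches false p v k + touches true q v k)
        collect p q = ≈-trans (+-cong (≈-trans (at-cong ↓-usage v) (at-usage false p v))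
          (≈-trans (at-cong ↑-usage v) (at-usage true q v))) (≈-sym (∑-+ _ _))

      cycle-of : Cycle
      cycle-of = record
        { change = change
        ; circulation = circulation
        ; raised⇒ = λ {e} → raised⇒ (used? true e) (used? false e)
        ; lowered⇒ = λ {e} → lowered⇒ (used? true e) (used? false e)
        ; nontrivial = arc σ , nontrivial (backward σ) ≡.refl (used? true (arc σ)) (used? false (arc σ))
        }
        where
        raised⇒ : ∀ {e} (p : Dec (∃ (Uses true e))) (q : Dec (∃ (Uses false e))) → changeOf p q ≡ raised →
          ∃[ τ ] arc τ ≡ e × backward τ ≡ true
        raised⇒ (yes (k , b , a)) q _ = at-step k , a , b
        raised⇒ (no _) (yes _) ()
        raised⇒ (no _) (no _) ()
        lowered⇒ : ∀ {e} (p : Dec (∃ (Uses true e))) (q : Dec (∃ (Uses false e))) → changeOf p q ≡ lowered →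
          ∃[ τ ] arc τ ≡ e × backward τ ≡ false
        lowered⇒ (no _) (yes (k , b , a)) _ = at-step k , a , b
        lowered⇒ (no _) (no _) ()
        nontrivial : ∀ b → backward σ ≡ b → (p : Dec (∃ (Uses true (arc σ)))) (q : Dec (∃ (Uses false (arc σ)))) → changeOf p q ≢ fixed
        nontrivial true  eq (no ¬p) (no ¬q) _ = ¬p (zero , eq , ≡.refl)
        nontrivial false eq (no ¬p) (no ¬q) _ = ¬q (zero , eq , ≡.refl)

    opaque
      cycle : St → Cycle
      cycle τ = cycle-of (simpleOrbit τ)

-- Counting for termination.

tally : ∀ {k} → (Fin k → ℕ) → ℕ
tally {zero}  f = 0
tally {suc k} f = f zero ℕ.+ tally (f ∘ suc)

tally-mono : ∀ {k} {f g : Fin k → ℕ} → (∀ i → f i ℕ.≤ g i) → tally f ℕ.≤ tally g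
tally-mono {zero}  p = z≤n
tally-mono {suc k} p = ℕ.+-mono-≤ (p zero) (tally-mono (p ∘ suc))

tally-strict : ∀ {k} {f g : Fin k → ℕ} → (∀ i → f i ℕ.≤ g i) → ∀ i → f i ℕ.< g i → tally f ℕ.< tally g
tally-strict p zero    lt = ℕ.+-mono-<-≤ lt (tally-mono (p ∘ suc))
tally-strict p (suc i) lt = ℕ.+-mono-≤-< (p zero) (tally-strict (p ∘ suc) i lt)

indicator : ∀ {P : Set} → Dec P → ℕ
indicator d = if does d then 1 else 0

indicator-mono : ∀ {P Q : Set} (d : Dec P) (e : Dec Q) → (P → Q) → indicator d ℕ.≤ indicator e
indicator-mono (no _)  e f = z≤n
indicator-mono (yes p) (yes _) f = ℕ.≤-refl
indicator-mono (yes p) (no ¬q) f = contradiction (f p) ¬q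

indicator-strict : ∀ {P Q : Set} (d : Dec P) (e : Dec Q) → ¬ P → Q → indicator d ℕ.< indicator e
indicator-strict (yes p) e ¬p q = contradiction p ¬p
indicator-strict (no _) (yes _) ¬p q = ℕ.≤-refl
indicator-strict (no _) (no ¬q) ¬p q = contradiction q ¬q

-- Acyclic flows by cancelling directed cycles.

module Acyclic (ℝ : RealNumbers) where
  open OrderedField ℝ
  open AtVertices ℝ

  argmin : ∀ {k} {P : Fin k → Set} → (∀ i → Dec (P i)) → (f : Fin k → Carrier) → ∃ P →
    ∃[ i ] P i × (∀ j → P j → f i ≤ f j)
  argmin {zero} P? f (() , _)
  argmin {suc k} {P} P? f (i₀ , p₀) with P? zero | Fin.any? (P? ∘ suc)
  ... | no ¬z | no ¬r = contradiction p₀ (none i₀)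
    where
    none : ∀ i → ¬ P i
    none zero    = ¬z
    none (suc i) q = ¬r (i , q)
  ... | yes z | no ¬r = zero , z , λ { zero _ → ≤-refl ; (suc j) q → contradiction (j , q) ¬r }
  ... | no ¬z | yes r with argmin (P? ∘ suc) (f ∘ suc) r
  ...   | i , p , m = suc i , p , λ { zero q → contradiction q ¬z ; (suc j) q → m j q }
  argmin {suc k} {P} P? f _ | yes z | yes r with argmin (P? ∘ suc) (f ∘ suc) r
  ...   | i , p , m with ≤-total (f zero) (f (suc i))
  ...     | inj₁ le = zero , z , λ { zero _ → ≤-refl ; (suc j) q → ≤-trans le (m j q) }
  ...     | inj₂ ge = suc i , p , λ { zero _ → ge ; (suc j) q → m j q }

  module _ {N K : ℕ} (tl hd : Fin K → Fin N) where

    Ranked : (Fin K → Carrier) → (Fin N → ℕ) → Set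
    Ranked x rank = ∀ e → 0# < x e → rank (tl e) ℕ.< rank (hd e)

    -- A directed cycle in the support of `x`, presented as a signed cycle that never raises.
    Ring : (Fin K → Carrier) → Set
    Ring x = Σ[ change ∈ (Fin K → Change) ] Circulation tl hd change ×
             (∀ {e} → change e ≢ raised) × (∀ {e} → change e ≡ lowered → 0# < x e) × (∃[ e ] change e ≢ fixed)

    module _ (x : Fin K → Carrier) where

      -- From every vertex of `P` a positive arc leads back into `P`, so a walk inside `P` never
      -- gets stuck and must close up.
      ring : (P : Fin N → Set) → (∀ v → P v → ∃[ e ] tl e ≡ v × 0# < x e × P (hd e)) → ∃ P → Ring x
      ring P step (v₀ , p₀) = change , circulation , noRaise , supported , nontrivial
        where
        St : Set
        St = Σ[ e ∈ Fin K ] 0# < x e × P (hd e)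
        advance : ∀ v → P v → St
        advance v p with step v p
        ... | e , _ , pos , q = e , pos , q
        next : St → St
        next (e , _ , p) = advance (hd e) p
        link : ∀ v (p : P v) → v ≡ tl (proj₁ (advance v p))
        link v p with step v p
        ... | e , eq , _ , _ = ≡.sym eq
        open SignedCycles ℝ tl hd {St} proj₁ (λ _ → false) next using (cycle; module Cycle)
        cyc = cycle (λ (e , _ , p) → link (hd e) p) (λ _ _ → ≡.refl) (advance v₀ p₀)
        open Cycle cyc
        noRaise : ∀ {e} → change e ≢ raised
        noRaise eq with raised⇒ eq
        ... | _ , _ , ()
        supported : ∀ {e} → change e ≡ lowered → 0# < x e
        supported eq with lowered⇒ eq
        ... | (e , pos , _) , ≡.refl , _ = pos

      undone : (Fin N → Bool) → ℕ
      undone done = tally λ v → indicator (done v Bool.≟ false)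

      -- Peels off vertices whose positive arcs all lead to vertices already done. The remaining
      -- fuel serves as the rank of the peeled vertex, so ranks are handed out from the top
      -- downwards and `bound` places the new vertex below all earlier ones. If no vertex can be
      -- peeled, every undone vertex has a positive arc to an undone vertex, which yields a ring.
      eliminate : ∀ fuel (done : Fin N → Bool) (rank : Fin N → ℕ) → undone done ℕ.< fuel →
        (∀ v → done v ≡ true → fuel ℕ.≤ rank v) →
        (∀ e → 0# < x e → done (tl e) ≡ true → done (hd e) ≡ true × rank (tl e) ℕ.< rank (hd e)) →
        (∃[ rank ] Ranked x rank) ⊎ Ring x
      eliminate (suc fuel) done rank (s≤s lt) bound ok
        with Fin.any? (λ v → (done v Bool.≟ false) ×-dec
               Fin.all? (λ e → (tl e Fin.≟ v) →-dec ((0# <? x e) →-dec (done (hd e) Bool.≟ true))))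
      ... | yes (v , notYet , sink) = eliminate fuel done′ rank′ (ℕ.<-≤-trans (tally-strict le v less) lt) bound′ ok′
        where
        done′ : Fin N → Bool
        done′ w = if does (w Fin.≟ v) then true else done w
        rank′ : Fin N → ℕ
        rank′ w = if does (w Fin.≟ v) then fuel else rank w
        le : ∀ w → indicator (done′ w Bool.≟ false) ℕ.≤ indicator (done w Bool.≟ false)
        le w with w Fin.≟ v
        ... | yes _ = z≤n
        ... | no _  = ℕ.≤-refl
        less : indicator (done′ v Bool.≟ false) ℕ.< indicator (done v Bool.≟ false)
        less with v Fin.≟ v
        ... | yes _ = indicator-strict (true Bool.≟ false) (done v Bool.≟ false) (λ ()) notYet
        ... | no ne = contradiction ≡.refl ne
        bound′ : ∀ w → done′ w ≡ true → fuel ℕ.≤ rank′ w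
        bound′ w d with w Fin.≟ v
        ... | yes _ = ℕ.≤-refl
        ... | no _  = ℕ.<⇒≤ (bound w d)
        ok′ : ∀ e → 0# < x e → done′ (tl e) ≡ true → done′ (hd e) ≡ true × rank′ (tl e) ℕ.< rank′ (hd e)
        ok′ e pos d with tl e Fin.≟ v | hd e Fin.≟ v
        ... | yes t | yes h = contradiction (≡.trans (≡.sym (sink e t pos)) (≡.trans (≡.cong done h) notYet)) (λ ())
        ... | yes t | no _  = sink e t pos , bound (hd e) (sink e t pos)
        ... | no _  | yes h = contradiction (≡.trans (≡.sym (proj₁ (ok e pos d))) (≡.trans (≡.cong done h) notYet)) (λ ())
        ... | no _  | no _  = ok e pos d
      ... | no ¬found with Fin.any? (λ v → done v Bool.≟ false)
      ...   | no ¬undone = inj₁ (rank , λ e pos → proj₂ (ok e pos (allDone (tl e))))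
        where
        allDone : ∀ v → done v ≡ true
        allDone v with done v in eq
        ... | true  = ≡.refl
        ... | false = contradiction (v , eq) ¬undone
      ...   | yes someUndone = inj₂ (ring (λ v → done v ≡ false) step someUndone)
        where
        step : ∀ v → done v ≡ false → ∃[ e ] tl e ≡ v × 0# < x e × done (hd e) ≡ false
        step v nd with Fin.any? (λ e → (tl e Fin.≟ v) ×-dec ((0# <? x e) ×-dec (done (hd e) Bool.≟ false)))
        ... | yes r = r
        ... | no ¬r = contradiction (v , nd , λ e t pos → isTrue e t pos) ¬found
          where
          isTrue : ∀ e → tl e ≡ v → 0# < x e → done (hd e) ≡ true
          isTrue e t pos with done (hd e) in eq
          ... | true  = ≡.refl
          ... | false = contradiction (e , t , pos , eq) ¬r

      ranked⊎ring : (∃[ rank ] Ranked x rank) ⊎ Ring x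
      ranked⊎ring = eliminate _ (λ _ → false) (λ _ → 0) ℕ.≤-refl (λ _ ()) (λ _ _ ())

    SameNet : (x y : Fin K → Carrier) → Set
    SameNet x y = ∀ v → at tl y v + at hd x v ≈ at tl x v + at hd y v

    support : (Fin K → Carrier) → ℕ
    support x = tally λ e → indicator (0# <? x e)

    cancel : ∀ x → (∀ e → 0# ≤ x e) → Ring x →
      ∃[ y ] (∀ e → 0# ≤ y e) × (∀ e → y e ≤ x e) × SameNet x y × support y ℕ.< support x
    cancel x x≥0 (change , circ , noRaise , supported , (e₀ , ne₀)) = y , y≥0 , y≤x ,
      shift-conserves tl hd change circ ε x , tally-strict less a strictly
      where
      islowered : ∀ {e} → change e ≢ fixed → change e ≡ lowered
      islowered {e} ne with change e in eq
      ... | raised  = contradiction eq noRaise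
      ... | lowered = ≡.refl
      ... | fixed   = contradiction ≡.refl ne
      lowered? : ∀ e → Dec (change e ≡ lowered)
      lowered? e with change e
      ... | raised  = no λ ()
      ... | lowered = yes ≡.refl
      ... | fixed   = no λ ()
      -- The least flow on the cycle: subtracting it keeps all flows nonnegative and removes `a`
      -- from the support.
      least = argmin lowered? x (e₀ , islowered ne₀)
      a = proj₁ least
      ε = x a
      y : Fin K → Carrier
      y e = shift (change e) ε (x e)
      y≥0 : ∀ e → 0# ≤ y e
      y≥0 e with change e in eq
      ... | raised  = contradiction eq noRaise
      ... | lowered = 0≤x-y (proj₂ (proj₂ least) e eq)
      ... | fixed   = x≥0 e
      y≤x : ∀ e → y e ≤ x e
      y≤x e with change e in eq
      ... | raised  = contradiction eq noRaise
      ... | lowered = x-y≤x (x≥0 a)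
      ... | fixed   = ≤-refl
      less : ∀ e → indicator (0# <? y e) ℕ.≤ indicator (0# <? x e)
      less e = indicator-mono (0# <? y e) (0# <? x e) (λ p → <-≤-trans p (y≤x e))
      strictly : indicator (0# <? y a) ℕ.< indicator (0# <? x a)
      strictly = indicator-strict (0# <? y a) (0# <? x a) (0≮0 y≈0) (supported (proj₁ (proj₂ least)))
        where
        y≈0 : y a ≈ 0#
        y≈0 rewrite proj₁ (proj₂ least) = -‿inverseʳ (x a)

    -- Transitivity of `SameNet`, again without subtraction.
    exchange : ∀ {x₁ y₁ z₁ x₂ y₂ z₂} → y₁ + x₂ ≈ x₁ + y₂ → z₁ + y₂ ≈ y₁ + z₂ → z₁ + x₂ ≈ x₁ + z₂
    exchange {x₁} {y₁} {z₁} {x₂} {y₂} {z₂} p q = +-cancelʳ (y₁ + y₂) (begin-equality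
      (z₁ + x₂) + (y₁ + y₂) ≈⟨ solve 4 (λ a b c d → (a :+ b) :+ (c :+ d) := (a :+ d) :+ (c :+ b)) ≈-refl z₁ x₂ y₁ y₂ ⟩
      (z₁ + y₂) + (y₁ + x₂) ≈⟨ +-cong q p ⟩
      (y₁ + z₂) + (x₁ + y₂) ≈⟨ solve 4 (λ a b c d → (a :+ b) :+ (c :+ d) := (c :+ b) :+ (a :+ d)) ≈-refl y₁ z₂ x₁ y₂ ⟩
      (x₁ + z₂) + (y₁ + y₂) ∎)

    acyclic : ∀ x → (∀ e → 0# ≤ x e) →
      ∃[ y ] (∀ e → 0# ≤ y e) × (∀ e → y e ≤ x e) × SameNet x y × ∃[ rank ] Ranked y rank
    acyclic x x≥0 = go _ x x≥0 ℕ.≤-refl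
      where
      go : ∀ fuel x → (∀ e → 0# ≤ x e) → support x ℕ.≤ fuel →
        ∃[ y ] (∀ e → 0# ≤ y e) × (∀ e → y e ≤ x e) × SameNet x y × ∃[ rank ] Ranked y rank
      go fuel x x≥0 le with ranked⊎ring x
      ... | inj₁ (rank , r) = x , x≥0 , (λ _ → ≤-refl) , (λ _ → ≈-refl) , rank , r
      ... | inj₂ c with cancel x x≥0 c
      go zero x x≥0 le | inj₂ c | y , _ , _ , _ , lt = contradiction (ℕ.<-≤-trans lt le) λ ()
      go (suc fuel) x x≥0 le | inj₂ c | y , y≥0 , y≤x , net , lt
        with go fuel y y≥0 (ℕ.≤-pred (ℕ.<-≤-trans lt le))
      ... | z , z≥0 , z≤y , net′ , rest = z , z≥0 , (λ e → ≤-trans (z≤y e) (y≤x e)) , sameNet , rest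
        where
        sameNet : SameNet x z
        sameNet v = exchange (net v) (net′ v)

-- Rounding a flow by moving terminals

data Layer : Set where
  supplyLayer demandLayer : Layer
  copy : Bool → Layer

_[_↦_] : ∀ {k} {A : Set} → (Fin k → A) → Fin k → A → Fin k → A
(f [ i ↦ a ]) j = if does (j Fin.≟ i) then a else f j

module _ {k : ℕ} {A : Set} (f : Fin k → A) (i : Fin k) (a : A) where
  ↦-same : (f [ i ↦ a ]) i ≡ a
  ↦-same with i Fin.≟ i
  ... | yes _ = ≡.refl
  ... | no ne = contradiction ≡.refl ne

-- Effect of elementary updates on balances.

module Updates (ℝ : RealNumbers) where
  open OrderedField ℝ
  open AtVertices ℝ

  opaque
    reduce : ∀ {k} → (Fin k → Carrier) → Fin k → Carrier → Fin k → Carrier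
    reduce x i d j = x j - when (j Fin.≟ i) d

  module _ {k : ℕ} (x : Fin k → Carrier) (i : Fin k) (d : Carrier) where
    opaque
      unfolding reduce

      reduce-plus : ∀ j → reduce x i d j + when (j Fin.≟ i) d ≈ x j
      reduce-plus j = minus-plus (x j) _

      reduce-same : reduce x i d i ≈ x i - d
      reduce-same = ≈-reflexive (≡.cong (λ y → x i - y) (when-yes (i Fin.≟ i) ≡.refl))

      reduce-other : ∀ {j} → j ≢ i → reduce x i d j ≈ x j
      reduce-other {j} ne = +-minus (≈-sym (≈-trans (+-congˡ (≈-reflexive (when-no (j Fin.≟ i) ne))) (+-identityʳ _)))

      reduce≤ : 0# ≤ d → ∀ j → reduce x i d j ≤ x j
      reduce≤ 0≤d j = x-y≤x (when-nonNeg (j Fin.≟ i) 0≤d)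

      reduce-nonNeg : d ≤ x i → (∀ j → 0# ≤ x j) → ∀ j → 0# ≤ reduce x i d j
      reduce-nonNeg d≤ x≥0 j = 0≤x-y le
        where
        le : when (j Fin.≟ i) d ≤ x j
        le with j Fin.≟ i
        ... | yes ≡.refl = d≤
        ... | no _       = x≥0 j

      reduce-vanishes : x i ≈ d → ¬ 0# < reduce x i d i
      reduce-vanishes e = 0≮0 (≈-trans reduce-same (≈-trans (+-congʳ e) (-‿inverseʳ d)))

    reduce-pos : 0# ≤ d → ∀ {j} → 0# < reduce x i d j → 0# < x j
    reduce-pos 0≤d {j} p = <-≤-trans p (reduce≤ 0≤d j)

    at-reduce : ∀ {N} (g : Fin k → Fin N) v → at g (reduce x i d) v + when (g i Fin.≟ v) d ≈ at g x v
    at-reduce g v = begin-equality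
      at g (reduce x i d) v + when (g i Fin.≟ v) d ≈⟨ +-congˡ (at-pick i d v) ⟨
      at g (reduce x i d) v + at g (λ j → when (j Fin.≟ i) d) v ≈⟨ at-+ _ _ v ⟨
      at g (λ j → reduce x i d j + when (j Fin.≟ i) d) v ≈⟨ at-cong reduce-plus v ⟩
      at g x v ∎

  module _ {k N : ℕ} where
    opaque
      unfolding at

      at-move : (g : Fin k → Fin N) (i : Fin k) (u : Fin N) (y : Fin k → Carrier) (v : Fin N) →
        at (g [ i ↦ u ]) y v + when (g i Fin.≟ v) (y i) ≈ at g y v + when (u Fin.≟ v) (y i)
      at-move g i u y v = begin-equality
        at (g [ i ↦ u ]) y v + when (g i Fin.≟ v) (y i)
          ≈⟨ +-congˡ (∑-pick i (λ j → when (g j Fin.≟ v) (y j))) ⟨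
        at (g [ i ↦ u ]) y v + ∑ (λ j → when (j Fin.≟ i) (when (g j Fin.≟ v) (y j)))
          ≈⟨ ∑-+ _ _ ⟨
        ∑ (λ j → when ((g [ i ↦ u ]) j Fin.≟ v) (y j) + when (j Fin.≟ i) (when (g j Fin.≟ v) (y j)))
          ≈⟨ ∑-cong swap ⟩
        ∑ (λ j → when (g j Fin.≟ v) (y j) + when (j Fin.≟ i) (when (u Fin.≟ v) (y j)))
          ≈⟨ ∑-+ _ _ ⟩
        at g y v + ∑ (λ j → when (j Fin.≟ i) (when (u Fin.≟ v) (y j)))
          ≈⟨ +-congˡ (∑-pick i (λ j → when (u Fin.≟ v) (y j))) ⟩
        at g y v + when (u Fin.≟ v) (y i) ∎
        where
        swap : ∀ j → when ((g [ i ↦ u ]) j Fin.≟ v) (y j) + when (j Fin.≟ i) (when (g j Fin.≟ v) (y j)) ≈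
                     when (g j Fin.≟ v) (y j) + when (j Fin.≟ i) (when (u Fin.≟ v) (y j))
        swap j with j Fin.≟ i
        ... | yes _ = +-comm _ _
        ... | no  _ = ≈-refl

      at-redirect : (g : Fin k → Fin N) (u w : Fin N) (y : Fin k → Carrier) (v : Fin N) →
        at (λ i → if does (g i Fin.≟ u) then w else g i) y v + when (u Fin.≟ v) (at g y u) ≈
        at g y v + when (w Fin.≟ v) (at g y u)
      at-redirect g u w y v = begin-equality
        at g′ y v + when (u Fin.≟ v) (at g y u)
          ≈⟨ +-congˡ (when-∑ (u Fin.≟ v) _) ⟩
        at g′ y v + ∑ (λ i → when (u Fin.≟ v) (when (g i Fin.≟ u) (y i)))
          ≈⟨ ∑-+ _ _ ⟨
        ∑ (λ i → when (g′ i Fin.≟ v) (y i) + when (u Fin.≟ v) (when (g i Fin.≟ u) (y i)))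
          ≈⟨ ∑-cong swap ⟩
        ∑ (λ i → when (g i Fin.≟ v) (y i) + when (w Fin.≟ v) (when (g i Fin.≟ u) (y i)))
          ≈⟨ ∑-+ _ _ ⟩
        at g y v + ∑ (λ i → when (w Fin.≟ v) (when (g i Fin.≟ u) (y i)))
          ≈⟨ +-congˡ (when-∑ (w Fin.≟ v) _) ⟨
        at g y v + when (w Fin.≟ v) (at g y u) ∎
        where
        g′ : Fin k → Fin N
        g′ i = if does (g i Fin.≟ u) then w else g i
        swap : ∀ i → when (g′ i Fin.≟ v) (y i) + when (u Fin.≟ v) (when (g i Fin.≟ u) (y i)) ≈
                     when (g i Fin.≟ v) (y i) + when (w Fin.≟ v) (when (g i Fin.≟ u) (y i))
        swap i with g i Fin.≟ u
        ... | no _       = +-congˡ (≈-trans (when-0 (u Fin.≟ v)) (≈-sym (when-0 (w Fin.≟ v))))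
        ... | yes ≡.refl = +-comm _ _

module Rounding (ℝ : RealNumbers) {N K S T : ℕ} (tl hd : Fin K → Fin N) (layer : Fin N → Layer) (rank : Fin N → ℕ)
  (Δ : RealNumbers.Carrier ℝ) where
  open OrderedField ℝ
  open AtVertices ℝ
  open Updates ℝ
  open Acyclic ℝ using (Ranked)

  -- Endpoints are kept out of the type of routes: sources and terminals move while routes are
  -- built, and only a pair with positive flow needs a connecting route.
  IsWalk : Fin N → List (Fin K) → Fin N → Set
  IsWalk u []      v = u ≡ v
  IsWalk u (e ∷ r) v = tl e ≡ u × IsWalk (hd e) r v

  walk-snoc : ∀ {u} r e {v} → IsWalk u r (tl e) → hd e ≡ v → IsWalk u (r ∷ʳ e) v
  walk-snoc []      e p        q = ≡.sym p , q
  walk-snoc (f ∷ r) e (p , ps) q = p , walk-snoc r e ps q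

  count : Fin K → List (Fin K) → Carrier
  count e []      = 0#
  count e (f ∷ r) = when (e Fin.≟ f) 1# + count e r

  count-nonNeg : ∀ e r → 0# ≤ count e r
  count-nonNeg e []      = ≤-refl
  count-nonNeg e (f ∷ r) = +-nonNeg (when-nonNeg (e Fin.≟ f) 0≤1) (count-nonNeg e r)

  count-snoc : ∀ e r f → count e (r ∷ʳ f) ≈ count e r + when (e Fin.≟ f) 1#
  count-snoc e []      f = +-comm _ _
  count-snoc e (g ∷ r) f = ≈-trans (+-congˡ (count-snoc e r f)) (≈-sym (+-assoc _ _ _))

  -- A residual instance: the supplies sup s and demands dem t not yet matched, at the current vertices sp s and
  -- tp t, and a residual flow x. Flagged vertices form an in-forest, and only arcs into flagged vertices are ever
  -- raised. A terminal is irregular if some arc into its vertex carries more than its demand; at a flagged vertex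
  -- with a leaving arc there is none (regular), at a flagged root at most one (one-irregular); com t is the copy
  -- that terminal t has entered.
  record State : Set where
    field
      x           : Fin K → Carrier
      sup         : Fin S → Carrier
      dem         : Fin T → Carrier
      sp          : Fin S → Fin N
      tp          : Fin T → Fin N
      flag        : Fin N → Bool
      com         : Fin T → Bool
      x≥0         : ∀ e → 0# ≤ x e
      sup≥0       : ∀ s → 0# ≤ sup s
      dem≥0       : ∀ t → 0# ≤ dem t
      dem≤Δ       : ∀ t → dem t ≤ Δ
      conserve    : ∀ v → at hd x v + at sp sup v ≈ at tl x v + at tp dem v
      ranked      : Ranked tl hd x rank
      flag-unique : ∀ {e f} → flag (tl e) ≡ true → 0# < x e → 0# < x f → tl f ≡ tl e → f ≡ e
      flag-closed : ∀ {e} → flag (tl e) ≡ true → 0# < x e → flag (hd e) ≡ true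
      regular     : ∀ {e f t} → flag (hd e) ≡ true → 0# < x e → 0# < x f → tl f ≡ hd e →
                    tp t ≡ hd e → 0# < dem t → x e ≤ dem t
      one-irregular : ∀ {e f t u} → flag (hd e) ≡ true → 0# < x e → 0# < x f → hd f ≡ hd e →
                    tp t ≡ hd e → tp u ≡ hd e → 0# < dem t → 0# < dem u → t ≢ u → x e ≤ dem t ⊎ x f ≤ dem u
      alone       : ∀ {t u} → layer (tp t) ≡ demandLayer → tp t ≡ tp u → t ≡ u
      committed   : ∀ {t j} → layer (tp t) ≡ copy j → com t ≡ j

  -- Each reduction lowers one of the five summands and raises none: live arcs, live supplies, live
  -- demands, total rank of the terminals (for retreats), unflagged vertices.
  measure : State → ℕ
  measure σ = tally (λ e → indicator (0# <? x e)) ℕ.+ (tally (λ s → indicator (0# <? sup s)) ℕ.+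
              (tally (λ t → indicator (0# <? dem t)) ℕ.+ (tally (λ t → rank (tp t)) ℕ.+
               tally (λ v → indicator (flag v Bool.≟ false)))))
    where open State σ

  record _⊑_ (σ′ σ : State) : Set where
    private
      module σ′ = State σ′
      module σ = State σ
    field
      x-pos   : ∀ e → 0# < σ′.x e → 0# < σ.x e
      sup-pos : ∀ s → 0# < σ′.sup s → 0# < σ.sup s
      dem-pos : ∀ t → 0# < σ′.dem t → 0# < σ.dem t
      tp-rank : ∀ t → rank (σ′.tp t) ℕ.≤ rank (σ.tp t)
      flags   : ∀ v → σ′.flag v ≡ false → σ.flag v ≡ false

  data Strictly (σ′ σ : State) : Set where
    x-drop    : ∀ e → 0# < State.x σ e → ¬ 0# < State.x σ′ e → Strictly σ′ σ
    sup-drop  : ∀ s → 0# < State.sup σ s → ¬ 0# < State.sup σ′ s → Strictly σ′ σ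
    dem-drop  : ∀ t → 0# < State.dem σ t → ¬ 0# < State.dem σ′ t → Strictly σ′ σ
    rank-drop : ∀ t → rank (State.tp σ′ t) ℕ.< rank (State.tp σ t) → Strictly σ′ σ
    flag-drop : ∀ v → State.flag σ v ≡ false → State.flag σ′ v ≢ false → Strictly σ′ σ

  module _ {σ′ σ : State} (le : σ′ ⊑ σ) where
    open _⊑_ le
    private
      module σ′ = State σ′
      module σ = State σ
      m₁ : ∀ e → indicator (0# <? σ′.x e) ℕ.≤ indicator (0# <? σ.x e)
      m₁ e = indicator-mono (0# <? σ′.x e) (0# <? σ.x e) (x-pos e)
      m₂ : ∀ s → indicator (0# <? σ′.sup s) ℕ.≤ indicator (0# <? σ.sup s)
      m₂ s = indicator-mono (0# <? σ′.sup s) (0# <? σ.sup s) (sup-pos s)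
      m₃ : ∀ t → indicator (0# <? σ′.dem t) ℕ.≤ indicator (0# <? σ.dem t)
      m₃ t = indicator-mono (0# <? σ′.dem t) (0# <? σ.dem t) (dem-pos t)
      m₅ : ∀ v → indicator (σ′.flag v Bool.≟ false) ℕ.≤ indicator (σ.flag v Bool.≟ false)
      m₅ v = indicator-mono (σ′.flag v Bool.≟ false) (σ.flag v Bool.≟ false) (flags v)

    measure-mono : measure σ′ ℕ.≤ measure σ
    measure-mono = ℕ.+-mono-≤ (tally-mono m₁) (ℕ.+-mono-≤ (tally-mono m₂)
      (ℕ.+-mono-≤ (tally-mono m₃) (ℕ.+-mono-≤ (tally-mono tp-rank) (tally-mono m₅))))

    measure-drop : Strictly σ′ σ → measure σ′ ℕ.< measure σ
    measure-drop (x-drop e p q) = ℕ.+-mono-<-≤ (tally-strict m₁ e (indicator-strict (0# <? σ′.x e) (0# <? σ.x e) q p))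
      (ℕ.+-mono-≤ (tally-mono m₂) (ℕ.+-mono-≤ (tally-mono m₃) (ℕ.+-mono-≤ (tally-mono tp-rank) (tally-mono m₅))))
    measure-drop (sup-drop s p q) = ℕ.+-mono-≤-< (tally-mono m₁) (ℕ.+-mono-<-≤
      (tally-strict m₂ s (indicator-strict (0# <? σ′.sup s) (0# <? σ.sup s) q p))
      (ℕ.+-mono-≤ (tally-mono m₃) (ℕ.+-mono-≤ (tally-mono tp-rank) (tally-mono m₅))))
    measure-drop (dem-drop t p q) = ℕ.+-mono-≤-< (tally-mono m₁) (ℕ.+-mono-≤-< (tally-mono m₂) (ℕ.+-mono-<-≤
      (tally-strict m₃ t (indicator-strict (0# <? σ′.dem t) (0# <? σ.dem t) q p))
      (ℕ.+-mono-≤ (tally-mono tp-rank) (tally-mono m₅))))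
    measure-drop (rank-drop t p) = ℕ.+-mono-≤-< (tally-mono m₁) (ℕ.+-mono-≤-< (tally-mono m₂)
      (ℕ.+-mono-≤-< (tally-mono m₃) (ℕ.+-mono-<-≤ (tally-strict tp-rank t p) (tally-mono m₅))))
    measure-drop (flag-drop v p q) = ℕ.+-mono-≤-< (tally-mono m₁) (ℕ.+-mono-≤-< (tally-mono m₂)
      (ℕ.+-mono-≤-< (tally-mono m₃) (ℕ.+-mono-≤-< (tally-mono tp-rank)
      (tally-strict m₅ v (indicator-strict (σ′.flag v Bool.≟ false) (σ.flag v Bool.≟ false) q p)))))

  -- The weight `w` lets one definition measure both the whole flow on `e` (`all-sinks`) and the
  -- part going to sinks of the other copy (`not-on`).
  load : (Fin S → Fin T → Carrier) → (Fin S → Fin T → List (Fin K)) → (Fin T → Carrier) → Fin K → Carrier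
  load z route w e = ∑ λ s → ∑ λ t → (w t * z s t) * count e (route s t)

  all-sinks : Fin T → Carrier
  all-sinks _ = 1#

  not-on : Bool → (Fin T → Bool) → Fin T → Carrier
  not-on j side t = if does (side t Bool.≟ j) then 0# else 1#

  not-on-nonNeg : ∀ j side t → 0# ≤ not-on j side t
  not-on-nonNeg j side t with side t Bool.≟ j
  ... | yes _ = ≤-refl
  ... | no  _ = 0≤1

  not-on≤1 : ∀ j side t → not-on j side t ≤ 1#
  not-on≤1 j side t with side t Bool.≟ j
  ... | yes _ = 0≤1
  ... | no  _ = ≤-refl

  not-on≈0 : ∀ j side {t} → side t ≡ j → not-on j side t ≈ 0#
  not-on≈0 j side {t} e with side t Bool.≟ j
  ... | yes _ = ≈-refl
  ... | no ne = contradiction e ne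

  -- z s t flows from s to t along route s t, and side t is the copy to which t is assigned. The field crossing
  -- bounds the flow in one copy towards sinks assigned to the other; spill bounds the part of it that starts at
  -- a given vertex, which is what crossing becomes when all supplies at a vertex move along one arc.
  record Solution (σ : State) : Set where
    open State σ
    field
      z         : Fin S → Fin T → Carrier
      route     : Fin S → Fin T → List (Fin K)
      side      : Fin T → Bool
      z≥0       : ∀ s t → 0# ≤ z s t
      shipped   : ∀ s → ∑ (λ t → z s t) ≈ sup s
      delivered : ∀ t → ∑ (λ s → z s t) ≈ dem t
      connects  : ∀ {s t} → 0# < z s t → IsWalk (sp s) (route s t) (tp t)
      side-com  : ∀ {t} → layer (tp t) ≢ demandLayer → side t ≡ com t
      load≤     : ∀ e → load z route all-sinks e ≤ x e + Δ
      load-flag : ∀ e → flag (hd e) ≡ true → load z route all-sinks e ≤ Δ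
      load-dead : ∀ e → ¬ 0# < x e → load z route all-sinks e ≤ 0#
      crossing  : ∀ e {j} → layer (tl e) ≡ copy j → load z route (not-on j side) e ≤ Δ
      spill     : ∀ v {j} → layer v ≡ copy j → at sp (λ s → ∑ λ t → not-on j side t * z s t) v ≤ Δ

  -- Flow and routes are built on the way back: a move passes to a smaller state, and a solution
  -- there is extended by what the move contributed. The bounds of `Solution` thus concern only what
  -- remains to be routed.
  Reduction : State → Set
  Reduction σ = Σ[ σ′ ∈ State ] measure σ′ ℕ.< measure σ × (Solution σ′ → Solution σ)

-- The moves of the rounding algorithm and how solutions extend over them.

module Algorithm (ℝ : RealNumbers) {N K S T : ℕ} (tl hd : Fin K → Fin N) (layer : Fin N → Layer) (rank : Fin N → ℕ)
  (Δ : RealNumbers.Carrier ℝ)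
  (0≤Δ : RealNumbers._≤_ ℝ (RealNumbers.0# ℝ) Δ)
  (from-demand : ∀ e → layer (tl e) ≢ demandLayer)
  (into-supply : ∀ e → layer (hd e) ≢ supplyLayer)
  (same-copy : ∀ e {i j} → layer (tl e) ≡ copy i → layer (hd e) ≡ copy j → i ≡ j) where
  open OrderedField ℝ
  open AtVertices ℝ
  open Updates ℝ
  open Acyclic ℝ using (argmin)
  open Rounding ℝ {N} {K} {S} {T} tl hd layer rank Δ

  load-split : ∀ z route route′ w e (extra : Fin S → Fin T → Carrier) →
    (∀ s t → (w t * z s t) * count e (route s t) ≈ (w t * z s t) * count e (route′ s t) + extra s t) →
    load z route w e ≈ load z route′ w e + ∑ (λ s → ∑ (extra s))
  load-split z route route′ w e extra p = ≈-trans (∑-cong λ s → ≈-trans (∑-cong (p s)) (∑-+ _ _)) (∑-+ _ _)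

  -- The load on `i` grows by exactly the amount removed from its residual flow, so the excess over
  -- that flow stays the same.
  load-grow : ∀ (x : Fin K → Carrier) i d {ℓ ℓ⁻} e → ℓ ≈ ℓ⁻ + when (e Fin.≟ i) d → ℓ⁻ ≤ reduce x i d e + Δ → ℓ ≤ x e + Δ
  load-grow x i d {ℓ} {ℓ⁻} e eq le = begin
    ℓ ≈⟨ eq ⟩
    ℓ⁻ + D ≤⟨ +-monoˡ-≤ D le ⟩
    (reduce x i d e + Δ) + D ≈⟨ solve 3 (λ a b c → (a :+ b) :+ c := (a :+ c) :+ b) ≈-refl (reduce x i d e) Δ D ⟩
    (reduce x i d e + D) + Δ ≈⟨ +-congʳ (reduce-plus x i d e) ⟩
    x e + Δ ∎
    where
    D : Carrier
    D = when (e Fin.≟ i) d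

  -- Retreat: a terminal moves backwards over an arc.

  module Retreat (σ : State) where
    open State σ

    module _ (t₀ : Fin T) (e₀ : Fin K) (live : 0# < dem t₀) (pos : 0# < x e₀) (here : tp t₀ ≡ hd e₀)
             (fits : dem t₀ ≤ x e₀) (tight : flag (hd e₀) ≡ true → x e₀ ≈ dem t₀) where
      private
        d : Carrier
        d = dem t₀

        x′ : Fin K → Carrier
        x′ = reduce x e₀ d

        tp′ : Fin T → Fin N
        tp′ = tp [ t₀ ↦ tl e₀ ]

        -- A terminal that retreats into a supply vertex keeps the copy through which it came.
        sideOf : Layer → Bool → Bool
        sideOf (copy j) _ = j
        sideOf _        c = c

        com′ : Fin T → Bool
        com′ = com [ t₀ ↦ sideOf (layer (tl e₀)) (com t₀) ]

        x′≤x : ∀ e → x′ e ≤ x e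
        x′≤x = reduce≤ x e₀ d (dem≥0 t₀)

        x′⇒x : ∀ {e} → 0# < x′ e → 0# < x e
        x′⇒x = reduce-pos x e₀ d (dem≥0 t₀)

        -- If the new position is flagged, its only outgoing arc is e₀, which then vanishes: the position is a root.
        no-flagged-out : ∀ {f} → flag (tl e₀) ≡ true → 0# < x′ f → tl f ≢ tl e₀
        no-flagged-out fl pf eq with flag-unique fl pos (x′⇒x pf) eq
        ... | ≡.refl = reduce-vanishes x e₀ d (tight (flag-closed fl pos)) pf

        conserve′ : ∀ v → at hd x′ v + at sp sup v ≈ at tl x′ v + at tp′ dem v
        conserve′ v = +-cancelʳ (H + D) (begin-equality
          (at hd x′ v + at sp sup v) + (H + D)
            ≈⟨ solve 4 (λ a b c e → (a :+ b) :+ (c :+ e) := (a :+ c) :+ b :+ e) ≈-refl (at hd x′ v) (at sp sup v) H D ⟩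
          (at hd x′ v + H) + at sp sup v + D
            ≈⟨ +-congʳ (+-congʳ (at-reduce x e₀ d hd v)) ⟩
          (at hd x v + at sp sup v) + D
            ≈⟨ +-congʳ (conserve v) ⟩
          (at tl x v + at tp dem v) + D
            ≈⟨ +-congʳ (+-congʳ (at-reduce x e₀ d tl v)) ⟨
          ((at tl x′ v + D) + at tp dem v) + D
            ≈⟨ solve 3 (λ a b e → ((a :+ e) :+ b) :+ e := a :+ (b :+ e) :+ e) ≈-refl (at tl x′ v) (at tp dem v) D ⟩
          at tl x′ v + (at tp dem v + D) + D
            ≈⟨ +-congʳ (+-congˡ (≈-trans (≈-sym (at-move tp t₀ (tl e₀) dem v)) (+-congˡ (≈-reflexive (≡.cong (λ u → when (u Fin.≟ v) d) here))))) ⟩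
          at tl x′ v + (at tp′ dem v + H) + D
            ≈⟨ solve 4 (λ a b c e → a :+ (b :+ c) :+ e := (a :+ b) :+ (c :+ e)) ≈-refl (at tl x′ v) (at tp′ dem v) H D ⟩
          (at tl x′ v + at tp′ dem v) + (H + D) ∎)
          where
          H D : Carrier
          H = when (hd e₀ Fin.≟ v) d
          D = when (tl e₀ Fin.≟ v) d

        moved : ∀ {t} → t ≡ t₀ → tp′ t ≡ tl e₀
        moved ≡.refl = ↦-same tp t₀ (tl e₀)

      σ′ : State
      σ′ = record
        { x = x′ ; sup = sup ; dem = dem ; sp = sp ; tp = tp′ ; flag = flag ; com = com′
        ; x≥0 = reduce-nonNeg x e₀ d fits x≥0
        ; sup≥0 = sup≥0 ; dem≥0 = dem≥0 ; dem≤Δ = dem≤Δ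
        ; conserve = conserve′
        ; ranked = λ e p → ranked e (x′⇒x p)
        ; flag-unique = λ fl p q → flag-unique fl (x′⇒x p) (x′⇒x q)
        ; flag-closed = λ fl p → flag-closed fl (x′⇒x p)
        ; regular = regular′
        ; one-irregular = one-irregular′
        ; alone = alone′
        ; committed = committed′
        }
        where
        regular′ : ∀ {e f t} → flag (hd e) ≡ true → 0# < x′ e → 0# < x′ f → tl f ≡ hd e →
          tp′ t ≡ hd e → 0# < dem t → x′ e ≤ dem t
        regular′ {e} {f} {t} fl pe pf fe at′ lt with t Fin.≟ t₀
        ... | no ne  = ≤-trans (x′≤x e) (regular fl (x′⇒x pe) (x′⇒x pf) fe at′ lt)
        ... | yes _ = contradiction (≡.trans fe (≡.sym at′)) (no-flagged-out (≡.subst (λ v → flag v ≡ true) (≡.sym at′) fl) pf)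
        one-irregular′ : ∀ {e f t u} → flag (hd e) ≡ true → 0# < x′ e → 0# < x′ f → hd f ≡ hd e →
          tp′ t ≡ hd e → tp′ u ≡ hd e → 0# < dem t → 0# < dem u → t ≢ u → x′ e ≤ dem t ⊎ x′ f ≤ dem u
        one-irregular′ {e} {f} {t} {u} fl pe pf fe tt ut lt lu t≢u with t Fin.≟ t₀ | u Fin.≟ t₀
        ... | yes p | yes q = contradiction (≡.trans p (≡.sym q)) t≢u
        -- Before the move `e₀` left this vertex, so `regular` covers the terminals already there:
        -- only the newcomer can be irregular.
        ... | yes p | no q = inj₂ (≤-trans (x′≤x f)
                (regular (≡.subst (λ v → flag v ≡ true) (≡.sym fe) fl) (x′⇒x pf) pos (≡.trans tt (≡.sym fe)) (≡.trans ut (≡.sym fe)) lu))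
        ... | no p | yes q = inj₁ (≤-trans (x′≤x e) (regular fl (x′⇒x pe) pos ut tt lt))
        ... | no p | no q with one-irregular fl (x′⇒x pe) (x′⇒x pf) fe tt ut lt lu t≢u
        ...   | inj₁ le = inj₁ (≤-trans (x′≤x e) le)
        ...   | inj₂ le = inj₂ (≤-trans (x′≤x f) le)
        alone′ : ∀ {t u} → layer (tp′ t) ≡ demandLayer → tp′ t ≡ tp′ u → t ≡ u
        alone′ {t} {u} l e with t Fin.≟ t₀ | u Fin.≟ t₀
        ... | yes _ | _     = contradiction l (from-demand e₀)
        ... | no _  | yes _ = contradiction (≡.trans (≡.cong layer (≡.sym e)) l) (from-demand e₀)
        ... | no _  | no _  = alone l e
        committed′ : ∀ {t j} → layer (tp′ t) ≡ copy j → com′ t ≡ j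
        committed′ {t} l with t Fin.≟ t₀
        ... | no _  = committed l
        ... | yes _ rewrite l = ≡.refl

      descends : measure σ′ ℕ.< measure σ
      descends = measure-drop {σ′} {σ} (record
        { x-pos = λ _ → x′⇒x ; sup-pos = λ _ p → p ; dem-pos = λ _ p → p ; flags = λ _ p → p ; tp-rank = le }) (rank-drop t₀ lt)
        where
        lt : rank (tp′ t₀) ℕ.< rank (tp t₀)
        lt = ≡.subst₂ (λ u v → rank u ℕ.< rank v) (≡.sym (moved ≡.refl)) (≡.sym here) (ranked e₀ pos)
        le : ∀ t → rank (tp′ t) ℕ.≤ rank (tp t)
        le t with t Fin.≟ t₀
        ... | yes ≡.refl = ≡.subst (λ v → rank (tl e₀) ℕ.≤ rank v) (≡.sym here) (ℕ.<⇒≤ (ranked e₀ pos))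
        ... | no _ = ℕ.≤-refl

      extend : Solution σ′ → Solution σ
      extend sol = record
        { z = z ; route = route ; side = side ; z≥0 = z≥0 ; shipped = shipped ; delivered = delivered
        ; connects = λ {s} {t} → connects′ {s} {t}
        ; side-com = side-com′
        ; load≤ = λ e → load-grow x e₀ d e (load-all e) (load≤ e)
        ; load-flag = load-flag′
        ; load-dead = load-dead′
        ; crossing = crossing′
        ; spill = spill
        }
        where
        open Solution sol renaming (route to route⁻)
        route : Fin S → Fin T → List (Fin K)
        route s t = if does (t Fin.≟ t₀) then route⁻ s t ∷ʳ e₀ else route⁻ s t

        connects′ : ∀ {s t} → 0# < z s t → IsWalk (sp s) (route s t) (tp t)
        connects′ {s} {t} p with t Fin.≟ t₀ | connects {s} {t} p
        ... | yes ≡.refl | w = walk-snoc (route⁻ s t) e₀ w (≡.sym here)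
        ... | no ne | w = w

        -- Outside the demand layer a terminal retreats within its copy or into a supply vertex, so
        -- its commitment does not change. From a demand vertex nothing has to be shown, as there
        -- the side is still open.
        side-com′ : ∀ {t} → layer (tp t) ≢ demandLayer → side t ≡ com t
        side-com′ {t} l with t Fin.≟ t₀ | side-com {t}
        ... | no ne  | sc = sc l
        ... | yes ≡.refl | sc = ≡.trans (sc (from-demand e₀)) (go (layer (tl e₀)) (layer (hd e₀)) ≡.refl ≡.refl)
          where
          go : ∀ l₁ l₂ → layer (tl e₀) ≡ l₁ → layer (hd e₀) ≡ l₂ → sideOf l₁ (com t₀) ≡ com t₀
          go supplyLayer _ _ _ = ≡.refl
          go demandLayer _ _ _ = ≡.refl
          go (copy i) supplyLayer _ h = contradiction h (into-supply e₀)
          go (copy i) demandLayer _ h = contradiction (≡.trans (≡.cong layer here) h) l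
          go (copy i) (copy j) g h = ≡.trans (same-copy e₀ g h) (≡.sym (committed (≡.trans (≡.cong layer here) h)))

        -- Every route to `t₀` is prolonged by `e₀`, whatever its source; together these routes
        -- carry the remaining demand `d`.
        load-eq : ∀ w e → load z route w e ≈ load z route⁻ w e + when (e Fin.≟ e₀) (w t₀ * d)
        load-eq w e = ≈-trans (load-split z route route⁻ w e extra split) (+-congˡ total)
          where
          extra : Fin S → Fin T → Carrier
          extra s t = when (t Fin.≟ t₀) (when (e Fin.≟ e₀) (w t * z s t))
          split : ∀ s t → (w t * z s t) * count e (route s t) ≈ (w t * z s t) * count e (route⁻ s t) + extra s t
          split s t with t Fin.≟ t₀
          ... | no _  = ≈-sym (+-identityʳ _)
          ... | yes _ = begin-equality
            wz * count e (route⁻ s t ∷ʳ e₀) ≈⟨ *-congˡ (count-snoc e (route⁻ s t) e₀) ⟩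
            wz * (count e (route⁻ s t) + when (e Fin.≟ e₀) 1#) ≈⟨ distribˡ _ _ _ ⟩
            wz * count e (route⁻ s t) + wz * when (e Fin.≟ e₀) 1# ≈⟨ +-congˡ (≈-trans (*-when (e Fin.≟ e₀) wz 1#) (when-cong (e Fin.≟ e₀) λ _ → *-identityʳ wz)) ⟩
            wz * count e (route⁻ s t) + when (e Fin.≟ e₀) wz ∎
            where
            wz : Carrier
            wz = w t * z s t
          total : ∑ (λ s → ∑ (extra s)) ≈ when (e Fin.≟ e₀) (w t₀ * d)
          total = begin-equality
            ∑ (λ s → ∑ (extra s)) ≈⟨ ∑-cong (λ s → ∑-pick t₀ _) ⟩
            ∑ (λ s → when (e Fin.≟ e₀) (w t₀ * z s t₀)) ≈⟨ when-∑ (e Fin.≟ e₀) _ ⟨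
            when (e Fin.≟ e₀) (∑ λ s → w t₀ * z s t₀) ≈⟨ when-cong (e Fin.≟ e₀) (λ _ → ≈-trans (∑-*ˡ (w t₀) _) (*-congˡ (delivered t₀))) ⟩
            when (e Fin.≟ e₀) (w t₀ * d) ∎

        load-all : ∀ e → load z route all-sinks e ≈ load z route⁻ all-sinks e + when (e Fin.≟ e₀) d
        load-all e = ≈-trans (load-eq all-sinks e) (+-congˡ (when-cong (e Fin.≟ e₀) λ _ → *-identityˡ d))

        load-flag′ : ∀ e → flag (hd e) ≡ true → load z route all-sinks e ≤ Δ
        load-flag′ e fl with e Fin.≟ e₀ | load-all e
        ... | no _ | eq = ≤-trans (≤-reflexive (≈-trans eq (+-identityʳ _))) (load-flag e fl)
        ... | yes ≡.refl | eq = begin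
          load z route all-sinks e₀ ≈⟨ eq ⟩
          -- By `tight` the arc is dead after the move, so later moves put no load on it and only
          -- the demand of `t₀` counts.
          load z route⁻ all-sinks e₀ + d ≤⟨ +-mono-≤ (load-dead e₀ (reduce-vanishes x e₀ d (tight fl))) (dem≤Δ t₀) ⟩
          0# + Δ ≈⟨ +-identityˡ Δ ⟩
          Δ ∎

        load-dead′ : ∀ e → ¬ 0# < x e → load z route all-sinks e ≤ 0#
        load-dead′ e dead with e Fin.≟ e₀ | load-all e
        ... | no _ | eq = ≤-trans (≤-reflexive (≈-trans eq (+-identityʳ _))) (load-dead e (λ p → dead (x′⇒x p)))
        ... | yes ≡.refl | _ = contradiction pos dead

        -- A retreat never adds crossing flow: having entered copy `j`, the terminal is assigned to
        -- `j` and has weight 0.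
        crossing′ : ∀ e {j} → layer (tl e) ≡ copy j → load z route (not-on j side) e ≤ Δ
        crossing′ e {j} l with e Fin.≟ e₀ | load-eq (not-on j side) e
        ... | no _ | eq = ≤-trans (≤-reflexive (≈-trans eq (+-identityʳ _))) (crossing e l)
        ... | yes ≡.refl | eq = begin
          load z route (not-on j side) e₀ ≈⟨ eq ⟩
          load z route⁻ (not-on j side) e₀ + not-on j side t₀ * d ≈⟨ +-congˡ (≈-trans (*-congʳ (not-on≈0 j side own)) (zeroˡ d)) ⟩
          load z route⁻ (not-on j side) e₀ + 0# ≈⟨ +-identityʳ _ ⟩
          load z route⁻ (not-on j side) e₀ ≤⟨ crossing e₀ l ⟩
          Δ ∎
          where
          l′ : layer (tp′ t₀) ≡ copy j
          l′ = ≡.trans (≡.cong layer (moved ≡.refl)) l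
          own : side t₀ ≡ j
          own = ≡.trans (side-com (λ q → contradiction (≡.trans (≡.sym q) l′) (λ ()))) (State.committed σ′ l′)

      reduction : Reduction σ
      reduction = σ′ , descends , extend

  -- Residual flows bounded by `Δ`.

  module Bounds (σ : State) where
    open State σ

    inflow≤ : ∀ e → x e ≤ at tl x (hd e) + at tp dem (hd e)
    inflow≤ e = begin
      x e ≤⟨ at-term x≥0 ≡.refl ⟩
      at hd x (hd e) ≤⟨ x≤x+y (at-nonNeg sup≥0 (hd e)) ⟩
      at hd x (hd e) + at sp sup (hd e) ≈⟨ conserve (hd e) ⟩
      at tl x (hd e) + at tp dem (hd e) ∎

    demand-at≤ : ∀ v → (∀ t u → tp t ≡ v → tp u ≡ v → 0# < dem t → 0# < dem u → t ≡ u) → at tp dem v ≤ Δ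
    demand-at≤ v unique with Fin.any? (λ t → (tp t Fin.≟ v) ×-dec (0# <? dem t))
    ... | yes (t , e , l) = ≤-trans (at-single dem≥0 t (λ u e′ l′ → unique u t e′ e l′ l)) (dem≤Δ t)
    ... | no none = ≤-trans (≤-reflexive (at-zero (λ t e → ≮⇒≈0 (dem≥0 t) (λ l → none (t , e , l))))) 0≤Δ

    no-outflow : ∀ {v} → (∀ f → 0# < x f → tl f ≢ v) → at tl x v ≈ 0#
    no-outflow root = at-zero λ f e → ≮⇒≈0 (x≥0 f) (λ p → root f p e)

    root-bound : ∀ e → (∀ f → 0# < x f → tl f ≢ hd e) →
      (∀ t u → tp t ≡ hd e → tp u ≡ hd e → 0# < dem t → 0# < dem u → t ≡ u) → x e ≤ Δ
    root-bound e root unique = begin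
      x e ≤⟨ inflow≤ e ⟩
      at tl x (hd e) + at tp dem (hd e) ≤⟨ +-mono-≤ (≤-reflexive (no-outflow root)) (demand-at≤ (hd e) unique) ⟩
      0# + Δ ≈⟨ +-identityˡ Δ ⟩
      Δ ∎

    -- No arc leaves a demand vertex and at most one terminal stands there, so this terminal must
    -- absorb the whole inflow.
    demand-bound : ∀ e → layer (hd e) ≡ demandLayer → x e ≤ Δ
    demand-bound e l = root-bound e (λ f _ eq → from-demand f (≡.trans (≡.cong layer eq) l))
      (λ t u p q _ _ → alone (≡.trans (≡.cong layer p) l) (≡.trans p (≡.sym q)))

    -- Unless some terminal at `hd e` has demand at least `x e`, two cases remain. If an arc leaves
    -- `hd e`, then by `regular` no live terminal stands there, and the flow passes on to the unique
    -- leaving arc, whose head is flagged and of higher rank. At a root, `one-irregular` with both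
    -- arcs equal to `e` leaves at most one live terminal, which absorbs the flow. Ranks are at most
    -- `tally rank`, so the chain ends.
    flag-bound : ∀ e → flag (hd e) ≡ true → 0# < x e → x e ≤ Δ
    flag-bound e = go (tally rank) e (ℕ.m≤m+n _ _)
      where
      rank≤ : ∀ {k} (r : Fin k → ℕ) i → r i ℕ.≤ tally r
      rank≤ r zero    = ℕ.m≤m+n _ _
      rank≤ r (suc i) = ℕ.≤-trans (rank≤ (r ∘ suc) i) (ℕ.m≤n+m _ _)

      go : ∀ k e → tally rank ℕ.≤ k ℕ.+ rank (hd e) → flag (hd e) ≡ true → 0# < x e → x e ≤ Δ
      go k e le fl pos with Fin.any? (λ f → (0# <? x f) ×-dec (tl f Fin.≟ hd e))
                          | Fin.any? (λ t → (tp t Fin.≟ hd e) ×-dec ((0# <? dem t) ×-dec (x e ≤? dem t)))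
      ... | _ | yes (t , _ , _ , le′) = ≤-trans le′ (dem≤Δ t)
      ... | no root | no none = root-bound e (λ f p q → root (f , p , q)) unique
        where
        unique : ∀ t u → tp t ≡ hd e → tp u ≡ hd e → 0# < dem t → 0# < dem u → t ≡ u
        unique t u p q lt lu with t Fin.≟ u
        ... | yes eq = eq
        ... | no ne with one-irregular {e} {e} fl pos pos ≡.refl p q lt lu ne
        ...   | inj₁ le′ = contradiction (t , p , lt , le′) none
        ...   | inj₂ le′ = contradiction (u , q , lu , le′) none
      ... | yes (f , pf , fe) | no none = begin
        x e ≤⟨ inflow≤ e ⟩
        at tl x (hd e) + at tp dem (hd e) ≈⟨ +-congˡ (at-zero λ t p → ≮⇒≈0 (dem≥0 t) (λ l → none (t , p , l , regular fl pos pf fe p l))) ⟩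
        at tl x (hd e) + 0# ≈⟨ +-identityʳ _ ⟩
        at tl x (hd e) ≤⟨ at-single x≥0 f (λ g ge pg → flag-unique (≡.subst (λ v → flag v ≡ true) (≡.sym fe) fl) pf pg (≡.trans ge (≡.sym fe))) ⟩
        x f ≤⟨ next k le ⟩
        Δ ∎
        where
        fl′ : flag (hd f) ≡ true
        fl′ = flag-closed (≡.subst (λ v → flag v ≡ true) (≡.sym fe) fl) pf
        up : rank (hd e) ℕ.< rank (hd f)
        up = ≡.subst (λ v → rank v ℕ.< rank (hd f)) fe (ranked f pf)
        next : ∀ k → tally rank ℕ.≤ k ℕ.+ rank (hd e) → x f ≤ Δ
        next zero    le = contradiction (ℕ.≤-<-trans le up) (ℕ.≤⇒≯ (rank≤ rank (hd f)))
        next (suc k) le = go k f (ℕ.≤-trans le (ℕ.≤-trans (ℕ.≤-reflexive (≡.sym (ℕ.+-suc k _))) (ℕ.+-monoʳ-≤ k up))) fl′ pf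

  -- Advance: all supply at a dead end moves forward.

  module Advance (σ : State) where
    open State σ
    open Bounds σ

    module _ (f₀ : Fin K) (pos : 0# < x f₀) (no-in : ∀ e → 0# < x e → hd e ≢ tl f₀)
             (only : ∀ e → 0# < x e → tl e ≡ tl f₀ → e ≡ f₀) (idle : ∀ t → 0# < dem t → tp t ≢ tl f₀) where
      private
        u : Fin N
        u = tl f₀

        q : Carrier
        q = x f₀

        x′ : Fin K → Carrier
        x′ = reduce x f₀ q

        sp′ : Fin S → Fin N
        sp′ s = if does (sp s Fin.≟ u) then hd f₀ else sp s

        x′⇒x : ∀ {e} → 0# < x′ e → 0# < x e
        x′⇒x = reduce-pos x f₀ q (x≥0 f₀)

        x′≤x : ∀ e → x′ e ≤ x e
        x′≤x = reduce≤ x f₀ q (x≥0 f₀)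

        -- Conservation at a vertex where nothing enters, nothing is demanded and only `f₀` leaves.
        -- Hence moving the whole supply kills `f₀`.
        supply-at : at sp sup u ≈ q
        supply-at = begin-equality
          at sp sup u ≈⟨ +-identityˡ _ ⟨
          0# + at sp sup u ≈⟨ +-congʳ (at-zero λ e h → ≮⇒≈0 (x≥0 e) (λ p → no-in e p h)) ⟨
          at hd x u + at sp sup u ≈⟨ conserve u ⟩
          at tl x u + at tp dem u ≈⟨ +-cong (≤-antisym (at-single x≥0 f₀ (λ e h p → only e p h)) (at-term x≥0 ≡.refl))
                                            (at-zero λ t h → ≮⇒≈0 (dem≥0 t) (λ l → idle t l h)) ⟩
          q + 0# ≈⟨ +-identityʳ q ⟩
          q ∎

        conserve′ : ∀ v → at hd x′ v + at sp′ sup v ≈ at tl x′ v + at tp dem v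
        conserve′ v = +-cancelʳ (H + U) (begin-equality
          (at hd x′ v + at sp′ sup v) + (H + U)
            ≈⟨ solve 4 (λ a b h k → (a :+ b) :+ (h :+ k) := (a :+ h) :+ (b :+ k)) ≈-refl (at hd x′ v) (at sp′ sup v) H U ⟩
          (at hd x′ v + H) + (at sp′ sup v + U)
            ≈⟨ +-cong (at-reduce x f₀ q hd v) redirect ⟩
          at hd x v + (at sp sup v + H)
            ≈⟨ +-assoc _ _ _ ⟨
          (at hd x v + at sp sup v) + H
            ≈⟨ +-congʳ (conserve v) ⟩
          (at tl x v + at tp dem v) + H
            ≈⟨ +-congʳ (+-congʳ (at-reduce x f₀ q tl v)) ⟨
          ((at tl x′ v + U) + at tp dem v) + H
            ≈⟨ solve 4 (λ a b h k → ((a :+ k) :+ b) :+ h := (a :+ b) :+ (h :+ k)) ≈-refl (at tl x′ v) (at tp dem v) H U ⟩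
          (at tl x′ v + at tp dem v) + (H + U) ∎)
          where
          H U : Carrier
          H = when (hd f₀ Fin.≟ v) q
          U = when (u Fin.≟ v) q
          redirect : at sp′ sup v + U ≈ at sp sup v + H
          redirect = begin-equality
            at sp′ sup v + U ≈⟨ +-congˡ (when-cong (u Fin.≟ v) λ _ → supply-at) ⟨
            at sp′ sup v + when (u Fin.≟ v) (at sp sup u) ≈⟨ at-redirect sp u (hd f₀) sup v ⟩
            at sp sup v + when (hd f₀ Fin.≟ v) (at sp sup u) ≈⟨ +-congˡ (when-cong (hd f₀ Fin.≟ v) λ _ → supply-at) ⟩
            at sp sup v + H ∎

      σ′ : State
      σ′ = record
        { x = x′ ; sup = sup ; dem = dem ; sp = sp′ ; tp = tp ; flag = flag ; com = com
        ; x≥0 = reduce-nonNeg x f₀ q ≤-refl x≥0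
        ; sup≥0 = sup≥0 ; dem≥0 = dem≥0 ; dem≤Δ = dem≤Δ
        ; conserve = conserve′
        ; ranked = λ e p → ranked e (x′⇒x p)
        ; flag-unique = λ fl p r → flag-unique fl (x′⇒x p) (x′⇒x r)
        ; flag-closed = λ fl p → flag-closed fl (x′⇒x p)
        ; regular = λ {e} fl pe pf fe tt lt → ≤-trans (x′≤x e) (regular fl (x′⇒x pe) (x′⇒x pf) fe tt lt)
        ; one-irregular = one-irregular′
        ; alone = alone
        ; committed = committed
        }
        where
        one-irregular′ : ∀ {e f t v} → flag (hd e) ≡ true → 0# < x′ e → 0# < x′ f → hd f ≡ hd e →
          tp t ≡ hd e → tp v ≡ hd e → 0# < dem t → 0# < dem v → t ≢ v → x′ e ≤ dem t ⊎ x′ f ≤ dem v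
        one-irregular′ {e} {f} fl pe pf fe tt ut lt lu ne with one-irregular fl (x′⇒x pe) (x′⇒x pf) fe tt ut lt lu ne
        ... | inj₁ le = inj₁ (≤-trans (x′≤x e) le)
        ... | inj₂ le = inj₂ (≤-trans (x′≤x f) le)

      descends : measure σ′ ℕ.< measure σ
      descends = measure-drop {σ′} {σ} (record
        { x-pos = λ _ → x′⇒x ; sup-pos = λ _ p → p ; dem-pos = λ _ p → p ; flags = λ _ p → p ; tp-rank = λ _ → ℕ.≤-refl })
        (x-drop f₀ pos (reduce-vanishes x f₀ q ≈-refl))

      extend : Solution σ′ → Solution σ
      extend sol = record
        { z = z ; route = route ; side = side ; z≥0 = z≥0 ; shipped = shipped ; delivered = delivered
        ; connects = λ {s} {t} → connects′ {s} {t}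
        ; side-com = side-com
        ; load≤ = λ e → load-grow x f₀ q e (load-all e) (load≤ e)
        ; load-flag = load-flag′
        ; load-dead = load-dead′
        ; crossing = crossing′
        ; spill = spill′
        }
        where
        open Solution sol renaming (route to route⁻)
        route : Fin S → Fin T → List (Fin K)
        route s t = if does (sp s Fin.≟ u) then f₀ ∷ route⁻ s t else route⁻ s t

        connects′ : ∀ {s t} → 0# < z s t → IsWalk (sp s) (route s t) (tp t)
        connects′ {s} {t} p with sp s Fin.≟ u | connects {s} {t} p
        ... | yes eq | w = ≡.sym eq , w
        ... | no _   | w = w

        shipping : (Fin T → Carrier) → Fin S → Carrier
        shipping w s = ∑ λ t → w t * z s t

        load-eq : ∀ w e → load z route w e ≈ load z route⁻ w e + when (e Fin.≟ f₀) (at sp (shipping w) u)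
        load-eq w e = ≈-trans (load-split z route route⁻ w e extra split) (+-congˡ total)
          where
          extra : Fin S → Fin T → Carrier
          extra s t = when (sp s Fin.≟ u) (when (e Fin.≟ f₀) (w t * z s t))
          split : ∀ s t → (w t * z s t) * count e (route s t) ≈ (w t * z s t) * count e (route⁻ s t) + extra s t
          split s t with sp s Fin.≟ u
          ... | no _  = ≈-sym (+-identityʳ _)
          ... | yes _ = begin-equality
            wz * (when (e Fin.≟ f₀) 1# + count e (route⁻ s t)) ≈⟨ distribˡ _ _ _ ⟩
            wz * when (e Fin.≟ f₀) 1# + wz * count e (route⁻ s t) ≈⟨ +-comm _ _ ⟩
            wz * count e (route⁻ s t) + wz * when (e Fin.≟ f₀) 1# ≈⟨ +-congˡ (≈-trans (*-when (e Fin.≟ f₀) wz 1#) (when-cong (e Fin.≟ f₀) λ _ → *-identityʳ wz)) ⟩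
            wz * count e (route⁻ s t) + when (e Fin.≟ f₀) wz ∎
            where
            wz : Carrier
            wz = w t * z s t
          swap : ∀ s → ∑ (extra s) ≈ when (e Fin.≟ f₀) (when (sp s Fin.≟ u) (shipping w s))
          swap s with sp s Fin.≟ u
          ... | yes _ = ≈-sym (when-∑ (e Fin.≟ f₀) _)
          ... | no _  = ≈-trans (∑-zero λ _ → ≈-refl) (≈-sym (when-0 (e Fin.≟ f₀)))
          total : ∑ (λ s → ∑ (extra s)) ≈ when (e Fin.≟ f₀) (at sp (shipping w) u)
          total = begin-equality
            ∑ (λ s → ∑ (extra s)) ≈⟨ ∑-cong swap ⟩
            ∑ (λ s → when (e Fin.≟ f₀) (when (sp s Fin.≟ u) (shipping w s))) ≈⟨ when-∑ (e Fin.≟ f₀) _ ⟨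
            when (e Fin.≟ f₀) (∑ λ s → when (sp s Fin.≟ u) (shipping w s)) ≈⟨ when-cong (e Fin.≟ f₀) (λ _ → ≈-reflexive (≡.sym (at-def sp (shipping w) u))) ⟩
            when (e Fin.≟ f₀) (at sp (shipping w) u) ∎

        load-all : ∀ e → load z route all-sinks e ≈ load z route⁻ all-sinks e + when (e Fin.≟ f₀) q
        load-all e = ≈-trans (load-eq all-sinks e) (+-congˡ (when-cong (e Fin.≟ f₀) λ _ →
          ≈-trans (at-cong (λ s → ≈-trans (∑-cong λ t → *-identityˡ _) (shipped s)) u) supply-at))

        dead₀ : ¬ 0# < x′ f₀
        dead₀ = reduce-vanishes x f₀ q ≈-refl

        load-flag′ : ∀ e → flag (hd e) ≡ true → load z route all-sinks e ≤ Δ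
        load-flag′ e fl with e Fin.≟ f₀ | load-all e
        ... | no _ | eq = ≤-trans (≤-reflexive (≈-trans eq (+-identityʳ _))) (load-flag e fl)
        ... | yes ≡.refl | eq = begin
          load z route all-sinks f₀ ≈⟨ eq ⟩
          load z route⁻ all-sinks f₀ + q ≤⟨ +-mono-≤ (load-dead f₀ dead₀) (flag-bound f₀ fl pos) ⟩
          0# + Δ ≈⟨ +-identityˡ Δ ⟩
          Δ ∎

        load-dead′ : ∀ e → ¬ 0# < x e → load z route all-sinks e ≤ 0#
        load-dead′ e dead with e Fin.≟ f₀ | load-all e
        ... | no _ | eq = ≤-trans (≤-reflexive (≈-trans eq (+-identityʳ _))) (load-dead e (λ p → dead (x′⇒x p)))
        ... | yes ≡.refl | _ = contradiction pos dead

        wz≥0 : ∀ j s t → 0# ≤ not-on j side t * z s t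
        wz≥0 j s t = *-nonNeg (not-on-nonNeg j side t) (z≥0 s t)

        wz≤z : ∀ j s t → not-on j side t * z s t ≤ z s t
        wz≤z j s t = begin
          not-on j side t * z s t ≈⟨ *-comm _ _ ⟩
          z s t * not-on j side t ≤⟨ *-monoˡ-≤ (z≥0 s t) (not-on≤1 j side t) ⟩
          z s t * 1# ≈⟨ *-identityʳ _ ⟩
          z s t ∎

        redirected : ∀ {j} v w → (∀ s → sp s ≡ v → sp′ s ≡ w) →
          at sp (shipping (not-on j side)) v ≤ at sp′ (shipping (not-on j side)) w
        redirected {j} v w follow = begin
          at sp (shipping (not-on j side)) v ≈⟨ ≈-reflexive (at-def sp _ v) ⟩
          ∑ (λ s → when (sp s Fin.≟ v) (shipping (not-on j side) s)) ≤⟨ ∑-mono le ⟩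
          ∑ (λ s → when (sp′ s Fin.≟ w) (shipping (not-on j side) s)) ≈⟨ ≈-reflexive (at-def sp′ _ w) ⟨
          at sp′ (shipping (not-on j side)) w ∎
          where
          le : ∀ s → when (sp s Fin.≟ v) (shipping (not-on j side) s) ≤ when (sp′ s Fin.≟ w) (shipping (not-on j side) s)
          le s with sp s Fin.≟ v
          ... | yes eq = ≤-reflexive (≈-reflexive (≡.sym (when-yes (sp′ s Fin.≟ w) (follow s eq))))
          ... | no _ = when-nonNeg (sp′ s Fin.≟ w) (∑-nonNeg (wz≥0 j s))

        -- The supply at `u` travels on as a whole, so its spill is part of the spill at `hd f₀` if
        -- that lies in the same copy. If `f₀` is a drain, even the total supply is at most its
        -- flow, which `demand-bound` limits; this is where the bound on all crossing flow begins.
        spill-here : ∀ {j} → layer u ≡ copy j → at sp (shipping (not-on j side)) u ≤ Δ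
        spill-here {j} l with layer (hd f₀) in eq
        ... | supplyLayer = contradiction eq (into-supply f₀)
        ... | copy i = ≤-trans (redirected u (hd f₀) follow) (spill (hd f₀) (≡.trans eq (≡.cong copy (≡.sym (same-copy f₀ l eq)))))
          where
          follow : ∀ s → sp s ≡ u → sp′ s ≡ hd f₀
          follow s e with sp s Fin.≟ u
          ... | yes _ = ≡.refl
          ... | no ne = contradiction e ne
        ... | demandLayer = begin
          at sp (shipping (not-on j side)) u ≤⟨ at-mono (λ s → ≤-trans (∑-mono (wz≤z j s)) (≤-reflexive (shipped s))) u ⟩
          at sp sup u ≈⟨ supply-at ⟩
          q ≤⟨ demand-bound f₀ eq ⟩
          Δ ∎

        spill′ : ∀ v {j} → layer v ≡ copy j → at sp (shipping (not-on j side)) v ≤ Δ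
        spill′ v {j} l with v Fin.≟ u
        ... | yes ≡.refl = spill-here l
        ... | no ne = ≤-trans (redirected v v follow) (spill v l)
          where
          follow : ∀ s → sp s ≡ v → sp′ s ≡ v
          follow s e with sp s Fin.≟ u
          ... | yes e′ = contradiction (≡.trans (≡.sym e) e′) ne
          ... | no _ = e

        crossing′ : ∀ e {j} → layer (tl e) ≡ copy j → load z route (not-on j side) e ≤ Δ
        crossing′ e {j} l with e Fin.≟ f₀ | load-eq (not-on j side) e
        ... | no _ | eq = ≤-trans (≤-reflexive (≈-trans eq (+-identityʳ _))) (crossing e l)
        ... | yes ≡.refl | eq = begin
          load z route (not-on j side) f₀ ≈⟨ eq ⟩
          -- After the move `f₀` is dead and gets no later load, so its crossing flow is just the
          -- spill at its tail.
          load z route⁻ (not-on j side) f₀ + at sp (shipping (not-on j side)) u ≤⟨ +-mono-≤ dominated (spill-here l) ⟩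
          0# + Δ ≈⟨ +-identityˡ Δ ⟩
          Δ ∎
          where
          dominated : load z route⁻ (not-on j side) f₀ ≤ 0#
          dominated = ≤-trans (∑-mono λ s → ∑-mono λ t → begin
            (not-on j side t * z s t) * count f₀ (route⁻ s t) ≈⟨ *-comm _ _ ⟩
            count f₀ (route⁻ s t) * (not-on j side t * z s t) ≤⟨ *-monoˡ-≤ (count-nonNeg f₀ (route⁻ s t)) (wz≤z j s t) ⟩
            count f₀ (route⁻ s t) * z s t ≈⟨ ≈-trans (*-comm _ _) (*-congʳ (≈-sym (*-identityˡ _))) ⟩
            (1# * z s t) * count f₀ (route⁻ s t) ∎) (load-dead f₀ dead₀)

      reduction : Reduction σ
      reduction = σ′ , descends , extend

  -- Match: a supply meets a terminal.

  module Match (σ : State) where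
    open State σ

    -- Shrinking the demand of `t₀` can make it irregular. `dead-end` restricts this to vertices
    -- where `regular` demands nothing, and `others` makes every other terminal there regular, so
    -- that `one-irregular` survives. `exhausts` makes the measure drop.
    module _ (s₀ : Fin S) (t₀ : Fin T) (live-s : 0# < sup s₀) (live-t : 0# < dem t₀) (here : sp s₀ ≡ tp t₀)
             (dead-end : (∀ f → 0# < x f → tl f ≢ tp t₀) ⊎ (∀ e → 0# < x e → hd e ≢ tp t₀))
             (others : ∀ {t e} → flag (hd e) ≡ true → 0# < x e → tp t₀ ≡ hd e → tp t ≡ hd e → 0# < dem t → t ≢ t₀ → x e ≤ dem t)
             (μ : Carrier) (0≤μ : 0# ≤ μ) (μ≤sup : μ ≤ sup s₀) (μ≤dem : μ ≤ dem t₀)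
             (exhausts : sup s₀ ≈ μ ⊎ dem t₀ ≈ μ) where
      private
        sup′ : Fin S → Carrier
        sup′ = reduce sup s₀ μ

        dem′ : Fin T → Carrier
        dem′ = reduce dem t₀ μ

        dem′⇒dem : ∀ {t} → 0# < dem′ t → 0# < dem t
        dem′⇒dem = reduce-pos dem t₀ μ 0≤μ

        dem′-other : ∀ {t} → t ≢ t₀ → dem t ≤ dem′ t
        dem′-other ne = ≤-reflexive (≈-sym (reduce-other dem t₀ μ ne))

        conserve′ : ∀ v → at hd x v + at sp sup′ v ≈ at tl x v + at tp dem′ v
        conserve′ v = +-cancelʳ (when (sp s₀ Fin.≟ v) μ) (begin-equality
          (at hd x v + at sp sup′ v) + when (sp s₀ Fin.≟ v) μ ≈⟨ +-assoc _ _ _ ⟩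
          at hd x v + (at sp sup′ v + when (sp s₀ Fin.≟ v) μ) ≈⟨ +-congˡ (at-reduce sup s₀ μ sp v) ⟩
          at hd x v + at sp sup v ≈⟨ conserve v ⟩
          at tl x v + at tp dem v ≈⟨ +-congˡ (at-reduce dem t₀ μ tp v) ⟨
          at tl x v + (at tp dem′ v + when (tp t₀ Fin.≟ v) μ) ≈⟨ +-congˡ (+-congˡ (≈-reflexive (≡.cong (λ u → when (u Fin.≟ v) μ) here))) ⟨
          at tl x v + (at tp dem′ v + when (sp s₀ Fin.≟ v) μ) ≈⟨ +-assoc _ _ _ ⟨
          (at tl x v + at tp dem′ v) + when (sp s₀ Fin.≟ v) μ ∎)

      σ′ : State
      σ′ = record
        { x = x ; sup = sup′ ; dem = dem′ ; sp = sp ; tp = tp ; flag = flag ; com = com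
        ; x≥0 = x≥0
        ; sup≥0 = reduce-nonNeg sup s₀ μ μ≤sup sup≥0
        ; dem≥0 = reduce-nonNeg dem t₀ μ μ≤dem dem≥0
        ; dem≤Δ = λ t → ≤-trans (reduce≤ dem t₀ μ 0≤μ t) (dem≤Δ t)
        ; conserve = conserve′
        ; ranked = ranked ; flag-unique = flag-unique ; flag-closed = flag-closed
        ; regular = regular′ ; one-irregular = one-irregular′
        ; alone = alone ; committed = committed
        }
        where
        regular′ : ∀ {e f t} → flag (hd e) ≡ true → 0# < x e → 0# < x f → tl f ≡ hd e →
          tp t ≡ hd e → 0# < dem′ t → x e ≤ dem′ t
        regular′ {e} {f} {t} fl pe pf fe tt lt with t Fin.≟ t₀
        ... | no ne = ≤-trans (regular fl pe pf fe tt (dem′⇒dem lt)) (dem′-other ne)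
        ... | yes ≡.refl = [ (λ root → contradiction (≡.trans fe (≡.sym tt)) (root f pf))
                           , (λ no-in → contradiction (≡.sym tt) (no-in e pe)) ]′ dead-end
        one-irregular′ : ∀ {e f t u} → flag (hd e) ≡ true → 0# < x e → 0# < x f → hd f ≡ hd e →
          tp t ≡ hd e → tp u ≡ hd e → 0# < dem′ t → 0# < dem′ u → t ≢ u → x e ≤ dem′ t ⊎ x f ≤ dem′ u
        one-irregular′ {e} {f} {t} {u} fl pe pf fe tt ut lt lu t≢u with t Fin.≟ t₀ | u Fin.≟ t₀
        ... | yes p | yes q = contradiction (≡.trans p (≡.sym q)) t≢u
        ... | yes ≡.refl | no q = inj₂ (≤-trans
                (others (≡.subst (λ v → flag v ≡ true) (≡.sym fe) fl) pf (≡.trans tt (≡.sym fe)) (≡.trans ut (≡.sym fe)) (dem′⇒dem lu) q)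
                (dem′-other q))
        ... | no p | yes ≡.refl = inj₁ (≤-trans (others fl pe ut tt (dem′⇒dem lt) p) (dem′-other p))
        ... | no p | no q with one-irregular fl pe pf fe tt ut (dem′⇒dem lt) (dem′⇒dem lu) t≢u
        ...   | inj₁ le = inj₁ (≤-trans le (dem′-other p))
        ...   | inj₂ le = inj₂ (≤-trans le (dem′-other q))

      descends : measure σ′ ℕ.< measure σ
      descends = measure-drop {σ′} {σ} (record
        { x-pos = λ _ p → p ; sup-pos = λ _ → reduce-pos sup s₀ μ 0≤μ ; dem-pos = λ _ → dem′⇒dem
        ; flags = λ _ p → p ; tp-rank = λ _ → ℕ.≤-refl }) (drop exhausts)
        where
        drop : sup s₀ ≈ μ ⊎ dem t₀ ≈ μ → Strictly σ′ σ
        drop (inj₁ e) = sup-drop s₀ live-s (reduce-vanishes sup s₀ μ e)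
        drop (inj₂ e) = dem-drop t₀ live-t (reduce-vanishes dem t₀ μ e)

      extend : Solution σ′ → Solution σ
      extend sol = record
        { z = z ; route = route ; side = side
        ; z≥0 = λ s t → +-nonNeg (z⁻≥0 s t) (when-nonNeg (s Fin.≟ s₀) (when-nonNeg (t Fin.≟ t₀) 0≤μ))
        ; shipped = shipped′
        ; delivered = delivered′
        ; connects = λ {s} {t} → connects′ {s} {t}
        ; side-com = side-com
        ; load≤ = λ e → ≤-trans (load-mono all-sinks e (λ _ → 0≤1)) (load≤ e)
        ; load-flag = λ e fl → ≤-trans (load-mono all-sinks e (λ _ → 0≤1)) (load-flag e fl)
        ; load-dead = λ e de → ≤-trans (load-mono all-sinks e (λ _ → 0≤1)) (load-dead e de)
        ; crossing = λ e {j} l → ≤-trans (load-mono (not-on j side) e (not-on-nonNeg j side)) (crossing e l)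
        ; spill = spill′
        }
        where
        open Solution sol renaming (z to z⁻; route to route⁻; z≥0 to z⁻≥0)
        new : Fin S → Fin T → Carrier
        new s t = when (s Fin.≟ s₀) (when (t Fin.≟ t₀) μ)

        z : Fin S → Fin T → Carrier
        z s t = z⁻ s t + new s t

        route : Fin S → Fin T → List (Fin K)
        -- Source and terminal share a vertex, so the empty walk serves the whole flow of the pair.
        -- Putting it in place of the earlier route can only lower loads, and the pair keeps a
        -- single route.
        route s t = if does (s Fin.≟ s₀) then (if does (t Fin.≟ t₀) then [] else route⁻ s t) else route⁻ s t

        shipped′ : ∀ s → ∑ (z s) ≈ sup s
        shipped′ s = begin-equality
          ∑ (z s) ≈⟨ ∑-+ _ _ ⟩
          ∑ (z⁻ s) + ∑ (new s) ≈⟨ +-cong (shipped s) (≈-trans (≈-sym (when-∑ (s Fin.≟ s₀) _)) (when-cong (s Fin.≟ s₀) λ _ → ∑-pick t₀ _)) ⟩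
          sup′ s + when (s Fin.≟ s₀) μ ≈⟨ reduce-plus sup s₀ μ s ⟩
          sup s ∎

        delivered′ : ∀ t → ∑ (λ s → z s t) ≈ dem t
        delivered′ t = begin-equality
          ∑ (λ s → z s t) ≈⟨ ∑-+ _ _ ⟩
          ∑ (λ s → z⁻ s t) + ∑ (λ s → new s t) ≈⟨ +-cong (delivered t) (∑-pick s₀ _) ⟩
          dem′ t + when (t Fin.≟ t₀) μ ≈⟨ reduce-plus dem t₀ μ t ⟩
          dem t ∎

        connects′ : ∀ {s t} → 0# < z s t → IsWalk (sp s) (route s t) (tp t)
        connects′ {s} {t} p with s Fin.≟ s₀ | t Fin.≟ t₀ | connects {s} {t}
        ... | yes ≡.refl | yes ≡.refl | _ = here
        ... | yes _ | no _ | w = w (<-≤-trans p (≤-reflexive (+-identityʳ _)))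
        ... | no _  | _    | w = w (<-≤-trans p (≤-reflexive (+-identityʳ _)))

        load-mono : ∀ w e → (∀ t → 0# ≤ w t) → load z route w e ≤ load z⁻ route⁻ w e
        load-mono w e w≥0 = ∑-mono λ s → ∑-mono λ t → le s t
          where
          le : ∀ s t → (w t * z s t) * count e (route s t) ≤ (w t * z⁻ s t) * count e (route⁻ s t)
          le s t with s Fin.≟ s₀ | t Fin.≟ t₀
          ... | yes _ | yes _ = ≤-trans (≤-reflexive (zeroʳ _)) (*-nonNeg (*-nonNeg (w≥0 t) (z⁻≥0 s t)) (count-nonNeg e (route⁻ s t)))
          ... | yes _ | no _  = ≤-reflexive (*-congʳ (*-congˡ (+-identityʳ _)))
          ... | no _  | _     = ≤-reflexive (*-congʳ (*-congˡ (+-identityʳ _)))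

        spill′ : ∀ v {j} → layer v ≡ copy j → at sp (λ s → ∑ λ t → not-on j side t * z s t) v ≤ Δ
        spill′ v {j} l = begin
          at sp (λ s → ∑ λ t → w t * z s t) v
            ≈⟨ at-cong row v ⟩
          at sp (λ s → (∑ λ t → w t * z⁻ s t) + when (s Fin.≟ s₀) (w t₀ * μ)) v
            ≈⟨ at-+ _ _ v ⟩
          at sp (λ s → ∑ λ t → w t * z⁻ s t) v + at sp (λ s → when (s Fin.≟ s₀) (w t₀ * μ)) v
            ≈⟨ +-congˡ (at-pick s₀ _ v) ⟩
          at sp (λ s → ∑ λ t → w t * z⁻ s t) v + when (sp s₀ Fin.≟ v) (w t₀ * μ)
            -- If the match takes place in copy `j`, the terminal stands in `j` and is assigned to
            -- it, so the new flow has weight 0.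
            ≈⟨ +-congˡ (when-≈0 (sp s₀ Fin.≟ v) λ e → ≈-trans (*-congʳ (not-on≈0 j side (own e))) (zeroˡ μ)) ⟩
          at sp (λ s → ∑ λ t → w t * z⁻ s t) v + 0#
            ≈⟨ +-identityʳ _ ⟩
          at sp (λ s → ∑ λ t → w t * z⁻ s t) v
            ≤⟨ spill v l ⟩
          Δ ∎
          where
          w : Fin T → Carrier
          w = not-on j side
          row : ∀ s → (∑ λ t → w t * z s t) ≈ (∑ λ t → w t * z⁻ s t) + when (s Fin.≟ s₀) (w t₀ * μ)
          row s = begin-equality
            (∑ λ t → w t * z s t) ≈⟨ ∑-cong (λ t → distribˡ (w t) _ _) ⟩
            (∑ λ t → w t * z⁻ s t + w t * new s t) ≈⟨ ∑-+ _ _ ⟩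
            (∑ λ t → w t * z⁻ s t) + (∑ λ t → w t * new s t) ≈⟨ +-congˡ (∑-cong λ t → pull t) ⟩
            (∑ λ t → w t * z⁻ s t) + (∑ λ t → when (t Fin.≟ t₀) (when (s Fin.≟ s₀) (w t * μ))) ≈⟨ +-congˡ (∑-pick t₀ _) ⟩
            (∑ λ t → w t * z⁻ s t) + when (s Fin.≟ s₀) (w t₀ * μ) ∎
            where
            pull : ∀ t → w t * new s t ≈ when (t Fin.≟ t₀) (when (s Fin.≟ s₀) (w t * μ))
            pull t with s Fin.≟ s₀ | t Fin.≟ t₀
            ... | yes _ | yes _ = ≈-refl
            ... | yes _ | no _  = zeroʳ _
            ... | no _  | yes _ = zeroʳ _
            ... | no _  | no _  = zeroʳ _
          own : sp s₀ ≡ v → side t₀ ≡ j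
          own e = ≡.trans (side-com (λ q → contradiction (≡.trans (≡.sym q) l′) (λ ()))) (committed l′)
            where
            l′ : layer (tp t₀) ≡ copy j
            l′ = ≡.trans (≡.cong layer (≡.trans (≡.sym here) e)) l

      reduction : Reduction σ
      reduction = σ′ , descends , extend

  -- Flagging a vertex.

  module Flagging (σ : State) where
    open State σ

    -- The flagged forest grows backwards from the roots: a vertex joins once its only leaving arc,
    -- if any, leads to a flagged vertex. At that moment `small` makes all terminals regular, even
    -- at a root; irregular ones arise only from later retreats and matches.
    module _ (v₀ : Fin N) (unflagged : flag v₀ ≡ false)
             (closed : ∀ e → 0# < x e → tl e ≡ v₀ → flag (hd e) ≡ true)
             (unique : ∀ e f → 0# < x e → 0# < x f → tl e ≡ v₀ → tl f ≡ v₀ → f ≡ e)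
             (small : ∀ e t → 0# < x e → 0# < dem t → hd e ≡ v₀ → tp t ≡ v₀ → x e ≤ dem t) where
      private
        flag′ : Fin N → Bool
        flag′ = flag [ v₀ ↦ true ]

        flag⇒flag′ : ∀ {v} → flag v ≡ true → flag′ v ≡ true
        flag⇒flag′ {v} fl with v Fin.≟ v₀
        ... | yes _ = ≡.refl
        ... | no _  = fl

      σ′ : State
      σ′ = record
        { x = x ; sup = sup ; dem = dem ; sp = sp ; tp = tp ; flag = flag′ ; com = com
        ; x≥0 = x≥0 ; sup≥0 = sup≥0 ; dem≥0 = dem≥0 ; dem≤Δ = dem≤Δ
        ; conserve = conserve ; ranked = ranked
        ; flag-unique = flag-unique′ ; flag-closed = λ fl p → flag⇒flag′ (flag-closed′ fl p)
        ; regular = regular′ ; one-irregular = one-irregular′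
        ; alone = alone ; committed = committed
        }
        where
        flag-unique′ : ∀ {e f} → flag′ (tl e) ≡ true → 0# < x e → 0# < x f → tl f ≡ tl e → f ≡ e
        flag-unique′ {e} {f} fl pe pf fe with tl e Fin.≟ v₀
        ... | yes p = unique e f pe pf p (≡.trans fe p)
        ... | no _  = flag-unique fl pe pf fe
        flag-closed′ : ∀ {e} → flag′ (tl e) ≡ true → 0# < x e → flag (hd e) ≡ true
        flag-closed′ {e} fl p with tl e Fin.≟ v₀
        ... | yes q = closed e p q
        ... | no _  = flag-closed fl p
        regular′ : ∀ {e f t} → flag′ (hd e) ≡ true → 0# < x e → 0# < x f → tl f ≡ hd e →
          tp t ≡ hd e → 0# < dem t → x e ≤ dem t
        regular′ {e} {f} {t} fl pe pf fe tt lt with hd e Fin.≟ v₀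
        ... | yes p = small e t pe lt p (≡.trans tt p)
        ... | no _  = regular fl pe pf fe tt lt
        one-irregular′ : ∀ {e f t u} → flag′ (hd e) ≡ true → 0# < x e → 0# < x f → hd f ≡ hd e →
          tp t ≡ hd e → tp u ≡ hd e → 0# < dem t → 0# < dem u → t ≢ u → x e ≤ dem t ⊎ x f ≤ dem u
        one-irregular′ {e} {f} {t} fl pe pf fe tt ut lt lu ne with hd e Fin.≟ v₀
        ... | yes p = inj₁ (small e t pe lt p (≡.trans tt p))
        ... | no _  = one-irregular fl pe pf fe tt ut lt lu ne

      descends : measure σ′ ℕ.< measure σ
      descends = measure-drop {σ′} {σ} (record
        { x-pos = λ _ p → p ; sup-pos = λ _ p → p ; dem-pos = λ _ p → p ; flags = le ; tp-rank = λ _ → ℕ.≤-refl })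
        (flag-drop v₀ unflagged λ q → contradiction (≡.trans (≡.sym (↦-same flag v₀ true)) q) (λ ()))
        where
        le : ∀ v → flag′ v ≡ false → flag v ≡ false
        le v p with v Fin.≟ v₀
        ... | no _ = p

      extend : Solution σ′ → Solution σ
      extend sol = record
        { z = z ; route = route ; side = side ; z≥0 = z≥0 ; shipped = shipped ; delivered = delivered
        ; connects = connects ; side-com = side-com ; load≤ = load≤
        ; load-flag = λ e fl → load-flag e (flag⇒flag′ fl)
        ; load-dead = load-dead ; crossing = crossing ; spill = spill }
        where open Solution sol

      reduction : Reduction σ
      reduction = σ′ , descends , extend

  -- Augmenting along a signed cycle when no other move applies.

  module Augment (σ : State) where
    open State σ

    Root NoIn : Fin N → Set
    Root v = ∀ f → 0# < x f → tl f ≢ v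
    NoIn v = ∀ e → 0# < x e → hd e ≢ v

    module _
      (no-match : ∀ s t → 0# < sup s → 0# < dem t → sp s ≡ tp t → ¬ (Root (tp t) ⊎ NoIn (tp t)))
      (no-retreat : ∀ t e → 0# < dem t → 0# < x e → tp t ≡ hd e → dem t ≤ x e → ¬ (flag (hd e) ≡ true → x e ≈ dem t))
      (no-advance : ∀ f → 0# < x f → NoIn (tl f) → ¬ (∀ e → 0# < x e → tl e ≡ tl f → e ≡ f))
      (no-flag : ∀ v → flag v ≡ false → (∀ e → 0# < x e → tl e ≡ v → flag (hd e) ≡ true) →
                 ¬ (∀ e f → 0# < x e → 0# < x f → tl e ≡ v → tl f ≡ v → f ≡ e))
      where

      -- Arcs traversed forwards are lowered and arcs traversed backwards are raised, so only arcs
      -- into flagged vertices may be traversed backwards.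
      data Step : Set where
        fwd : ∀ e → 0# < x e → Step
        bwd : ∀ e → 0# < x e → flag (hd e) ≡ true → Step

      arc : Step → Fin K
      arc (fwd e _)   = e
      arc (bwd e _ _) = e

      backward : Step → Bool
      backward (fwd _ _)   = false
      backward (bwd _ _ _) = true

      arc-pos : ∀ τ → 0# < x (arc τ)
      arc-pos (fwd _ p)   = p
      arc-pos (bwd _ p _) = p

      start : Step → Fin N
      start τ = if backward τ then hd (arc τ) else tl (arc τ)

      root-flagged : ∀ {v} → Root v → flag v ≡ true
      root-flagged {v} root with flag v in eq
      ... | true  = ≡.refl
      ... | false = contradiction (λ e f p _ q → contradiction q (root e p))
                      (no-flag v eq (λ e p q → contradiction q (root e p)))

      -- At a root with a single entering arc e, the flow x e would equal the total demand there,
      -- which at most one irregular terminal allows only for a lone terminal: it could retreat.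
      second-arc : ∀ e → 0# < x e → Root (hd e) → ∃[ f ] 0# < x f × hd f ≡ hd e × f ≢ e
      second-arc e pos root with Fin.any? (λ f → (0# <? x f) ×-dec ((hd f Fin.≟ hd e) ×-dec ¬? (f Fin.≟ e)))
      ... | yes r = r
      ... | no none = ⊥-elim (no-retreat t₀ e live pos at₀ (≤-trans (at-term dem≥0 at₀) total≤) (λ _ → tight))
        where
        v : Fin N
        v = hd e

        single : at hd x v ≤ x e
        single = at-single x≥0 e only
          where
          only : ∀ f → hd f ≡ v → 0# < x f → f ≡ e
          only f h p with f Fin.≟ e
          ... | yes q = q
          ... | no ne = contradiction (f , p , h , ne) none

        demand : at hd x v + at sp sup v ≈ at tp dem v
        demand = ≈-trans (conserve v) (≈-trans (+-congʳ (Bounds.no-outflow σ root)) (+-identityˡ _))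

        demanded : ∃[ t ] tp t ≡ v × 0# < dem t
        demanded = at-pos⇒∃ dem≥0 (<-≤-trans pos (begin
          x e ≤⟨ at-term x≥0 ≡.refl ⟩
          at hd x v ≤⟨ x≤x+y (at-nonNeg sup≥0 v) ⟩
          at hd x v + at sp sup v ≈⟨ demand ⟩
          at tp dem v ∎))

        t₀ : Fin T
        t₀ = proj₁ demanded
        at₀ : tp t₀ ≡ v
        at₀ = proj₁ (proj₂ demanded)
        live : 0# < dem t₀
        live = proj₂ (proj₂ demanded)

        no-supply : at sp sup v ≈ 0#
        no-supply = at-zero λ s q → ≮⇒≈0 (sup≥0 s) λ l →
          no-match s t₀ l live (≡.trans q (≡.sym at₀)) (inj₁ (≡.subst Root (≡.sym at₀) root))

        total≤ : at tp dem v ≤ x e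
        total≤ = begin
          at tp dem v ≈⟨ demand ⟨
          at hd x v + at sp sup v ≈⟨ +-congˡ no-supply ⟩
          at hd x v + 0# ≈⟨ +-identityʳ _ ⟩
          at hd x v ≤⟨ single ⟩
          x e ∎

        ≤total : x e ≤ at tp dem v
        ≤total = begin
          x e ≤⟨ Bounds.inflow≤ σ e ⟩
          at tl x v + at tp dem v ≈⟨ +-congʳ (Bounds.no-outflow σ root) ⟩
          0# + at tp dem v ≈⟨ +-identityˡ _ ⟩
          at tp dem v ∎

        unique : ∀ u → tp u ≡ v → 0# < dem u → u ≡ t₀
        unique u q lu with u Fin.≟ t₀
        ... | yes p = p
        ... | no ne = ⊥-elim (absurd (one-irregular {e} {e} (root-flagged root) pos pos ≡.refl q at₀ lu live ne))
          where
          both : dem u + dem t₀ ≤ x e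
          both = ≤-trans (at-two-terms dem≥0 ne q at₀) total≤
          absurd : ¬ (x e ≤ dem u ⊎ x e ≤ dem t₀)
          absurd (inj₁ le) = <⇒≱ live (+-cancelʳ-≤ (dem u) (begin
            dem t₀ + dem u ≈⟨ +-comm _ _ ⟩
            dem u + dem t₀ ≤⟨ ≤-trans both le ⟩
            dem u ≈⟨ +-identityˡ _ ⟨
            0# + dem u ∎))
          absurd (inj₂ le) = <⇒≱ lu (+-cancelʳ-≤ (dem t₀) (begin
            dem u + dem t₀ ≤⟨ ≤-trans both le ⟩
            dem t₀ ≈⟨ +-identityˡ _ ⟨
            0# + dem t₀ ∎))

        tight : x e ≈ dem t₀
        tight = ≤-antisym (≤-trans ≤total (at-single dem≥0 t₀ unique)) (≤-trans (at-term dem≥0 at₀) total≤)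

      -- The walk continues forwards while some arc leaves. At a root, which is flagged, it turns
      -- back over a second entering arc, so that it does not reverse on `e`.
      after-fwd : ∀ e → 0# < x e → Σ[ τ ∈ Step ] hd e ≡ start τ × (arc τ ≡ e → backward τ ≡ false)
      after-fwd e pos with Fin.any? (λ f → (0# <? x f) ×-dec (tl f Fin.≟ hd e))
      ... | yes (f , p , q) = fwd f p , ≡.sym q , λ _ → ≡.refl
      ... | no none with second-arc e pos (λ f p q → none (f , p , q))
      ...   | f , p , q , ne = bwd f p (≡.subst (λ v → flag v ≡ true) (≡.sym q) (root-flagged (λ g r s → none (g , r , s)))) ,
                               ≡.sym q , λ a → contradiction a ne

      -- If another arc leaves the tail, the walk turns forwards along it. Otherwise `e` is the only
      -- leaving arc and leads to a flagged vertex, so the tail is flagged as well and the walk may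
      -- go on backwards; an entering arc exists since the supply at the tail could otherwise
      -- advance.
      after-bwd : ∀ e → 0# < x e → flag (hd e) ≡ true → Σ[ τ ∈ Step ] tl e ≡ start τ × (arc τ ≡ e → backward τ ≡ true)
      after-bwd e pos fl with Fin.any? (λ g → (0# <? x g) ×-dec ((tl g Fin.≟ tl e) ×-dec ¬? (g Fin.≟ e)))
      ... | yes (g , p , q , ne) = fwd g p , ≡.sym q , λ a → contradiction a ne
      ... | no none = enter
        where
        only : ∀ f → 0# < x f → tl f ≡ tl e → f ≡ e
        only f p q with f Fin.≟ e
        ... | yes r = r
        ... | no ne = contradiction (f , p , q , ne) none
        flagged : flag (tl e) ≡ true
        flagged with flag (tl e) in eq
        ... | true  = ≡.refl
        ... | false = contradiction
          (λ f g p q r s → ≡.trans (only g q s) (≡.sym (only f p r)))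
          (no-flag (tl e) eq (λ f p q → ≡.subst (λ g → flag (hd g) ≡ true) (≡.sym (only f p q)) fl))
        enter : Σ[ τ ∈ Step ] tl e ≡ start τ × (arc τ ≡ e → backward τ ≡ true)
        enter with Fin.any? (λ f → (0# <? x f) ×-dec (hd f Fin.≟ tl e))
        ... | yes (f , p , q) = bwd f p (≡.subst (λ v → flag v ≡ true) (≡.sym q) flagged) , ≡.sym q , λ _ → ≡.refl
        ... | no no-in = contradiction only (no-advance e pos λ f p q → no-in (f , p , q))

      after : ∀ τ → Σ[ τ′ ∈ Step ] (if backward τ then tl (arc τ) else hd (arc τ)) ≡ start τ′ ×
                                   (arc τ′ ≡ arc τ → backward τ′ ≡ backward τ)
      after (fwd e p)    = after-fwd e p
      after (bwd e p fl) = after-bwd e p fl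

      next : Step → Step
      next τ = proj₁ (after τ)

      open SignedCycles ℝ tl hd arc backward next using (module Cycle; Cycle; cycle)

      module _ (C : Cycle (λ τ → proj₁ (proj₂ (after τ))) (λ τ → proj₂ (proj₂ (after τ)))) where
        open Cycle C

        raised-flag : ∀ {e} → change e ≡ raised → flag (hd e) ≡ true
        raised-flag eq with raised⇒ eq
        ... | bwd e _ fl , ≡.refl , _ = fl

        change-pos : ∀ {e} → change e ≢ fixed → 0# < x e
        change-pos {e} ne with change e in eq
        ... | fixed = contradiction ≡.refl ne
        ... | raised with raised⇒ eq
        ...   | τ , ≡.refl , _ = arc-pos τ
        change-pos {e} ne | lowered with lowered⇒ eq
        ...   | τ , ≡.refl , _ = arc-pos τ

        -- With equality the terminal could retreat over `e`.
        slack : ∀ {e t} → change e ≡ raised → 0# < dem t → tp t ≡ hd e → x e ≤ dem t → x e < dem t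
        slack {e} {t} eq l q le = le , λ ≈ → no-retreat t e l (change-pos λ f → contradiction (≡.trans (≡.sym eq) f) λ ()) q
          (≤-reflexive (≈-sym ≈)) (λ _ → ≈)

        -- Two events limit `ε`: a lowered arc reaches 0, or a raised arc reaches the demand of a
        -- terminal at its head. Only terminals whose demand still exceeds the flow count, as the
        -- invariants ask nothing more of an irregular pair.
        module Shifted (ε : Carrier) (0≤ε : 0# ≤ ε) (lowered≤ : ∀ e → change e ≡ lowered → ε ≤ x e)
          (raised≤ : ∀ e t → change e ≡ raised → 0# < dem t → tp t ≡ hd e → x e < dem t → x e + ε ≤ dem t) where

          x′ : Fin K → Carrier
          x′ e = shift (change e) ε (x e)

          x′≥0 : ∀ e → 0# ≤ x′ e
          x′≥0 e with change e in eq
          ... | raised  = +-nonNeg (x≥0 e) 0≤ε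
          ... | lowered = 0≤x-y (lowered≤ e eq)
          ... | fixed   = x≥0 e

          x′≤x : ∀ {e} → change e ≢ raised → x′ e ≤ x e
          x′≤x {e} ne with change e
          ... | raised  = contradiction ≡.refl ne
          ... | lowered = x-y≤x 0≤ε
          ... | fixed   = ≤-refl

          x′⇒x : ∀ {e} → 0# < x′ e → 0# < x e
          x′⇒x {e} p with change e in eq
          ... | raised  = change-pos λ f → contradiction (≡.trans (≡.sym eq) f) λ ()
          ... | lowered = change-pos λ f → contradiction (≡.trans (≡.sym eq) f) λ ()
          ... | fixed   = p

          keep : ∀ {e t} → tp t ≡ hd e → 0# < dem t → x e ≤ dem t → x′ e ≤ dem t
          keep {e} {t} q l le with change e in eq
          ... | raised  = raised≤ e t eq l q (slack eq l q le)
          ... | lowered = ≤-trans (x-y≤x 0≤ε) le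
          ... | fixed   = le

          conserve′ : ∀ v → at hd x′ v + at sp sup v ≈ at tl x′ v + at tp dem v
          conserve′ v = +-cancelʳ (at tl x v + at hd x v) (begin-equality
            (H′ + P) + (L + H) ≈⟨ solve 4 (λ h′ p l h → (h′ :+ p) :+ (l :+ h) := (l :+ h′) :+ (h :+ p)) ≈-refl H′ P L H ⟩
            (L + H′) + (H + P) ≈⟨ +-cong (≈-sym (shift-conserves tl hd change circulation ε x v)) (conserve v) ⟩
            (L′ + H) + (L + D) ≈⟨ solve 4 (λ l′ h l d → (l′ :+ h) :+ (l :+ d) := (l′ :+ d) :+ (l :+ h)) ≈-refl L′ H L D ⟩
            (L′ + D) + (L + H) ∎)
            where
            H H′ L L′ P D : Carrier
            H = at hd x v
            H′ = at hd x′ v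
            L = at tl x v
            L′ = at tl x′ v
            P = at sp sup v
            D = at tp dem v

          σ′ : State
          σ′ = record
            { x = x′ ; sup = sup ; dem = dem ; sp = sp ; tp = tp ; flag = flag ; com = com
            ; x≥0 = x′≥0 ; sup≥0 = sup≥0 ; dem≥0 = dem≥0 ; dem≤Δ = dem≤Δ
            ; conserve = conserve′
            ; ranked = λ e p → ranked e (x′⇒x p)
            ; flag-unique = λ fl p q → flag-unique fl (x′⇒x p) (x′⇒x q)
            ; flag-closed = λ fl p → flag-closed fl (x′⇒x p)
            ; regular = λ fl pe pf fe tt lt → keep tt lt (regular fl (x′⇒x pe) (x′⇒x pf) fe tt lt)
            ; one-irregular = one-irregular′
            ; alone = alone ; committed = committed
            }
            where
            one-irregular′ : ∀ {e f t u} → flag (hd e) ≡ true → 0# < x′ e → 0# < x′ f → hd f ≡ hd e →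
              tp t ≡ hd e → tp u ≡ hd e → 0# < dem t → 0# < dem u → t ≢ u → x′ e ≤ dem t ⊎ x′ f ≤ dem u
            one-irregular′ fl pe pf fe tt ut lt lu ne with one-irregular fl (x′⇒x pe) (x′⇒x pf) fe tt ut lt lu ne
            ... | inj₁ le = inj₁ (keep tt lt le)
            ... | inj₂ le = inj₂ (keep (≡.trans ut (≡.sym fe)) lu le)

          below : σ′ ⊑ σ
          below = record
            { x-pos = λ _ → x′⇒x ; sup-pos = λ _ p → p ; dem-pos = λ _ p → p ; flags = λ _ p → p ; tp-rank = λ _ → ℕ.≤-refl }

          extend : Solution σ′ → Solution σ
          extend sol = record
            { z = z ; route = route ; side = side ; z≥0 = z≥0 ; shipped = shipped ; delivered = delivered
            ; connects = connects ; side-com = side-com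
            ; load≤ = load≤′
            ; load-flag = load-flag
            ; load-dead = λ e dead → load-dead e (λ p → dead (x′⇒x p))
            ; crossing = crossing ; spill = spill }
            where
            open Solution sol
            load≤′ : ∀ e → load z route all-sinks e ≤ x e + Δ
            load≤′ e with flag (hd e) in eq
            -- A raised residual flow no longer certifies the old bound `x e + Δ`. Raised arcs enter
            -- flagged vertices, however, where all remaining load is at most `Δ`.
            ... | true  = ≤-trans (load-flag e eq) (y≤x+y (x≥0 e))
            ... | false = ≤-trans (load≤ e) (+-monoˡ-≤ Δ (x′≤x λ r → contradiction (≡.trans (≡.sym eq) (raised-flag r)) λ ()))

        lowered? : ∀ e → Dec (change e ≡ lowered)
        lowered? e with change e
        ... | raised  = no λ ()
        ... | lowered = yes ≡.refl
        ... | fixed   = no λ ()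

        raised? : ∀ e → Dec (change e ≡ raised)
        raised? e with change e
        ... | raised  = yes ≡.refl
        ... | lowered = no λ ()
        ... | fixed   = no λ ()

        some-lowered : ∃[ e ] change e ≡ lowered
        some-lowered = lowered-exists tl hd change circulation rank (λ e ne → ranked e (change-pos ne)) nontrivial

        a : Fin K
        a = proj₁ (argmin lowered? x some-lowered)

        a-lowered : change a ≡ lowered
        a-lowered = proj₁ (proj₂ (argmin lowered? x some-lowered))

        a-least : ∀ e → change e ≡ lowered → x a ≤ x e
        a-least = proj₂ (proj₂ (argmin lowered? x some-lowered))

        -- Pairs of a raised arc and a terminal at its head that become tight no later than `a`
        -- reaches 0. They are coded in one `Fin` so that `argmin` can choose among them.
        Tight : Fin (K ℕ.* T) → Set
        Tight k = change e ≡ raised × 0# < dem t × tp t ≡ hd e × x e < dem t × dem t - x e ≤ x a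
          where
          e = proj₁ (Fin.remQuot T k)
          t = proj₂ (Fin.remQuot {K} T k)

        tight? : ∀ k → Dec (Tight k)
        tight? k = raised? e ×-dec ((0# <? dem t) ×-dec ((tp t Fin.≟ hd e) ×-dec ((x e <? dem t) ×-dec ((dem t - x e) ≤? x a))))
          where
          e = proj₁ (Fin.remQuot T k)
          t = proj₂ (Fin.remQuot {K} T k)

        gap : Fin (K ℕ.* T) → Carrier
        gap k = dem (proj₂ (Fin.remQuot {K} T k)) - x (proj₁ (Fin.remQuot T k))

        Tight′ : Fin K → Fin T → Set
        Tight′ e t = change e ≡ raised × 0# < dem t × tp t ≡ hd e × x e < dem t × dem t - x e ≤ x a

        tight-combine : ∀ {e t} → Tight′ e t → Tight (Fin.combine e t)
        tight-combine {e} {t} p = ≡.subst (λ q → Tight′ (proj₁ q) (proj₂ q)) (≡.sym (Fin.remQuot-combine e t)) p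

        gap-combine : ∀ e t → gap (Fin.combine e t) ≡ dem t - x e
        gap-combine e t = ≡.cong (λ q → dem (proj₂ q) - x (proj₁ q)) (Fin.remQuot-combine {K} {T} e t)

        fill : ∀ {y d} → y + (d - y) ≈ d
        fill {y} {d} = ≈-trans (+-comm y _) (minus-plus d y)

        lower-all : (∀ k → ¬ Tight k) → Reduction σ
        lower-all none = σ′ , measure-drop below (x-drop a (change-pos (λ f → contradiction (≡.trans (≡.sym a-lowered) f) λ ())) gone) , extend
          where
          raised≤ : ∀ e t → change e ≡ raised → 0# < dem t → tp t ≡ hd e → x e < dem t → x e + x a ≤ dem t
          raised≤ e t c l q lt with ≤⊎> (dem t - x e) (x a)
          ... | inj₁ le = contradiction (tight-combine (c , l , q , lt , le)) (none (Fin.combine e t))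
          ... | inj₂ (ge , _) = ≤-trans (+-monoʳ-≤ (x e) ge) (≤-reflexive fill)
          open Shifted (x a) (x≥0 a) a-least raised≤
          gone : ¬ 0# < x′ a
          gone p = 0≮0 (≈-trans (≈-reflexive (≡.cong (λ c → shift c (x a) (x a)) a-lowered)) (-‿inverseʳ (x a))) p

        -- Once raised, the flow on the arc equals the demand, so the terminal retreats and the arc vanishes.
        raise-to : ∃ Tight → Reduction σ
        raise-to some = go (argmin tight? gap some)
          where
          go : ∃[ k ] Tight k × (∀ l → Tight l → gap k ≤ gap l) → Reduction σ
          go (k , (c , l , q , lt , le) , least) =
            R.σ′ t e l live′ q (≤-reflexive (≈-sym tight)) (λ _ → tight) ,
            -- The shift alone need not lower the measure, so it forms a single reduction with the
            -- retreat.
            ℕ.<-≤-trans (R.descends t e l live′ q (≤-reflexive (≈-sym tight)) (λ _ → tight)) (measure-mono below) ,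
            extend ∘ R.extend t e l live′ q (≤-reflexive (≈-sym tight)) (λ _ → tight)
            where
            e : Fin K
            e = proj₁ (Fin.remQuot T k)
            t : Fin T
            t = proj₂ (Fin.remQuot {K} T k)
            raised≤ : ∀ f u → change f ≡ raised → 0# < dem u → tp u ≡ hd f → x f < dem u → x f + gap k ≤ dem u
            raised≤ f u cf lu qf ltf with ≤⊎> (dem u - x f) (x a)
            ... | inj₁ le′ = ≤-trans (+-monoʳ-≤ (x f) (≤-trans (least (Fin.combine f u) (tight-combine (cf , lu , qf , ltf , le′)))
                               (≤-reflexive (≈-reflexive (gap-combine f u))))) (≤-reflexive fill)
            ... | inj₂ (ge , _) = ≤-trans (+-monoʳ-≤ (x f) (≤-trans le ge)) (≤-reflexive fill)
            open Shifted (gap k) (proj₁ (0<x-y lt)) (λ f cf → ≤-trans le (a-least f cf)) raised≤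
            module R = Retreat σ′
            tight : x′ e ≈ dem t
            tight = ≈-trans (≈-reflexive (≡.cong (λ c → shift c (gap k) (x e)) c)) fill
            live′ : 0# < x′ e
            live′ = <-≤-trans l (≤-reflexive (≈-sym tight))

        reduction-along : Reduction σ
        reduction-along with Fin.any? tight?
        ... | yes some = raise-to some
        ... | no none  = lower-all λ k p → none (k , p)

      reduction : ∀ e → 0# < x e → Reduction σ
      reduction e pos = reduction-along (cycle _ _ (fwd e pos))

  -- The end of the algorithm.

  module Exhausted (σ : State) where
    open State σ

    -- Without live arcs, conservation equates supply and demand at each vertex. A live supply would
    -- thus share its vertex with a live demand, which `no-match` excludes; so everything has been
    -- shipped.
    idle : (∀ e → ¬ 0# < x e) → (∀ s t → 0# < sup s → 0# < dem t → sp s ≢ tp t) → Solution σ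
    idle dead no-match = record
      { z = λ _ _ → 0# ; route = λ _ _ → [] ; side = com
      ; z≥0 = λ _ _ → ≤-refl
      ; shipped = λ s → ≈-trans (∑-zero λ _ → ≈-refl) (≈-sym (≮⇒≈0 (sup≥0 s) (sup-dead s)))
      ; delivered = λ t → ≈-trans (∑-zero λ _ → ≈-refl) (≈-sym (≮⇒≈0 (dem≥0 t) (dem-dead t)))
      ; connects = λ p → contradiction p (0≮0 ≈-refl)
      ; side-com = λ _ → ≡.refl
      ; load≤ = λ e → ≤-trans (unloaded all-sinks e) (+-nonNeg (x≥0 e) 0≤Δ)
      ; load-flag = λ e _ → ≤-trans (unloaded all-sinks e) 0≤Δ
      ; load-dead = λ e _ → unloaded all-sinks e
      ; crossing = λ e _ → ≤-trans (unloaded _ e) 0≤Δ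
      ; spill = λ v _ → ≤-trans (≤-reflexive (at-zero λ s _ → ∑-zero λ t → zeroʳ _)) 0≤Δ
      }
      where
      unloaded : ∀ w e → load (λ _ _ → 0#) (λ _ _ → []) w e ≤ 0#
      unloaded w e = ≤-reflexive (∑-zero λ s → ∑-zero λ t → zeroʳ _)
      balanced : ∀ v → at sp sup v ≈ at tp dem v
      balanced v = begin-equality
        at sp sup v ≈⟨ +-identityˡ _ ⟨
        0# + at sp sup v ≈⟨ +-congʳ (at-zero λ e _ → ≮⇒≈0 (x≥0 e) (dead e)) ⟨
        at hd x v + at sp sup v ≈⟨ conserve v ⟩
        at tl x v + at tp dem v ≈⟨ +-congʳ (at-zero λ e _ → ≮⇒≈0 (x≥0 e) (dead e)) ⟩
        0# + at tp dem v ≈⟨ +-identityˡ _ ⟩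
        at tp dem v ∎
      sup-dead : ∀ s → ¬ 0# < sup s
      sup-dead s l with at-pos⇒∃ {g = tp} dem≥0 (<-≤-trans (at-pos {g = sp} sup≥0 {s} ≡.refl l) (≤-reflexive (balanced (sp s))))
      ... | t , q , l′ = no-match s t l l′ (≡.sym q)
      dem-dead : ∀ t → ¬ 0# < dem t
      dem-dead t l with at-pos⇒∃ {g = sp} sup≥0 (<-≤-trans (at-pos {g = tp} dem≥0 {t} ≡.refl l) (≤-reflexive (≈-sym (balanced (tp t)))))
      ... | s , q , l′ = no-match s t l′ l q

  -- Choice of the next move.

  module Progress (σ : State) where
    open State σ
    open Augment σ using (Root; NoIn)

    root? : ∀ v → Dec (Root v)
    root? v = Fin.all? λ f → (0# <? x f) →-dec ¬? (tl f Fin.≟ v)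

    noIn? : ∀ v → Dec (NoIn v)
    noIn? v = Fin.all? λ e → (0# <? x e) →-dec ¬? (hd e Fin.≟ v)

    Matching : Fin S → Fin T → Set
    Matching s t = 0# < sup s × 0# < dem t × sp s ≡ tp t × (Root (tp t) ⊎ NoIn (tp t))

    matching? : ∀ s t → Dec (Matching s t)
    matching? s t = (0# <? sup s) ×-dec ((0# <? dem t) ×-dec ((sp s Fin.≟ tp t) ×-dec (root? (tp t) ⊎-dec noIn? (tp t))))

    Irregular : Fin N → Fin T → Set
    Irregular v t = 0# < dem t × tp t ≡ v × ∃[ e ] 0# < x e × hd e ≡ v × dem t < x e

    irregular? : ∀ v t → Dec (Irregular v t)
    irregular? v t = (0# <? dem t) ×-dec ((tp t Fin.≟ v) ×-dec
      Fin.any? λ e → (0# <? x e) ×-dec ((hd e Fin.≟ v) ×-dec (dem t <? x e)))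

    Retreating : Fin T → Fin K → Set
    Retreating t e = 0# < dem t × 0# < x e × tp t ≡ hd e × dem t ≤ x e × (flag (hd e) ≡ true → x e ≈ dem t)

    retreating? : ∀ t e → Dec (Retreating t e)
    retreating? t e = (0# <? dem t) ×-dec ((0# <? x e) ×-dec ((tp t Fin.≟ hd e) ×-dec
      ((dem t ≤? x e) ×-dec ((flag (hd e) Bool.≟ true) →-dec (x e ≈? dem t)))))

    Advancing : Fin K → Set
    Advancing f = 0# < x f × NoIn (tl f) × (∀ e → 0# < x e → tl e ≡ tl f → e ≡ f)

    advancing? : ∀ f → Dec (Advancing f)
    advancing? f = (0# <? x f) ×-dec (noIn? (tl f) ×-dec
      Fin.all? λ e → (0# <? x e) →-dec ((tl e Fin.≟ tl f) →-dec (e Fin.≟ f)))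

    Flaggable : Fin N → Set
    Flaggable v = flag v ≡ false × (∀ e → 0# < x e → tl e ≡ v → flag (hd e) ≡ true) ×
      (∀ e f → 0# < x e → 0# < x f → tl e ≡ v → tl f ≡ v → f ≡ e)

    flaggable? : ∀ v → Dec (Flaggable v)
    flaggable? v = (flag v Bool.≟ false) ×-dec
      (Fin.all? (λ e → (0# <? x e) →-dec ((tl e Fin.≟ v) →-dec (flag (hd e) Bool.≟ true))) ×-dec
       Fin.all? λ e → Fin.all? λ f → (0# <? x e) →-dec ((0# <? x f) →-dec ((tl e Fin.≟ v) →-dec ((tl f Fin.≟ v) →-dec (f Fin.≟ e)))))

    match-with : ∀ s t → Matching s t →
      (∀ {u e} → flag (hd e) ≡ true → 0# < x e → tp t ≡ hd e → tp u ≡ hd e → 0# < dem u → u ≢ t → x e ≤ dem u) →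
      Reduction σ
    match-with s t (ls , lt , q , dead-end) others with ≤-total (sup s) (dem t)
    ... | inj₁ le = Match.reduction σ s t ls lt q dead-end others (sup s) (sup≥0 s) ≤-refl le (inj₁ ≈-refl)
    ... | inj₂ ge = Match.reduction σ s t ls lt q dead-end others (dem t) (dem≥0 t) ge ≤-refl (inj₂ ≈-refl)

    -- An irregular terminal is matched first: the partial match may leave the matched terminal irregular.
    match : ∀ s t → Matching s t → Reduction σ
    match s t (ls , lt , q , dead-end) with Fin.any? (irregular? (tp t))
    ... | yes (u , lu , qu , f , pf , hf , small) =
      match-with s u (ls , lu , ≡.trans q (≡.sym qu) , ≡.subst (λ v → Root v ⊎ NoIn v) (≡.sym qu) dead-end) others
      where
      others : ∀ {w e} → flag (hd e) ≡ true → 0# < x e → tp u ≡ hd e → tp w ≡ hd e → 0# < dem w → w ≢ u → x e ≤ dem w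
      others {w} {e} fl p r r′ lw ne with one-irregular {e} {f} fl p pf (≡.trans hf (≡.trans (≡.sym qu) r)) r′ r lw lu ne
      ... | inj₁ le = le
      ... | inj₂ le = contradiction le (<⇒≱ small)
    ... | no none = match-with s t (ls , lt , q , dead-end) others
      where
      others : ∀ {w e} → flag (hd e) ≡ true → 0# < x e → tp t ≡ hd e → tp w ≡ hd e → 0# < dem w → w ≢ t → x e ≤ dem w
      others {w} {e} fl p r r′ lw ne with ≤⊎> (x e) (dem w)
      ... | inj₁ le = le
      ... | inj₂ gt = contradiction (w , lw , ≡.trans r′ (≡.sym r) , e , p , ≡.sym r , gt) none

    retreat : ∀ t e → Retreating t e → Reduction σ
    retreat t e (l , p , q , fits , tight) = Retreat.reduction σ t e l p q fits tight

    module _ (no-match : ∀ s t → ¬ Matching s t) where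

      advance : ∀ f → Advancing f → Reduction σ
      advance f (pos , no-in , only) = Advance.reduction σ f pos no-in only no-demand
        where
        supplied : ∃[ s ] sp s ≡ tl f × 0# < sup s
        supplied = at-pos⇒∃ sup≥0 (<-≤-trans pos (begin
          x f ≤⟨ at-term x≥0 ≡.refl ⟩
          at tl x (tl f) ≤⟨ x≤x+y (at-nonNeg dem≥0 (tl f)) ⟩
          at tl x (tl f) + at tp dem (tl f) ≈⟨ conserve (tl f) ⟨
          at hd x (tl f) + at sp sup (tl f) ≈⟨ +-congʳ (at-zero λ e h → ≮⇒≈0 (x≥0 e) (λ p → no-in e p h)) ⟩
          0# + at sp sup (tl f) ≈⟨ +-identityˡ _ ⟩
          at sp sup (tl f) ∎))
        no-demand : ∀ t → 0# < dem t → tp t ≢ tl f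
        no-demand t l q with supplied
        ... | s , r , ls = no-match s t (ls , l , ≡.trans r (≡.sym q) , inj₂ (≡.subst NoIn (≡.sym q) no-in))

      module _ (no-retreat : ∀ t e → ¬ Retreating t e) where

        raise-flag : ∀ v → Flaggable v → Reduction σ
        raise-flag v (unflagged , closed , unique) = Flagging.reduction σ v unflagged closed unique small
          where
          small : ∀ e t → 0# < x e → 0# < dem t → hd e ≡ v → tp t ≡ v → x e ≤ dem t
          small e t p l h q with ≤⊎> (x e) (dem t)
          ... | inj₁ le = le
          ... | inj₂ (ge , _) = contradiction
            (l , p , ≡.trans q (≡.sym h) , ge , λ fl → contradiction (≡.trans (≡.sym fl) (≡.trans (≡.cong flag h) unflagged)) λ ())
            (no-retreat t e)

        reroute-or-stop : (∀ f → ¬ Advancing f) → (∀ v → ¬ Flaggable v) → Reduction σ ⊎ Solution σ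
        reroute-or-stop no-advance no-flag with Fin.any? (λ e → 0# <? x e)
        ... | yes (e , p) = inj₁ (Augment.reduction σ
          (λ s t ls lt q d → no-match s t (ls , lt , q , d))
          (λ t f l q r fits tight → no-retreat t f (l , q , r , fits , tight))
          (λ f q no-in only → no-advance f (q , no-in , only))
          (λ v uf closed unique → no-flag v (uf , closed , unique)) e p)
        ... | no none = inj₂ (Exhausted.idle σ (λ e p → none (e , p))
          (λ s t ls lt q → no-match s t (ls , lt , q , inj₁ (λ f p → contradiction (f , p) none))))

    opaque
      -- The order of the tests matters. An advance needs a tail without live demand: its supply is
      -- live, so a live terminal there would match. Flagging needs regular terminals: over a larger
      -- arc into an unflagged vertex a terminal would retreat. Augmenting needs that all other
      -- moves are impossible.
      progress : Reduction σ ⊎ Solution σ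
      progress with Fin.any? (λ s → Fin.any? (matching? s))
      ... | yes (s , t , m) = inj₁ (match s t m)
      ... | no no-m with Fin.any? (λ t → Fin.any? (retreating? t))
      ...   | yes (t , e , r) = inj₁ (retreat t e r)
      ...   | no no-r with Fin.any? advancing? | Fin.any? flaggable?
      ...     | yes (f , a) | _ = inj₁ (advance (λ s t m → no-m (s , t , m)) f a)
      ...     | no _ | yes (v , p) = inj₁ (raise-flag (λ s t m → no-m (s , t , m)) (λ t e r → no-r (t , e , r)) v p)
      ...     | no no-a | no no-f = reroute-or-stop (λ s t m → no-m (s , t , m)) (λ t e r → no-r (t , e , r))
                                      (λ f a → no-a (f , a)) (λ v p → no-f (v , p))

  solution : ∀ σ → Solution σ
  solution σ = go _ σ ℕ.≤-refl
    where
    go : ∀ fuel σ → measure σ ℕ.< fuel → Solution σ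
    go (suc fuel) σ (s≤s lt) with Progress.progress σ
    ... | inj₁ (σ′ , lt′ , extend) = extend (go fuel σ′ (ℕ.<-≤-trans lt′ lt))
    ... | inj₂ sol = sol

-- Paths, and the two copies of the digraph

open import Relation.Binary.Construct.Closure.ReflexiveTransitive using (ε; _◅_)

module LoopErasure {n m : ℕ} (D : Digraph n m) where
  open Digraph D
  open Paths D
  open DecMembership (Fin._≟_ {n}) using (_∈?_)

  arc-tail∈ : ∀ {u v} (w : Walk u v) {a} → a ∈ arcs w → tail a ∈ vertices w
  arc-tail∈ ((a , ≡.refl , _) ◅ w) (here ≡.refl) = here ≡.refl
  arc-tail∈ (_ ◅ w) (there p) = there (arc-tail∈ w p)

  suffix : ∀ {u v t} (w : Walk v t) → Unique (vertices w) → u ∈ vertices w →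
    Σ[ p ∈ Path u t ] (∀ {a} → a ∈ arcs (Path.walk p) → a ∈ arcs w)
  suffix ε un (here ≡.refl) = record { walk = ε ; simple = un } , λ p → p
  suffix (a ◅ w) un (here ≡.refl) = record { walk = a ◅ w ; simple = un } , λ p → p
  suffix (_ ◅ w) (_ ∷ un) (there p) with suffix w un p
  ... | q , sub = q , there ∘ sub

  -- Shortcuts use only arcs of the given walk, so bounds on the load of the walk carry over to the
  -- simple path.
  erase : ∀ {s t} (w : Walk s t) → Σ[ p ∈ Path s t ] (∀ {a} → a ∈ arcs (Path.walk p) → a ∈ arcs w)
  erase {s} ε = record { walk = ε ; simple = [] ∷ [] } , λ p → p
  erase {s} (a ◅ w) with erase w
  ... | p , sub with s ∈? vertices (Path.walk p)
  ...   | yes s∈ with suffix (Path.walk p) (Path.simple p) s∈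
  ...     | q , sub′ = q , λ r → there (sub (sub′ r))
  erase {s} (a ◅ w) | p , sub | no s∉ =
    record { walk = a ◅ Path.walk p ; simple = All.tabulate (λ r e → s∉ (≡.subst (_∈ vertices (Path.walk p)) (≡.sym e) r)) ∷ Path.simple p } ,
    λ { (here e) → here e ; (there r) → there (sub r) }

module PathNet (ℝ : RealNumbers) {n m : ℕ} (D : Digraph n m) where
  open OrderedField ℝ
  open AtVertices ℝ
  open Digraph D
  open Paths D
  open LoopErasure D
  open DecMembership (Fin._≟_ {m}) using (_∈?_)

  -- Membership in `arcs w` charges an arc once, however often the walk uses it. Simplicity makes
  -- this agree with traversal: the tail of the first arc is not visited again, so that arc is new.
  path-net : ∀ {s t} (w : Walk s t) → Unique (vertices w) → ∀ y v →
    at tail (λ a → when (a ∈? arcs w) y) v + when (t Fin.≟ v) y ≈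
    at head (λ a → when (a ∈? arcs w) y) v + when (s Fin.≟ v) y
  path-net {s} ε _ y v = +-congʳ (≈-trans (at-zero λ _ _ → ≈-refl) (≈-sym (at-zero λ _ _ → ≈-refl)))
  path-net {s} {t} (_◅_ {j = u} (a , ≡.refl , ≡.refl) w) (fresh ∷ un) y v = begin-equality
    at tail (on (a ∷ arcs w)) v + when (t Fin.≟ v) y
      ≈⟨ +-congʳ (first tail) ⟩
    (when (tail a Fin.≟ v) y + at tail (on (arcs w)) v) + when (t Fin.≟ v) y
      ≈⟨ +-assoc _ _ _ ⟩
    when (tail a Fin.≟ v) y + (at tail (on (arcs w)) v + when (t Fin.≟ v) y)
      ≈⟨ +-congˡ (path-net w un y v) ⟩
    when (tail a Fin.≟ v) y + (at head (on (arcs w)) v + when (head a Fin.≟ v) y)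
      ≈⟨ solve 3 (λ p q r → p :+ (q :+ r) := (r :+ q) :+ p) ≈-refl (when (tail a Fin.≟ v) y) (at head (on (arcs w)) v) (when (head a Fin.≟ v) y) ⟩
    (when (head a Fin.≟ v) y + at head (on (arcs w)) v) + when (tail a Fin.≟ v) y
      ≈⟨ +-congʳ (first head) ⟨
    at head (on (a ∷ arcs w)) v + when (tail a Fin.≟ v) y ∎
    where
    on : List (Fin m) → Fin m → Carrier
    on as f = when (f ∈? as) y
    new : a ∉ arcs w
    new a∈ = All.lookup fresh (arc-tail∈ w a∈) ≡.refl
    pointwise : ∀ f → on (a ∷ arcs w) f ≈ when (f Fin.≟ a) y + on (arcs w) f
    pointwise f with f Fin.≟ a | f ∈? arcs w
    ... | yes ≡.refl | yes q = contradiction q new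
    ... | yes _ | no _  = ≈-sym (+-identityʳ y)
    ... | no _  | yes _ = ≈-sym (+-identityˡ y)
    ... | no _  | no _  = ≈-sym (+-identityˡ 0#)
    first : ∀ g → at g (on (a ∷ arcs w)) v ≈ when (g a Fin.≟ v) y + at g (on (arcs w)) v
    first g = ≈-trans (at-cong pointwise v) (≈-trans (at-+ _ _ v) (+-congʳ (at-pick a y v)))

-- The digraph of two copies.

module CopyGraph {n m : ℕ} (D : Digraph n m) where
  open Digraph D

  -- A vertex of D has two copies (kinds 0F and 1F), a supply vertex (2F) feeding them,
  -- and a demand vertex (3F) into which they drain.
  N : ℕ
  N = 4 ℕ.* n

  vertex : Fin 4 → Fin n → Fin N
  vertex = Fin.combine

  vertex-injective : ∀ c u v → vertex c u ≡ vertex c v → u ≡ v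
  vertex-injective c u v e = proj₂ (Fin.combine-injective c u c v e)

  base : Fin N → Fin n
  base w = proj₂ (Fin.remQuot {4} n w)

  kind : Fin N → Fin 4
  kind w = proj₁ (Fin.remQuot {4} n w)

  copyKind : Bool → Fin 4
  copyKind false = 0F
  copyKind true  = 1F

  layerOf : Fin 4 → Layer
  layerOf 0F = copy false
  layerOf 1F = copy true
  layerOf 2F = supplyLayer
  layerOf 3F = demandLayer

  layer : Fin N → Layer
  layer = layerOf ∘ kind

  layer-vertex : ∀ c v → layer (vertex c v) ≡ layerOf c
  layer-vertex c v = ≡.cong (layerOf ∘ proj₁) (Fin.remQuot-combine {4} {n} c v)

  base-vertex : ∀ c v → base (vertex c v) ≡ v
  base-vertex c v = ≡.cong proj₂ (Fin.remQuot-combine {4} {n} c v)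

  layer-copy : ∀ j v → layer (vertex (copyKind j) v) ≡ copy j
  layer-copy false v = layer-vertex 0F v
  layer-copy true  v = layer-vertex 1F v

  data Kind : Set where
    real       : Fin m → Kind
    feed drain : Fin n → Kind

  kindOf : Fin m ⊎ (Fin n ⊎ Fin n) → Kind
  kindOf (inj₁ a) = real a
  kindOf (inj₂ (inj₁ v)) = feed v
  kindOf (inj₂ (inj₂ v)) = drain v

  -- Each copy has the `m` arcs of `D`, `n` feeds from supply vertices and `n` drains into demand
  -- vertices. A feed at a non-source or a drain at a non-sink exists too, but will carry flow 0.
  L K : ℕ
  L = m ℕ.+ (n ℕ.+ n)
  K = L ℕ.+ L

  kindIn : Fin L → Kind
  kindIn i = kindOf (Sum.map₂ (Fin.splitAt n) (Fin.splitAt m i))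

  code : Fin K → Bool × Kind
  code e = [ (λ i → false , kindIn i) , (λ i → true , kindIn i) ]′ (Fin.splitAt L e)

  arc : Bool → Fin m → Fin K
  arc false a = (a Fin.↑ˡ (n ℕ.+ n)) Fin.↑ˡ L
  arc true  a = L Fin.↑ʳ (a Fin.↑ˡ (n ℕ.+ n))

  code-arc : ∀ j a → code (arc j a) ≡ (j , real a)
  code-arc false a rewrite Fin.splitAt-↑ˡ L (a Fin.↑ˡ (n ℕ.+ n)) L | Fin.splitAt-↑ˡ m a (n ℕ.+ n) = ≡.refl
  code-arc true a rewrite Fin.splitAt-↑ʳ L L (a Fin.↑ˡ (n ℕ.+ n)) | Fin.splitAt-↑ˡ m a (n ℕ.+ n) = ≡.refl

  arc-code : ∀ e {j a} → code e ≡ (j , real a) → e ≡ arc j a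
  arc-code e {j} {a} eq with Fin.splitAt L e in eq₁
  ... | inj₁ i = ≡.trans (≡.sym (Fin.splitAt⁻¹-↑ˡ eq₁)) (go i eq)
    where
    go : ∀ i → (false , kindIn i) ≡ (j , real a) → i Fin.↑ˡ L ≡ arc j a
    go i eq′ with Fin.splitAt m i in eq₂
    go i ≡.refl | inj₁ a′ = ≡.cong (Fin._↑ˡ L) (≡.sym (Fin.splitAt⁻¹-↑ˡ eq₂))
    go i eq′ | inj₂ k with Fin.splitAt n k
    go i () | inj₂ k | inj₁ _
    go i () | inj₂ k | inj₂ _
  ... | inj₂ i = ≡.trans (≡.sym (Fin.splitAt⁻¹-↑ʳ eq₁)) (go i eq)
    where
    go : ∀ i → (true , kindIn i) ≡ (j , real a) → L Fin.↑ʳ i ≡ arc j a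
    go i eq′ with Fin.splitAt m i in eq₂
    go i ≡.refl | inj₁ a′ = ≡.cong (L Fin.↑ʳ_) (≡.sym (Fin.splitAt⁻¹-↑ˡ eq₂))
    go i eq′ | inj₂ k with Fin.splitAt n k
    go i () | inj₂ k | inj₁ _
    go i () | inj₂ k | inj₂ _

  tailOf headOf : Bool × Kind → Fin 4 × Fin n
  tailOf (j , real a)  = copyKind j , tail a
  tailOf (j , feed v)  = 2F , v
  tailOf (j , drain v) = copyKind j , v
  headOf (j , real a)  = copyKind j , head a
  headOf (j , feed v)  = copyKind j , v
  headOf (j , drain v) = 3F , v

  locate : Fin 4 × Fin n → Fin N
  locate (c , v) = vertex c v

  tl hd : Fin K → Fin N
  tl e = locate (tailOf (code e))
  hd e = locate (headOf (code e))

  from-demand : ∀ e → layer (tl e) ≢ demandLayer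
  from-demand e = go (code e)
    where
    go : ∀ k → layer (locate (tailOf k)) ≢ demandLayer
    go (j , real a)  eq = contradiction (≡.trans (≡.sym (layer-copy j (tail a))) eq) λ ()
    go (j , feed v)  eq = contradiction (≡.trans (≡.sym (layer-vertex 2F v)) eq) λ ()
    go (j , drain v) eq = contradiction (≡.trans (≡.sym (layer-copy j v)) eq) λ ()

  into-supply : ∀ e → layer (hd e) ≢ supplyLayer
  into-supply e = go (code e)
    where
    go : ∀ k → layer (locate (headOf k)) ≢ supplyLayer
    go (j , real a)  eq = contradiction (≡.trans (≡.sym (layer-copy j (head a))) eq) λ ()
    go (j , feed v)  eq = contradiction (≡.trans (≡.sym (layer-copy j v)) eq) λ ()
    go (j , drain v) eq = contradiction (≡.trans (≡.sym (layer-vertex 3F v)) eq) λ ()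

  copy-injective : ∀ {i j} → copy i ≡ copy j → i ≡ j
  copy-injective ≡.refl = ≡.refl

  same-copy : ∀ e {i j} → layer (tl e) ≡ copy i → layer (hd e) ≡ copy j → i ≡ j
  same-copy e = go (code e)
    where
    go : ∀ k {i j} → layer (locate (tailOf k)) ≡ copy i → layer (locate (headOf k)) ≡ copy j → i ≡ j
    go (j , real a)  p q = copy-injective (≡.trans (≡.sym (≡.trans (≡.sym (layer-copy j (tail a))) p)) (≡.trans (≡.sym (layer-copy j (head a))) q))
    go (j , feed v)  p q = contradiction (≡.trans (≡.sym (layer-vertex 2F v)) p) λ ()
    go (j , drain v) p q = contradiction (≡.trans (≡.sym (layer-vertex 3F v)) q) λ ()

  layer-arc : ∀ j a → layer (tl (arc j a)) ≡ copy j
  layer-arc j a rewrite code-arc j a = layer-copy j (tail a)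

-- Half of the flow in each copy.

module CopyFlow (ℝ : RealNumbers) {n m : ℕ} (D : Digraph n m) (half : RealNumbers.Carrier ℝ) where
  open OrderedField ℝ
  open AtVertices ℝ
  open Digraph D
  open CopyGraph D

  ∑-splitAt : ∀ k {l} (g : Fin k ⊎ Fin l → Carrier) →
    ∑ (λ i → g (Fin.splitAt k i)) ≈ ∑ (g ∘ inj₁) + ∑ (g ∘ inj₂)
  ∑-splitAt zero g = ≈-sym (≈-trans (+-congʳ (∑-empty _)) (+-identityˡ _))
  ∑-splitAt (suc k) g = begin-equality
    ∑ (λ i → g (Fin.splitAt (suc k) i)) ≈⟨ ∑-suc _ ⟩
    g (inj₁ zero) + ∑ (λ i → g (Sum.map₁ suc (Fin.splitAt k i))) ≈⟨ +-congˡ (∑-splitAt k (g ∘ Sum.map₁ suc)) ⟩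
    g (inj₁ zero) + (∑ (g ∘ inj₁ ∘ suc) + ∑ (g ∘ inj₂)) ≈⟨ +-assoc _ _ _ ⟨
    (g (inj₁ zero) + ∑ (g ∘ inj₁ ∘ suc)) + ∑ (g ∘ inj₂) ≈⟨ +-congʳ (∑-suc _) ⟨
    ∑ (g ∘ inj₁) + ∑ (g ∘ inj₂) ∎

  ∑-kind : ∀ (f : Kind → Carrier) → ∑ (f ∘ kindIn) ≈ ∑ (f ∘ real) + (∑ (f ∘ feed) + ∑ (f ∘ drain))
  ∑-kind f = ≈-trans (∑-splitAt m (f ∘ kindOf ∘ Sum.map₂ (Fin.splitAt n)))
    (+-congˡ (∑-splitAt n (f ∘ kindOf ∘ inj₂)))

  ∑-code : ∀ (f : Bool × Kind → Carrier) → ∑ (f ∘ code) ≈ ∑ (λ i → f (false , kindIn i)) + ∑ (λ i → f (true , kindIn i))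
  ∑-code f = ∑-splitAt L (f ∘ [ (λ i → false , kindIn i) , (λ i → true , kindIn i) ]′)

  when-vertex : ∀ c u c′ v {y} → when (vertex c u Fin.≟ vertex c′ v) y ≈ when (c Fin.≟ c′) (when (u Fin.≟ v) y)
  when-vertex c u c′ v {y} with c Fin.≟ c′ | u Fin.≟ v
  ... | yes ≡.refl | yes ≡.refl = ≈-reflexive (when-yes (vertex c u Fin.≟ vertex c u) ≡.refl)
  ... | yes _ | no ne = ≈-reflexive (when-no (vertex c u Fin.≟ vertex c′ v) (ne ∘ proj₂ ∘ Fin.combine-injective c u c′ v))
  ... | no ne | _ = ≈-reflexive (when-no (vertex c u Fin.≟ vertex c′ v) (ne ∘ proj₁ ∘ Fin.combine-injective c u c′ v))

  at-vertex : ∀ {k} (c : Fin 4) (g : Fin k → Fin n) (y : Fin k → Carrier) c′ v →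
    ∑ (λ i → when (vertex c (g i) Fin.≟ vertex c′ v) (y i)) ≈ when (c Fin.≟ c′) (at g y v)
  at-vertex c g y c′ v = begin-equality
    ∑ (λ i → when (vertex c (g i) Fin.≟ vertex c′ v) (y i)) ≈⟨ ∑-cong (λ i → when-vertex c (g i) c′ v) ⟩
    ∑ (λ i → when (c Fin.≟ c′) (when (g i Fin.≟ v) (y i))) ≈⟨ when-∑ (c Fin.≟ c′) _ ⟨
    when (c Fin.≟ c′) (∑ λ i → when (g i Fin.≟ v) (y i)) ≈⟨ when-cong (c Fin.≟ c′) (λ _ → ≈-reflexive (≡.sym (at-def g y v))) ⟩
    when (c Fin.≟ c′) (at g y v) ∎

  at-id : ∀ (y : Fin n → Carrier) v → at id y v ≈ y v
  at-id y v = ≈-trans (≈-reflexive (at-def id y v)) (∑-pick v y)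

  module _ (x : Fin m → Carrier) (p d : Fin n → Carrier) where

    flowOf : Kind → Carrier
    flowOf (real a)  = half * x a
    flowOf (feed v)  = half * p v
    flowOf (drain v) = half * d v

    X : Fin K → Carrier
    X e = flowOf (proj₂ (code e))

    ends : (Bool × Kind → Fin 4 × Fin n) → Bool → Fin 4 → Fin n → Carrier
    ends g j c v = ∑ (λ i → when (locate (g (j , kindIn i)) Fin.≟ vertex c v) (flowOf (kindIn i)))

    at-ends : ∀ g c v → at (λ e → locate (g (code e))) X (vertex c v) ≈ ends g false c v + ends g true c v
    at-ends g c v = ≈-trans (≈-reflexive (at-def _ X (vertex c v)))
      (∑-code (λ k → when (locate (g k) Fin.≟ vertex c v) (flowOf (proj₂ k))))

    O I P Q : Fin n → Carrier
    O v = half * at tail x v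
    I v = half * at head x v
    P v = half * p v
    Q v = half * d v

    ends-tail : ∀ j c v → ends tailOf j c v ≈ when (copyKind j Fin.≟ c) (O v) + (when (2F Fin.≟ c) (P v) + when (copyKind j Fin.≟ c) (Q v))
    ends-tail j c v = ≈-trans (∑-kind (λ k → when (locate (tailOf (j , k)) Fin.≟ vertex c v) (flowOf k))) (+-cong
      (≈-trans (at-vertex (copyKind j) tail _ c v) (when-cong (copyKind j Fin.≟ c) λ _ → at-* half x v))
      (+-cong (≈-trans (at-vertex 2F id _ c v) (when-cong (2F Fin.≟ c) λ _ → at-id _ v))
              (≈-trans (at-vertex (copyKind j) id _ c v) (when-cong (copyKind j Fin.≟ c) λ _ → at-id _ v))))

    ends-head : ∀ j c v → ends headOf j c v ≈ when (copyKind j Fin.≟ c) (I v) + (when (copyKind j Fin.≟ c) (P v) + when (3F Fin.≟ c) (Q v))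
    ends-head j c v = ≈-trans (∑-kind (λ k → when (locate (headOf (j , k)) Fin.≟ vertex c v) (flowOf k))) (+-cong
      (≈-trans (at-vertex (copyKind j) head _ c v) (when-cong (copyKind j Fin.≟ c) λ _ → at-* half x v))
      (+-cong (≈-trans (at-vertex (copyKind j) id _ c v) (when-cong (copyKind j Fin.≟ c) λ _ → at-id _ v))
              (≈-trans (at-vertex 3F id _ c v) (when-cong (3F Fin.≟ c) λ _ → at-id _ v))))

    module _ (half+half : half + half ≈ 1#) (balance : ∀ v → at head x v + p v ≈ at tail x v + d v) where

      twice : ∀ y → half * y + half * y ≈ y
      twice y = ≈-trans (≈-sym (distribʳ y half half)) (≈-trans (*-congʳ half+half) (*-identityˡ y))

      through : ∀ v → I v + P v ≈ O v + Q v
      through v = ≈-trans (≈-sym (distribˡ half _ _)) (≈-trans (*-congˡ (balance v)) (distribˡ half _ _))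

      copies-conserve : ∀ c v →
        at hd X (vertex c v) + at (vertex 2F) p (vertex c v) ≈ at tl X (vertex c v) + at (vertex 3F) d (vertex c v)
      copies-conserve c v = ≈-trans (+-cong into (terminal 2F p)) (≈-trans (go c) (≈-sym (+-cong outof (terminal 3F d))))
        where
        terminal : ∀ c′ (y : Fin n → Carrier) → at (vertex c′) y (vertex c v) ≈ when (c′ Fin.≟ c) (y v)
        terminal c′ y = ≈-trans (≈-reflexive (at-def (vertex c′) y (vertex c v)))
          (≈-trans (at-vertex c′ id y c v) (when-cong (c′ Fin.≟ c) λ _ → at-id y v))
        into : at hd X (vertex c v) ≈
          (when (0F Fin.≟ c) (I v) + (when (0F Fin.≟ c) (P v) + when (3F Fin.≟ c) (Q v))) +
          (when (1F Fin.≟ c) (I v) + (when (1F Fin.≟ c) (P v) + when (3F Fin.≟ c) (Q v)))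
        into = ≈-trans (at-ends headOf c v) (+-cong (ends-head false c v) (ends-head true c v))
        outof : at tl X (vertex c v) ≈
          (when (0F Fin.≟ c) (O v) + (when (2F Fin.≟ c) (P v) + when (0F Fin.≟ c) (Q v))) +
          (when (1F Fin.≟ c) (O v) + (when (2F Fin.≟ c) (P v) + when (1F Fin.≟ c) (Q v)))
        outof = ≈-trans (at-ends tailOf c v) (+-cong (ends-tail false c v) (ends-tail true c v))
        go : ∀ c →
          ((when (0F Fin.≟ c) (I v) + (when (0F Fin.≟ c) (P v) + when (3F Fin.≟ c) (Q v))) +
           (when (1F Fin.≟ c) (I v) + (when (1F Fin.≟ c) (P v) + when (3F Fin.≟ c) (Q v)))) + when (2F Fin.≟ c) (p v) ≈
          ((when (0F Fin.≟ c) (O v) + (when (2F Fin.≟ c) (P v) + when (0F Fin.≟ c) (Q v))) +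
           (when (1F Fin.≟ c) (O v) + (when (2F Fin.≟ c) (P v) + when (1F Fin.≟ c) (Q v)))) + when (3F Fin.≟ c) (d v)
        go 0F = begin-equality
          ((I v + (P v + 0#)) + (0# + (0# + 0#))) + 0# ≈⟨ solve 2 (λ a b → ((a :+ (b :+ con 0)) :+ (con 0 :+ (con 0 :+ con 0))) :+ con 0 := a :+ b) ≈-refl (I v) (P v) ⟩
          I v + P v ≈⟨ through v ⟩
          O v + Q v ≈⟨ solve 2 (λ a b → ((a :+ (con 0 :+ b)) :+ (con 0 :+ (con 0 :+ con 0))) :+ con 0 := a :+ b) ≈-refl (O v) (Q v) ⟨
          ((O v + (0# + Q v)) + (0# + (0# + 0#))) + 0# ∎
        go 1F = begin-equality
          ((0# + (0# + 0#)) + (I v + (P v + 0#))) + 0# ≈⟨ solve 2 (λ a b → ((con 0 :+ (con 0 :+ con 0)) :+ (a :+ (b :+ con 0))) :+ con 0 := a :+ b) ≈-refl (I v) (P v) ⟩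
          I v + P v ≈⟨ through v ⟩
          O v + Q v ≈⟨ solve 2 (λ a b → ((con 0 :+ (con 0 :+ con 0)) :+ (a :+ (con 0 :+ b))) :+ con 0 := a :+ b) ≈-refl (O v) (Q v) ⟨
          ((0# + (0# + 0#)) + (O v + (0# + Q v))) + 0# ∎
        go 2F = begin-equality
          ((0# + (0# + 0#)) + (0# + (0# + 0#))) + p v ≈⟨ solve 1 (λ a → ((con 0 :+ (con 0 :+ con 0)) :+ (con 0 :+ (con 0 :+ con 0))) :+ a := a) ≈-refl (p v) ⟩
          p v ≈⟨ twice (p v) ⟨
          P v + P v ≈⟨ solve 1 (λ a → ((con 0 :+ (a :+ con 0)) :+ (con 0 :+ (a :+ con 0))) :+ con 0 := a :+ a) ≈-refl (P v) ⟨
          ((0# + (P v + 0#)) + (0# + (P v + 0#))) + 0# ∎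
        go 3F = begin-equality
          ((0# + (0# + Q v)) + (0# + (0# + Q v))) + 0# ≈⟨ solve 1 (λ a → ((con 0 :+ (con 0 :+ a)) :+ (con 0 :+ (con 0 :+ a))) :+ con 0 := a :+ a) ≈-refl (Q v) ⟩
          Q v + Q v ≈⟨ twice (d v) ⟩
          d v ≈⟨ solve 1 (λ a → ((con 0 :+ (con 0 :+ con 0)) :+ (con 0 :+ (con 0 :+ con 0))) :+ a := a) ≈-refl (d v) ⟨
          ((0# + (0# + 0#)) + (0# + (0# + 0#))) + d v ∎

      conserve-all : ∀ w → at hd X w + at (vertex 2F) p w ≈ at tl X w + at (vertex 3F) d w
      conserve-all w = ≡.subst (λ w → at hd X w + at (vertex 2F) p w ≈ at tl X w + at (vertex 3F) d w)
        (Fin.combine-remQuot {4} n w) (copies-conserve (kind w) (base w))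

-- From a balance function to the rounding instance and back.

module Routing (ℝ : RealNumbers) {n m : ℕ} (D : Digraph n m) (c : Fin m → RealNumbers.Carrier ℝ)
  (b : Fin n → RealNumbers.Carrier ℝ) where
  open OrderedField ℝ
  open AtVertices ℝ
  open Acyclic ℝ using (acyclic; SameNet)
  open Digraph D
  open Paths D
  open Transshipments ℝ
  open CopyGraph D
  open LoopErasure D

  opaque
    positive? : ∀ y → Dec (0# < y)
    positive? y = 0# <? y

    negative? : ∀ y → Dec (y < 0#)
    negative? y = y <? 0#

  supply demand : Fin n → Carrier
  supply v = when (positive? (b v)) (b v)
  demand v = when (negative? (b v)) (- b v)

  negate-pos : ∀ {y} → y < 0# → 0# < - y
  negate-pos {y} (p , q) = +-cancelʳ-≤ y (≤-trans (≤-reflexive (+-identityˡ y)) (≤-trans p (≤-reflexive (≈-sym (-‿inverseˡ y))))) ,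
    λ e → q (≈-trans (≈-trans (≈-sym (+-identityˡ y)) (+-congʳ e)) (-‿inverseˡ y))

  supply≥0 : ∀ v → 0# ≤ supply v
  supply≥0 v with positive? (b v)
  ... | yes (p , _) = p
  ... | no _        = ≤-refl

  demand≥0 : ∀ v → 0# ≤ demand v
  demand≥0 v with negative? (b v)
  ... | yes p = proj₁ (negate-pos p)
  ... | no _  = ≤-refl

  not-both : ∀ {y} → 0# < y → ¬ y < 0#
  not-both p q = <⇒≱ p (proj₁ q)

  source-demand : ∀ {v} → 0# < b v → demand v ≈ 0#
  source-demand {v} p = ≈-reflexive (when-no (negative? (b v)) (not-both p))

  sink-supply : ∀ {v} → b v < 0# → supply v ≈ 0#
  sink-supply {v} p = ≈-reflexive (when-no (positive? (b v)) (λ q → not-both q p))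

  split-b : ∀ v → supply v ≈ b v + demand v
  split-b v with positive? (b v) | negative? (b v)
  ... | yes p | yes q = contradiction q (not-both p)
  ... | yes p | no _  = ≈-sym (+-identityʳ _)
  ... | no _  | yes q = ≈-sym (-‿inverseʳ _)
  ... | no ¬p | no ¬q = ≈-sym (≈-trans (+-identityʳ _) zero-b)
    where
    zero-b : b v ≈ 0#
    zero-b with ≤⊎> 0# (b v)
    ... | inj₁ le = ≮⇒≈0 le ¬p
    ... | inj₂ lt = contradiction lt ¬q

  Δ : Carrier
  Δ = dmax b

  private
    module E = Data.List.Extrema totalOrder
    magnitudes : List Carrier
    magnitudes = map (λ t → ∣ b t ∣) (filter (λ t → b t <? 0#) (allFin n))

  0≤Δ : 0# ≤ Δ
  0≤Δ = E.⊥≤max 0# magnitudes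

  magnitude : ∀ {t} → b t < 0# → ∣ b t ∣ ≈ - b t
  magnitude {t} p = x≤y⇒x⊔y≈y (≤-trans (proj₁ p) (proj₁ (negate-pos p)))
    where open import Algebra.Construct.NaturalChoice.Max totalOrder using (x≤y⇒x⊔y≈y)

  demand≤Δ : ∀ t → demand t ≤ Δ
  demand≤Δ t with negative? (b t)
  ... | no _  = 0≤Δ
  ... | yes p = ≤-trans (≤-reflexive (≈-sym (magnitude p)))
    (All.lookup (E.xs≤max 0# magnitudes) (∈-map⁺ (λ t → ∣ b t ∣) (∈-filter⁺ (λ t → b t <? 0#) (∈-allFin t) p)))

  cmin≤ : ∀ a → cmin c ≤ c a
  cmin≤ a = go (allFin m) (∈-allFin a)
    where
    go : ∀ as → a ∈ as → minimum (map c as) ≤ c a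
    go (f ∷ as) (here ≡.refl) = E.min≤⊤ (c f) (map c as)
    go (f ∷ as) (there p) = All.lookup (E.min≤xs (c f) (map c as)) (∈-map⁺ c p)

  2# half : Carrier
  2# = 1# + 1#
  half = 2# ⁻¹

  0<1 : 0# < 1#
  0<1 = 0≤1 , 0≉1

  0<2 : 0# < 2#
  0<2 = <-≤-trans 0<1 (x≤x+y 0≤1)

  half-2 : half * 2# ≈ 1#
  half-2 = ≈-trans (*-comm _ _) (⁻¹-inverseʳ 2# (λ e → proj₂ 0<2 (≈-sym e)))

  half+half : half + half ≈ 1#
  half+half = ≈-trans (≈-sym (≈-trans (distribˡ half 1# 1#) (+-cong (*-identityʳ _) (*-identityʳ _)))) half-2

  0≤half : 0# ≤ half
  0≤half with ≤⊎> 0# half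
  ... | inj₁ p = p
  ... | inj₂ (q , _) = contradiction 0<1 (λ p → <⇒≱ p (begin
    1# ≈⟨ half+half ⟨
    half + half ≤⟨ +-mono-≤ q q ⟩
    0# + 0# ≈⟨ +-identityˡ 0# ⟩
    0# ∎))

  module _ (dmax≤ : dmax b ≤ cmin c / 4#) where

    4Δ≤ : ∀ a → 4# * Δ ≤ c a
    4Δ≤ a = begin
      4# * Δ ≤⟨ *-monoˡ-≤ (proj₁ 0<4) dmax≤ ⟩
      4# * (cmin c * 4# ⁻¹) ≈⟨ solve 3 (λ f k i → f :* (k :* i) := k :* (f :* i)) ≈-refl 4# (cmin c) (4# ⁻¹) ⟩
      cmin c * (4# * 4# ⁻¹) ≈⟨ *-congˡ (⁻¹-inverseʳ 4# (λ e → proj₂ 0<4 (≈-sym e))) ⟩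
      cmin c * 1# ≈⟨ *-identityʳ _ ⟩
      cmin c ≤⟨ cmin≤ a ⟩
      c a ∎
      where
      0<4 : 0# < 4#
      0<4 = <-≤-trans (<-≤-trans 0<2 (x≤x+y 0≤1)) (x≤x+y 0≤1)

    room : ∀ {a y} → y ≤ c a → half * y + Δ + Δ ≤ c a
    room {a} {y} le = begin
      half * y + Δ + Δ ≈⟨ +-assoc _ _ _ ⟩
      half * y + (Δ + Δ) ≈⟨ +-congˡ double ⟨
      half * y + half * (4# * Δ) ≤⟨ +-mono-≤ (*-monoˡ-≤ 0≤half le) (*-monoˡ-≤ 0≤half (4Δ≤ a)) ⟩
      half * c a + half * c a ≈⟨ distribʳ (c a) half half ⟨
      (half + half) * c a ≈⟨ ≈-trans (*-congʳ half+half) (*-identityˡ _) ⟩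
      c a ∎
      where
      double : half * (4# * Δ) ≈ Δ + Δ
      double = begin-equality
        half * (4# * Δ) ≈⟨ solve 3 (λ o h d → h :* ((o :+ o :+ o :+ o) :* d) := (h :* (o :+ o)) :* (d :+ d)) ≈-refl 1# half Δ ⟩
        (half * 2#) * (Δ + Δ) ≈⟨ *-congʳ half-2 ⟩
        1# * (Δ + Δ) ≈⟨ *-identityˡ _ ⟩
        Δ + Δ ∎

  module _ (x : Fin m → Carrier) (tr : IsTransshipment D b x) where
    open CopyFlow ℝ D half using (X; flowOf; conserve-all)

    private
      opaque
        unfolding at ∑
        out-def : ∀ (y : Fin m → Carrier) v → outflow D y v ≡ at tail y v
        out-def y v = ≡.refl
        in-def : ∀ (y : Fin m → Carrier) v → inflow D y v ≡ at head y v
        in-def y v = ≡.refl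

    balance-x : ∀ v → at head x v + supply v ≈ at tail x v + demand v
    balance-x v = begin-equality
      at head x v + supply v ≈⟨ +-congˡ (split-b v) ⟩
      at head x v + (b v + demand v) ≈⟨ +-assoc _ _ _ ⟨
      (at head x v + b v) + demand v ≈⟨ +-congʳ (≈-trans (+-comm _ _) (+-congʳ (≈-sym net))) ⟩
      ((at tail x v - at head x v) + at head x v) + demand v ≈⟨ +-congʳ (minus-plus _ _) ⟩
      at tail x v + demand v ∎
      where
      net : at tail x v - at head x v ≈ b v
      net = ≡.subst₂ (λ o i → o - i ≈ b v) (out-def x v) (in-def x v) (IsTransshipment.balanced tr v)

    X₀ : Fin K → Carrier
    X₀ = X x supply demand

    X₀≥0 : ∀ e → 0# ≤ X₀ e
    X₀≥0 e = go (proj₂ (code e))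
      where
      go : ∀ k → 0# ≤ flowOf x supply demand k
      go (real a)  = *-nonNeg 0≤half (IsTransshipment.nonNegative tr a)
      go (feed v)  = *-nonNeg 0≤half (supply≥0 v)
      go (drain v) = *-nonNeg 0≤half (demand≥0 v)

    X₀-arc : ∀ j a → X₀ (arc j a) ≡ half * x a
    X₀-arc j a = ≡.cong (flowOf x supply demand ∘ proj₂) (code-arc j a)

    module _ (y : Fin K → Carrier) (y≥0 : ∀ e → 0# ≤ y e) (net : SameNet tl hd X₀ y)
             (rank : Fin N → ℕ) (ranked : ∀ e → 0# < y e → rank (tl e) ℕ.< rank (hd e)) where
      open Rounding ℝ {N} {K} {n} {n} tl hd layer rank Δ

      -- All terminals stand at demand vertices, so `com` holds a default: a terminal that never
      -- leaves its demand vertex, being served by advancing supply alone, ends up on side `false`.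
      initial : State
      initial = record
        { x = y ; sup = supply ; dem = demand ; sp = vertex 2F ; tp = vertex 3F ; flag = λ _ → false ; com = λ _ → false
        ; x≥0 = y≥0 ; sup≥0 = supply≥0 ; dem≥0 = demand≥0 ; dem≤Δ = demand≤Δ
        ; conserve = conserve
        ; ranked = ranked
        ; flag-unique = λ () ; flag-closed = λ () ; regular = λ () ; one-irregular = λ ()
        ; alone = λ {t} {u} _ e → vertex-injective 3F t u e
        ; committed = λ {t} l → contradiction (≡.trans (≡.sym (layer-vertex 3F t)) l) λ ()
        }
        where
        conserve : ∀ w → at hd y w + at (vertex 2F) supply w ≈ at tl y w + at (vertex 3F) demand w
        conserve w = +-cancelʳ (at tl X₀ w) (begin-equality
          (H + P) + L₀ ≈⟨ solve 3 (λ h p l → (h :+ p) :+ l := (l :+ h) :+ p) ≈-refl H P L₀ ⟩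
          (L₀ + H) + P ≈⟨ +-congʳ (net w) ⟨
          (L′ + H₀) + P ≈⟨ +-assoc _ _ _ ⟩
          L′ + (H₀ + P) ≈⟨ +-congˡ (conserve-all x supply demand half+half balance-x w) ⟩
          L′ + (L₀ + Q) ≈⟨ solve 3 (λ l m q → l :+ (m :+ q) := (l :+ q) :+ m) ≈-refl L′ L₀ Q ⟩
          (L′ + Q) + L₀ ∎)
          where
          H H₀ L′ L₀ P Q : Carrier
          H = at hd y w
          H₀ = at hd X₀ w
          L′ = at tl y w
          L₀ = at tl X₀ w
          P = at (vertex 2F) supply w
          Q = at (vertex 3F) demand w

      -- Feeds and drains join vertices with the same base and disappear. For every remaining arc
      -- the projection records that one of its two copies lies on the route, which is all that the
      -- load bounds need.
      project : ∀ u r w → IsWalk u r w →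
        Σ[ q ∈ Walk (base u) (base w) ] (∀ {a} → a ∈ arcs q → arc false a ∈ r ⊎ arc true a ∈ r)
      project u [] w ≡.refl = ε , λ ()
      project u (e ∷ r) w (t , rest) with project (hd e) r w rest
      ... | q , sub = go (code e) ≡.refl
        where
        Goal : Set
        Goal = Σ[ q ∈ Walk (base u) (base w) ] (∀ {a} → a ∈ arcs q → arc false a ∈ e ∷ r ⊎ arc true a ∈ e ∷ r)
        later : ∀ {a} → a ∈ arcs q → arc false a ∈ e ∷ r ⊎ arc true a ∈ e ∷ r
        later = Sum.map there there ∘ sub
        stay : base (hd e) ≡ base u → Goal
        stay eq = ≡.subst (λ v → Σ[ q ∈ Walk v (base w) ] (∀ {a} → a ∈ arcs q → arc false a ∈ e ∷ r ⊎ arc true a ∈ e ∷ r)) eq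
          (q , later)
        base-tl : ∀ {k} → code e ≡ k → base u ≡ proj₂ (tailOf k)
        base-tl ≡.refl = ≡.trans (≡.cong base (≡.sym t)) (base-vertex (proj₁ (tailOf (code e))) _)
        base-hd : ∀ {k} → code e ≡ k → base (hd e) ≡ proj₂ (headOf k)
        base-hd ≡.refl = base-vertex (proj₁ (headOf (code e))) _
        go : ∀ k → code e ≡ k → Goal
        go (j , feed v)  eq = stay (≡.trans (base-hd eq) (≡.sym (base-tl eq)))
        go (j , drain v) eq = stay (≡.trans (base-hd eq) (≡.sym (base-tl eq)))
        go (j , real a)  eq = (a , ≡.sym (base-tl eq) , ≡.sym (base-hd eq)) ◅ q , λ { (here ≡.refl) → now j (arc-code e eq) ; (there p) → later p }
          where
          now : ∀ j {a} → e ≡ arc j a → arc false a ∈ e ∷ r ⊎ arc true a ∈ e ∷ r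
          now false p = inj₁ (here (≡.sym p))
          now true  p = inj₂ (here (≡.sym p))

      ∈⇒1≤count : ∀ {e r} → e ∈ r → 1# ≤ count e r
      ∈⇒1≤count {e} {f ∷ r} (here ≡.refl) = ≤-trans (≤-reflexive (≈-reflexive (≡.sym (when-yes (e Fin.≟ e) ≡.refl)))) (x≤x+y (count-nonNeg e r))
      ∈⇒1≤count {e} {f ∷ r} (there p) = ≤-trans (∈⇒1≤count p) (y≤x+y (when-nonNeg (e Fin.≟ f) 0≤1))

      -- Rounds read off from a solution.

      module _ (sol : Solution initial) where
        open Solution sol
        open DecMembership (Fin._≟_ {m}) using (_∈?_)

        -- Numbers of rounds, not kinds of vertices: `2F` and `3F` are left empty.
        classOf : Bool → Fin 4
        classOf false = 0F
        classOf true  = 1F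

        round : Fin n → Fin 4
        round t = classOf (side t)

        path : ∀ {s t} → 0# < z s t →
          Σ[ p ∈ Path s t ] (∀ {a} → a ∈ arcs (Path.walk p) → arc false a ∈ route s t ⊎ arc true a ∈ route s t)
        path {s} {t} pos with project (vertex 2F s) (route s t) (vertex 3F t) (connects pos)
        ... | q , sub with ≡.subst₂ (λ u v → Σ[ q ∈ Walk u v ] (∀ {a} → a ∈ arcs q → arc false a ∈ route s t ⊎ arc true a ∈ route s t))
                             (base-vertex 2F s) (base-vertex 3F t) (q , sub)
        ...   | q′ , sub′ with erase q′
        ...     | p , sub″ = p , sub′ ∘ sub″

        share : Fin 4 → Fin n → Fin n → Carrier
        share i s t = when (round t Fin.≟ i) (z s t)

        share≥0 : ∀ i s t → 0# ≤ share i s t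
        share≥0 i s t = when-nonNeg (round t Fin.≟ i) (z≥0 s t)

        sent received : Fin 4 → Fin n → Carrier
        sent     i s = ∑ λ t → share i s t
        received i t = ∑ λ s → share i s t

        balanceOf : Fin 4 → Fin n → Carrier
        balanceOf i v = sent i v - received i v

        received-eq : ∀ i t → received i t ≈ when (round t Fin.≟ i) (demand t)
        received-eq i t = ≈-trans (≈-sym (when-∑ (round t Fin.≟ i) _)) (when-cong (round t Fin.≟ i) λ _ → delivered t)

        sent≥0 : ∀ i s → 0# ≤ sent i s
        sent≥0 i s = ∑-nonNeg (share≥0 i s)

        received≥0 : ∀ i t → 0# ≤ received i t
        received≥0 i t = ∑-nonNeg λ s → share≥0 i s t

        sent≤ : ∀ i s → sent i s ≤ supply s
        sent≤ i s = ≤-trans (∑-mono λ t → when≤ (round t Fin.≟ i) (z≥0 s t)) (≤-reflexive (shipped s))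

        received≤ : ∀ i t → received i t ≤ demand t
        received≤ i t = ≤-trans (≤-reflexive (received-eq i t)) (when≤ (round t Fin.≟ i) (demand≥0 t))

        sent⇒source : ∀ {i s} → 0# < sent i s → 0# < b s
        sent⇒source {i} {s} p = proj₁ (when-pos (positive? (b s)) (<-≤-trans p (sent≤ i s)))

        received⇒sink : ∀ {i t} → 0# < received i t → round t ≡ i × b t < 0#
        received⇒sink {i} {t} p with when-pos (round t Fin.≟ i) (<-≤-trans p (≤-reflexive (received-eq i t)))
        ... | eq , q = eq , proj₁ (when-pos (negative? (b t)) q)

        source-received : ∀ i {s} → 0# < b s → received i s ≈ 0#
        source-received i {s} p = ≤-antisym (≤-trans (received≤ i s) (≤-reflexive (source-demand p))) (received≥0 i s)

        sink-sent : ∀ i {t} → b t < 0# → sent i t ≈ 0#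
        sink-sent i {t} p = ≤-antisym (≤-trans (sent≤ i t) (≤-reflexive (sink-supply p))) (sent≥0 i t)

        source⇒ : ∀ {i s} → 0# < balanceOf i s → 0# < sent i s
        source⇒ {i} {s} p = <-≤-trans p (x-y≤x (received≥0 i s))

        ⇒source : ∀ {i s} → 0# < sent i s → 0# < balanceOf i s
        ⇒source {i} {s} p = <-≤-trans p (≤-reflexive (≈-sym (+-minus (≈-sym
          (≈-trans (+-congˡ (source-received i (sent⇒source p))) (+-identityʳ _))))))

        sink⇒ : ∀ {i t} → balanceOf i t < 0# → 0# < received i t
        sink⇒ {i} {t} (p , q) = received≥0 i t , λ e → <⇒≱ (p , q) (begin
          0# ≤⟨ sent≥0 i t ⟩
          sent i t ≈⟨ minus-plus _ _ ⟨
          balanceOf i t + received i t ≈⟨ +-congˡ e ⟨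
          balanceOf i t + 0# ≈⟨ +-identityʳ _ ⟩
          balanceOf i t ∎)

        ⇒sink : ∀ {i t} → 0# < received i t → balanceOf i t < 0#
        ⇒sink {i} {t} p = +-cancelʳ-≤ (received i t) (≤-trans (≤-reflexive back) (≤-trans (proj₁ p) (≤-reflexive (≈-sym (+-identityˡ _))))) ,
          λ e → proj₂ p (≈-trans (≈-sym back) (≈-trans (+-congʳ e) (+-identityˡ _)))
          where
          back : balanceOf i t + received i t ≈ 0#
          back = ≈-trans (minus-plus _ _) (sink-sent i (proj₂ (received⇒sink p)))

        pick : ∀ i {s t} → Dec (round t ≡ i) → Dec (0# < z s t) → Maybe (PathFlow D s t)
        pick i {s} {t} (yes _) (yes p) = just (record { path = proj₁ (path p) ; value = z s t ; positive = p })
        pick i         (yes _) (no _)  = nothing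
        pick i         (no _)  _       = nothing

        routeOf : Fin 4 → ∀ s t → Maybe (PathFlow D s t)
        routeOf i s t = pick i (round t Fin.≟ i) (positive? (z s t))

        on : Fin 4 → Fin n → Fin n → Fin m → Carrier
        on i s t a = maybe′ (λ p → PathFlow.flowOn p a) 0# (routeOf i s t)

        flowIn : Fin 4 → Fin m → Carrier
        flowIn i a = sum λ s → sum λ t → on i s t a

        opaque
          unfolding ∑
          ∑∑-def : ∀ (f : Fin n → Fin n → Carrier) → sum (λ s → sum (f s)) ≡ ∑ (λ s → ∑ (f s))
          ∑∑-def f = ≡.refl

        amount-eq : ∀ i s t → maybe′ PathFlow.value 0# (routeOf i s t) ≈ share i s t
        amount-eq i s t with round t Fin.≟ i | positive? (z s t)
        ... | yes _ | yes _ = ≈-refl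
        ... | yes _ | no ¬p = ≈-sym (≮⇒≈0 (z≥0 s t) ¬p)
        ... | no _  | _     = ≈-refl

        zeros : ∀ v → at tail (λ _ → 0#) v ≈ at head (λ _ → 0#) v
        zeros v = ≈-trans (at-zero λ _ _ → ≈-refl) (≈-sym (at-zero λ _ _ → ≈-refl))

        on-net : ∀ i s t v → at tail (on i s t) v + when (t Fin.≟ v) (share i s t) ≈ at head (on i s t) v + when (s Fin.≟ v) (share i s t)
        on-net i s t v with round t Fin.≟ i | positive? (z s t)
        ... | yes _ | yes p = PathNet.path-net ℝ D (Path.walk (proj₁ (path p))) (Path.simple (proj₁ (path p))) (z s t) v
        ... | yes _ | no ¬p = +-cong (zeros v) (≈-trans (when-≈0 (t Fin.≟ v) λ _ → ≮⇒≈0 (z≥0 s t) ¬p) (≈-sym (when-≈0 (s Fin.≟ v) λ _ → ≮⇒≈0 (z≥0 s t) ¬p)))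
        ... | no _  | _     = +-cong (zeros v) (≈-trans (when-0 (t Fin.≟ v)) (≈-sym (when-0 (s Fin.≟ v))))

        flow-net : ∀ i v → at tail (flowIn i) v + received i v ≈ at head (flowIn i) v + sent i v
        flow-net i v = begin-equality
          at tail (flowIn i) v + received i v
            ≈⟨ +-cong (total tail) (∑-cong λ s → ∑-pick v (share i s)) ⟨
          ∑ (λ s → ∑ λ t → at tail (on i s t) v) + ∑ (λ s → ∑ λ t → when (t Fin.≟ v) (share i s t))
            ≈⟨ merge (λ s t → at tail (on i s t) v) (λ s t → when (t Fin.≟ v) (share i s t)) ⟨
          ∑ (λ s → ∑ λ t → at tail (on i s t) v + when (t Fin.≟ v) (share i s t))
            ≈⟨ ∑-cong (λ s → ∑-cong λ t → on-net i s t v) ⟩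
          ∑ (λ s → ∑ λ t → at head (on i s t) v + when (s Fin.≟ v) (share i s t))
            ≈⟨ merge (λ s t → at head (on i s t) v) (λ s t → when (s Fin.≟ v) (share i s t)) ⟩
          ∑ (λ s → ∑ λ t → at head (on i s t) v) + ∑ (λ s → ∑ λ t → when (s Fin.≟ v) (share i s t))
            ≈⟨ +-cong (total head) (≈-trans (∑-cong λ s → ≈-sym (when-∑ (s Fin.≟ v) _)) (∑-pick v (sent i))) ⟩
          at head (flowIn i) v + sent i v ∎
          where
          merge : ∀ (f g : Fin n → Fin n → Carrier) →
            ∑ (λ s → ∑ λ t → f s t + g s t) ≈ ∑ (λ s → ∑ (f s)) + ∑ (λ s → ∑ (g s))
          merge f g = ≈-trans (∑-cong λ s → ∑-+ (f s) (g s)) (∑-+ _ _)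
          total : ∀ g → ∑ (λ s → ∑ λ t → at g (on i s t) v) ≈ at g (flowIn i) v
          total g = ≈-sym (≈-trans (at-cong (λ a → ≈-reflexive (∑∑-def λ s t → on i s t a)) v) (≈-trans (at-∑ _ v) (∑-cong λ s → at-∑ (on i s) v)))

        on≥0 : ∀ i s t a → 0# ≤ on i s t a
        on≥0 i s t a with round t Fin.≟ i | positive? (z s t)
        ... | yes _ | yes p = when-nonNeg (a ∈? arcs (Path.walk (proj₁ (path p)))) (z≥0 s t)
        ... | yes _ | no _  = ≤-refl
        ... | no _  | _     = ≤-refl

        isTransshipment : ∀ i → IsTransshipment D (balanceOf i) (flowIn i)
        isTransshipment i = record
          { nonNegative = λ a → ≤-trans (∑-nonNeg λ s → ∑-nonNeg λ t → on≥0 i s t a) (≤-reflexive (≈-reflexive (≡.sym (∑∑-def λ s t → on i s t a))))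
          ; balanced = λ v → ≡.subst₂ (λ o i′ → o - i′ ≈ balanceOf i v) (≡.sym (out-def (flowIn i) v)) (≡.sym (in-def (flowIn i) v)) (net′ v)
          }
          where
          net′ : ∀ v → at tail (flowIn i) v - at head (flowIn i) v ≈ balanceOf i v
          net′ v = +-minus (+-cancelʳ (received i v) (begin-equality
            at tail (flowIn i) v + received i v ≈⟨ flow-net i v ⟩
            at head (flowIn i) v + sent i v ≈⟨ +-congˡ (minus-plus _ _) ⟨
            at head (flowIn i) v + (balanceOf i v + received i v) ≈⟨ solve 3 (λ h k r → h :+ (k :+ r) := (k :+ h) :+ r) ≈-refl (at head (flowIn i) v) (balanceOf i v) (received i v) ⟩
            (balanceOf i v + at head (flowIn i) v) + received i v ∎))

        source–sink : ∀ i s t → Is-just (routeOf i s t) → Source (balanceOf i) s × Sink (balanceOf i) t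
        source–sink i s t j = ⇒source (∑-pos (share≥0 i s) t pos) , ⇒sink (∑-pos (λ s → share≥0 i s t) s pos)
          where
          used : Is-just (routeOf i s t) → 0# < share i s t
          used with round t Fin.≟ i | positive? (z s t)
          ... | yes _ | yes p = λ _ → p
          ... | yes _ | no _  = λ ()
          ... | no _  | _     = λ ()
          pos : 0# < share i s t
          pos = used j

        transshipment : ∀ i → UnsplittableTransshipment D (balanceOf i)
        transshipment i = record
          { flow = flowIn i
          ; isTransshipment = isTransshipment i
          ; route = routeOf i
          ; source–sink = source–sink i
          ; decomposition = λ a → ≈-refl
          }

        sum-amounts : ∀ {k} (f g : Fin k → Carrier) → (∀ i → f i ≈ g i) → sum f ≈ ∑ g
        sum-amounts f g p = ≈-trans (≈-reflexive (≡.sym (∑-def f))) (∑-cong p)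

        bound≥0 : ∀ j a s t → 0# ≤ (1# * z s t) * count (arc j a) (route s t) + (not-on (not j) side t * z s t) * count (arc (not j) a) (route s t)
        bound≥0 j a s t = +-nonNeg (*-nonNeg (*-nonNeg 0≤1 (z≥0 s t)) (count-nonNeg _ (route s t)))
          (*-nonNeg (*-nonNeg (not-on-nonNeg (not j) side t) (z≥0 s t)) (count-nonNeg _ (route s t)))

        module _ (y≤X₀ : ∀ e → y e ≤ X₀ e) (x≤c : ∀ a → x a ≤ c a) (dmax≤ : dmax b ≤ cmin c / 4#) where

          -- An arc on the path of a sink of side `j` comes from a route through its copy in `j` or
          -- in `not j`. The first case counts towards the load of `arc j a`; in the second the sink
          -- is not on side `not j`, so its weight is 1 in the crossing load of `arc (not j) a`.
          -- Summation bounds the round by `load≤` and `crossing`.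
          on≤ : ∀ j a s t → on (classOf j) s t a ≤
            (1# * z s t) * count (arc j a) (route s t) + (not-on (not j) side t * z s t) * count (arc (not j) a) (route s t)
          on≤ j a s t with round t Fin.≟ classOf j | positive? (z s t)
          ... | no _  | _      = bound≥0 j a s t
          ... | yes _ | no _   = bound≥0 j a s t
          ... | yes eq | yes p with a ∈? arcs (Path.walk (proj₁ (path p)))
          ...   | no _   = bound≥0 j a s t
          ...   | yes a∈ = begin
            z s t ≈⟨ *-identityʳ _ ⟨
            z s t * 1# ≤⟨ *-monoˡ-≤ (z≥0 s t) (used j (proj₂ (path p) a∈)) ⟩
            z s t * (count (arc j a) (route s t) + count (arc (not j) a) (route s t))
              ≈⟨ distribˡ _ _ _ ⟩
            z s t * count (arc j a) (route s t) + z s t * count (arc (not j) a) (route s t)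
              ≈⟨ +-cong (*-congʳ (≈-sym (*-identityˡ _))) (*-congʳ (≈-trans (≈-sym (*-identityˡ _)) (*-congʳ (≈-sym counted)))) ⟩
            (1# * z s t) * count (arc j a) (route s t) + (not-on (not j) side t * z s t) * count (arc (not j) a) (route s t) ∎
            where
            used : ∀ j → arc false a ∈ route s t ⊎ arc true a ∈ route s t →
              1# ≤ count (arc j a) (route s t) + count (arc (not j) a) (route s t)
            used false (inj₁ q) = ≤-trans (∈⇒1≤count q) (x≤x+y (count-nonNeg _ (route s t)))
            used false (inj₂ q) = ≤-trans (∈⇒1≤count q) (y≤x+y (count-nonNeg _ (route s t)))
            used true  (inj₁ q) = ≤-trans (∈⇒1≤count q) (y≤x+y (count-nonNeg _ (route s t)))
            used true  (inj₂ q) = ≤-trans (∈⇒1≤count q) (x≤x+y (count-nonNeg _ (route s t)))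
            same-side : ∀ i j → classOf i ≡ classOf j → i ≢ not j
            same-side false false _ ()
            same-side true  true  _ ()
            same-side false true  ()
            same-side true  false ()
            counted : not-on (not j) side t ≈ 1#
            counted with side t Bool.≟ not j
            ... | yes e = contradiction e (same-side (side t) j eq)
            ... | no _  = ≈-refl

          feasible : ∀ i a → flowIn i a ≤ c a
          feasible i a with isClass i
            where
            isClass : ∀ i → (∃[ j ] i ≡ classOf j) ⊎ (∀ j → classOf j ≢ i)
            isClass 0F = inj₁ (false , ≡.refl)
            isClass 1F = inj₁ (true , ≡.refl)
            isClass 2F = inj₂ λ { false () ; true () }
            isClass 3F = inj₂ λ { false () ; true () }
          ... | inj₁ (j , ≡.refl) = begin
            flowIn (classOf j) a
              ≈⟨ ≈-reflexive (∑∑-def λ s t → on (classOf j) s t a) ⟩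
            ∑ (λ s → ∑ λ t → on (classOf j) s t a)
              ≤⟨ ∑-mono (λ s → ∑-mono λ t → on≤ j a s t) ⟩
            ∑ (λ s → ∑ λ t → (1# * z s t) * count (arc j a) (route s t) + (not-on (not j) side t * z s t) * count (arc (not j) a) (route s t))
              ≈⟨ ≈-trans (∑-cong λ s → ∑-+ _ _) (∑-+ _ _) ⟩
            load z route all-sinks (arc j a) + load z route (not-on (not j) side) (arc (not j) a)
              ≤⟨ +-mono-≤ (load≤ (arc j a)) (crossing (arc (not j) a) (layer-arc (not j) a)) ⟩
            (y (arc j a) + Δ) + Δ
              ≤⟨ +-monoˡ-≤ Δ (+-monoˡ-≤ Δ (≤-trans (y≤X₀ (arc j a)) (≤-reflexive (≈-reflexive (X₀-arc j a))))) ⟩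
            half * x a + Δ + Δ
              ≤⟨ room dmax≤ (x≤c a) ⟩
            c a ∎
          ... | inj₂ ne = begin
            flowIn i a ≈⟨ ≈-reflexive (∑∑-def λ s t → on i s t a) ⟩
            ∑ (λ s → ∑ λ t → on i s t a) ≈⟨ ∑-zero (λ s → ∑-zero λ t → off s t) ⟩
            0# ≤⟨ IsTransshipment.nonNegative tr a ⟩
            x a ≤⟨ x≤c a ⟩
            c a ∎
            where
            off : ∀ s t → on i s t a ≈ 0#
            off s t with round t Fin.≟ i
            ... | yes e = contradiction e (ne (side t))
            ... | no _  = ≈-refl

          routable : RoutableInRounds D c b 4
          routable = record
            { round = round
            ; balance = balanceOf
            ; transshipment = transshipment
            ; feasible = feasible
            ; sources = λ i s p → sent⇒source (source⇒ p)
            ; sinks = λ i t → mk⇔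
                (λ p → proj₂ (received⇒sink (sink⇒ p)) , proj₁ (received⇒sink (sink⇒ p)))
                (λ (p , eq) → ⇒sink (receives p eq))
            ; fullDemand = fullDemand
            ; fullSupply = fullSupply
            }
            where
            receives : ∀ {i t} → b t < 0# → round t ≡ i → 0# < received i t
            receives {i} {t} p eq = <-≤-trans (negate-pos p) (≤-reflexive (≈-sym (≈-trans (received-eq i t)
              (≈-reflexive (≡.trans (when-yes (round t Fin.≟ i) eq) (when-yes (negative? (b t)) p))))))
            fullDemand : ∀ i t → Sink (balanceOf i) t → UnsplittableTransshipment.deliveredTo (transshipment i) t ≈ ∣ b t ∣
            fullDemand i t p with received⇒sink (sink⇒ p)
            ... | eq , q = ≈-trans (sum-amounts _ (λ s → share i s t) (λ s → amount-eq i s t)) (≈-trans (received-eq i t)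
              (≈-trans (≈-reflexive (≡.trans (when-yes (round t Fin.≟ i) eq) (when-yes (negative? (b t)) q))) (≈-sym (magnitude q))))
            fullSupply : ∀ s → Source b s → sum (λ i → UnsplittableTransshipment.sentFrom (transshipment i) s) ≈ b s
            fullSupply s p = begin-equality
              sum (λ i → UnsplittableTransshipment.sentFrom (transshipment i) s)
                ≈⟨ sum-amounts _ (λ i → sent i s) (λ i → sum-amounts _ (share i s) (amount-eq i s)) ⟩
              ∑ (λ i → ∑ λ t → share i s t) ≈⟨ ∑-swap _ ⟩
              ∑ (λ t → ∑ λ i → when (round t Fin.≟ i) (z s t)) ≈⟨ ∑-cong (λ t → ≈-trans (∑-cong λ i → ≈-reflexive
                                                                       (when-⇔ (round t Fin.≟ i) (i Fin.≟ round t) ≡.sym ≡.sym)) (∑-pick (round t) _)) ⟩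
              ∑ (λ t → z s t) ≈⟨ shipped s ⟩
              supply s ≈⟨ ≈-reflexive (when-yes (positive? (b s)) p) ⟩
              b s ∎

mainTheorem6 : (ℝ : RealNumbers) →
    let open RealNumbers ℝ
        open Transshipments ℝ
    in
    (n m : ℕ) (D : Digraph n m)
    (c : Fin m → Carrier) (b : Fin n → Carrier) →
    (∀ a → 0# ≤ c a) →
    sum b ≈ 0# →
    (∃[ x ] (IsTransshipment D b x × Feasible D c x)) →
    dmax b ≤ cmin c / 4# →
    RoutableInRounds D c b 4
mainTheorem6 ℝ n m D c b _ _ (x , tr , x≤c) dmax≤ =
  let open Routing ℝ D c b
      open CopyGraph D
      y , y≥0 , y≤X₀ , net , rank , ranked = Acyclic.acyclic ℝ tl hd (X₀ x tr) (X₀≥0 x tr)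
      σ = initial x tr y y≥0 net rank ranked
      solved = Algorithm.solution ℝ tl hd layer rank Δ 0≤Δ from-demand into-supply same-copy σ
  in routable x tr y y≥0 net rank ranked solved y≤X₀ x≤c dmax≤
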